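{- Let $n\ge 2$ and let $\lambda$ be a partition of $n$ with $\ell$ parts of size $1$, such that $(n)$ and $\lambda$ have the same parity. Then $$\| P_{(n),\lambda} - U_{A_n}\| \le \frac{\max\{1,\ell\}}{2\sqrt{n-1}}.$$ The same statement holds with $U_{A_n^c}$ in place of $U_{A_n}$ when $(n)$ and $\lambda$ have opposite parity.
   Context: $S_n$ is the symmetric group on $\{1,\dots,n\}$, $A_n$ the set of even permutations and $A_n^c$ the set of odd permutations in $S_n$. For a partition $\alpha$ of $n$, $C_\alpha$ is the conjugacy class of permutations of cycle type $\alpha$; $(n)$ denotes the class of full $n$-cycles. A partition is called even (odd) if the permutations of that cycle type are even (odd). For partitions $\alpha,\beta$ of $n$, $P_{\alpha,\beta}$ is the probability distribution on $S_n$ of $\pi\sigma$, where $\pi$ and $\sigma$ are chosen independently and uniformly at random from $C_\alpha$ and $C_\beta$ respectively. For $X\subseteq S_n$, $U_X$ is the uniform distribution on $X$. The total variation distance of distributions $P,Q$ on a finite set $X$ is $\|P-Q\| = \tfrac12\sum_{x\in X}|P(x)-Q(x)|$. -}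

module Defs where

open import Data.Bool using (Bool; true; false; _∧_; if_then_else_)
open import Data.Nat as ℕ using (ℕ; zero; suc; _≤_; _%_; _⊔_; _≡ᵇ_; _≤ᵇ_; _<ᵇ_)
open import Data.Fin using (Fin; toℕ)
open import Data.Fin.Properties using () renaming (_≟_ to _≟F_)
open import Data.List as L using (List; []; _∷_; [_]; _++_; allFin; upTo; concatMap; filterᵇ; length)
open import Data.Bool.ListAction using (all; any)
open import Data.Nat.ListAction using (sum)
open import Data.List.Relation.Unary.All using (All)
open import Data.Vec as V using (Vec; lookup; tabulate)
open import Data.Vec.Properties using (≡-dec)
open import Data.Integer using (+_)
open import Data.Rational as Q using (ℚ; 0ℚ; _/_)
open import Relation.Nullary.Decidable using (⌊_⌋)
open import Relation.Binary.PropositionalEquality using (_≡_)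

Perm : ℕ → Set
Perm n = Vec (Fin n) n

allVecs : (m k : ℕ) → List (Vec (Fin m) k)
allVecs m zero    = V.[] ∷ []
allVecs m (suc k) = concatMap (λ i → L.map (i V.∷_) (allVecs m k)) (allFin m)

_==F_ : ∀ {n} → Fin n → Fin n → Bool
i ==F j = ⌊ i ≟F j ⌋

isInjective : ∀ {n} → Perm n → Bool
isInjective {n} σ =
  all (λ i → all (λ j → if lookup σ i ==F lookup σ j then i ==F j else true) (allFin n)) (allFin n)

S : (n : ℕ) → List (Perm n)
S n = filterᵇ isInjective (allVecs n n)

_·_ : ∀ {n} → Perm n → Perm n → Perm n
π · σ = tabulate (λ i → lookup π (lookup σ i))

_==P_ : ∀ {n} → Perm n → Perm n → Bool
π ==P σ = ⌊ ≡-dec _≟F_ π σ ⌋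

inversions : ∀ {n} → Perm n → ℕ
inversions {n} σ =
  length (filterᵇ (λ p → (toℕ (Data.Product.proj₁ p) <ᵇ toℕ (Data.Product.proj₂ p))
                          ∧ (toℕ (lookup σ (Data.Product.proj₂ p)) <ᵇ toℕ (lookup σ (Data.Product.proj₁ p))))
                  (L.cartesianProduct (allFin n) (allFin n)))
  where import Data.Product

isEven : ∀ {n} → Perm n → Bool
isEven σ = (inversions σ % 2) ≡ᵇ 0

An : (n : ℕ) → List (Perm n)
An n = filterᵇ isEven (S n)

Anc : (n : ℕ) → List (Perm n)
Anc n = filterᵇ (λ σ → if isEven σ then false else true) (S n)

iter : ∀ {n} → Perm n → ℕ → Fin n → Fin n
iter σ zero    i = i
iter σ (suc k) i = lookup σ (iter σ k i)

orbitLen : ∀ {n} → Perm n → Fin n → ℕ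
orbitLen {n} σ i = go n 1
  where
  go : ℕ → ℕ → ℕ
  go zero    k = k
  go (suc f) k = if iter σ k i ==F i then k else go f (suc k)

isCycleMin : ∀ {n} → Perm n → Fin n → Bool
isCycleMin {n} σ i = all (λ k → toℕ i ≤ᵇ toℕ (iter σ k i)) (upTo (suc n))

-- cycle type of σ: the list of its cycle lengths (one entry per cycle,
-- including cycles of length 1), as a multiset (order irrelevant)
cycleType : ∀ {n} → Perm n → List ℕ
cycleType {n} σ = concatMap (λ i → if isCycleMin σ i then [ orbitLen σ i ] else []) (allFin n)

count : ℕ → List ℕ → ℕ
count k xs = length (filterᵇ (k ≡ᵇ_) xs)

-- equality of multisets of numbers ≤ n (all cycle lengths / parts are ≤ n)
sameMultiset : ℕ → List ℕ → List ℕ → Bool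
sameMultiset n xs ys = all (λ k → count k xs ≡ᵇ count k ys) (upTo (suc n))

-- Partitions of n: lists of positive integers summing to n (order irrelevant).

record IsPartition (n : ℕ) (λ′ : List ℕ) : Set where
  field
    positive : All (λ k → 1 ≤ k) λ′
    total    : sum λ′ ≡ n

C : (n : ℕ) → List ℕ → List (Perm n)
C n λ′ = filterᵇ (λ σ → sameMultiset n (cycleType σ) λ′) (S n)

EvenPartition : (n : ℕ) → List ℕ → Set
EvenPartition n λ′ = All (λ σ → isEven σ ≡ true) (C n λ′)

OddPartition : (n : ℕ) → List ℕ → Set
OddPartition n λ′ = All (λ σ → isEven σ ≡ false) (C n λ′)

ones : List ℕ → ℕ
ones = count 1

-- a / b as a rational, with the convention a / 0 = 0 (never used with b = 0 below)
frac : ℕ → ℕ → ℚ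
frac a zero    = 0ℚ
frac a (suc b) = (+ a) / suc b

sumℚ : List ℚ → ℚ
sumℚ = L.foldr Q._+_ 0ℚ

P : (n : ℕ) → List ℕ → List ℕ → Perm n → ℚ
P n α β x =
  frac (length (concatMap (λ π → filterᵇ (λ σ → (π · σ) ==P x) (C n β)) (C n α)))
       (length (C n α) ℕ.* length (C n β))

memberP : ∀ {n} → Perm n → List (Perm n) → Bool
memberP x X = any (x ==P_) X

U : (n : ℕ) → List (Perm n) → Perm n → ℚ
U n X x = if memberP x X then frac 1 (length X) else 0ℚ

TV : (n : ℕ) → (Perm n → ℚ) → (Perm n → ℚ) → ℚ
TV n p q = frac 1 2 Q.* sumℚ (L.map (λ x → Q.∣ p x Q.- q x ∣) (S n))

-- "d ≤ m / (2 √(n-1))" for d ≥ 0, n ≥ 2, stated without square roots: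
--   (2d)² · (n-1) ≤ m²
BoundedBy : ℚ → ℕ → ℕ → Set
BoundedBy d m n = ((frac 2 1 Q.* d) Q.* (frac 2 1 Q.* d)) Q.* frac (n ℕ.∸ 1) 1 Q.≤ frac (m ℕ.* m) 1

{-# OPTIONS --safe #-}

module Submission where

open import Defs
open import Data.Bool using (Bool; true; false; not; if_then_else_; T; _∧_)
import Data.Bool.Properties as Boolₚ
open import Data.Empty using (⊥-elim)
open import Data.Fin as Fin using (Fin; zero; suc; toℕ)
open import Data.Fin.Permutation.Components using (transpose)
open import Data.Fin.Properties as Finₚ using (_≟_)
open import Data.Integer using (ℤ; -_; _+_; _-_; _*_; ∣_∣; 0ℤ; 1ℤ; -1ℤ)
import Data.Integer as ℤ
import Data.Integer.Properties as ℤₚ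
open import Data.Integer.Tactic.RingSolver using (solve-∀)
open import Data.List as List using (List; []; _∷_; [_]; _++_; allFin; upTo; filterᵇ; length; concatMap; cartesianProduct)
open import Data.List.Membership.Propositional using (_∈_)
import Data.List.Membership.Propositional.Properties as ∈ₚ
import Data.List.Properties as Listₚ
open import Data.List.Relation.Unary.All as All using (All)
import Data.List.Relation.Unary.All.Properties as Allₚ
open import Data.List.Relation.Unary.AllPairs using ([]; _∷_)
import Data.List.Relation.Unary.AllPairs.Properties as AllPairsₚ
open import Data.List.Relation.Unary.Any as Any using (Any; here; there)
import Data.List.Relation.Unary.Any.Properties as Anyₚ
open import Data.List.Relation.Unary.Unique.Propositional using (Unique)
import Data.List.Relation.Unary.Unique.Propositional.Properties as Uniqueₚ
open import Data.Nat as ℕ using (ℕ; zero; suc; _≤_; _⊔_)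
import Data.Nat.DivMod as ℕD
open import Data.Nat.ListAction using (sum)
import Data.Nat.Properties as ℕₚ
import Data.Nat.Tactic.RingSolver as ℕR
open import Data.Product using (_×_; _,_; proj₁; proj₂; ∃; ∃₂)
open import Data.Rational as ℚ using (ℚ; 0ℚ; toℚᵘ)
import Data.Rational.Properties as ℚₚ
open import Data.Rational.Unnormalised as ℚᵘ using (mkℚᵘ; *≡*; *≤*) renaming (_≃_ to _≃ᵘ_)
import Data.Rational.Unnormalised.Properties as ℚᵘₚ
open import Data.Sum using (_⊎_; inj₁; inj₂; [_,_]′)
open import Data.Vec as Vec using (Vec; []; _∷_; lookup; tabulate)
import Data.Vec.Properties as Vecₚ
open import Function using (_∘_; id)
open import Relation.Binary.Definitions using (DecidableEquality; tri<; tri≈; tri>)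
open import Relation.Binary.PropositionalEquality using (_≡_; _≢_; refl; sym; trans; cong; cong₂; subst; subst₂; module ≡-Reasoning)
open import Relation.Nullary using (¬_; Dec; yes; no; does; ¬?)
open import Relation.Nullary.Decidable using (⌊_⌋; map′; _×-dec_)

-- For A ⊆ {1, …, N}, n = N + 1, let F A x be the sign of the permutation that agrees with x on A and is the
-- identity outside A ∪ {0}, and 0 if there is none. F A is a matrix coefficient of a hook representation: by von
-- Neumann's lemma Σ_y F A (x y z y⁻¹) = F A x · R A z with R A z = Σ_y F A (y z y⁻¹).
--
-- The alternating sum Σ_A (-1)^|A| F A x is the determinant of 1 - x with the row of the point 0 replaced by ones,
-- hence n if x is an n-cycle and 0 otherwise. So the number of ways to write x as an n-cycle times an element of C_λ
-- expands in the F A, and its second moment becomes a sum over n-cycles π, subsets A and σ, τ ∈ C_λ of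
-- (-1)^|A| F A π · R A σ · R A τ⁻¹ / (n · n!²). For fixed π only one A of each size contributes, with sign +1.
--
-- The sizes 0 and N give the uniform distribution. For the others, resampling one point of A (or of its complement)
-- gives |R A σ| / n! ≤ max(1, ℓ) / (max(|A|, N - |A|) + 1). The squares of these bounds telescope to 2 max(1, ℓ)² / N,
-- and Cauchy–Schwarz passes from the second moment to the total variation distance.

-- The origin of `F`: let e_0, ..., e_N be the permuted basis and u their sum, which every
-- permutation fixes. The vectors u ∧ e_A with 0 not in A are a basis of a copy of an exterior power
-- of the standard representation, and `F A x` is the coefficient of e_0 ∧ e_A in u ∧ x e_A. For
-- sets B without 0, e_0 ∧ e_B occurs in u ∧ e_A only if B = A, so these are diagonal matrix
-- entries. Those of one size add up to a character, and the alternating sum is det (1 - x) on the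
-- standard representation: the product of 1 - ζ over the n-th roots of unity ζ ≠ 1 for an n-cycle,
-- and 0 if x has a further cycle. Sizes 0 and N belong to the trivial and the sign representation.
-- Together they give at most 2 / n! to the second moment of P, which is that of the uniform
-- distribution on half of the group. The rest is at most (2 / n!) m² / N with m = max(1, ℓ), whence
-- (2 TV)² ≤ (n! / 2) Σ P² - 1 ≤ m² / N. The argument runs over the integers: n, n! and the sizes of
-- the classes are multiplied out, and fractions appear only in the distance itself.

private variable
  𝔸 𝔹 : Set
  Φ Ψ : Set
  n n′ N : ℕ

-- Finite sums and products

ι : Dec Φ → ℤ
ι d = if does d then 1ℤ else 0ℤ

ι-yes : (d : Dec Φ) → Φ → ι d ≡ 1ℤ
ι-yes (yes _) _ = refl
ι-yes (no ¬p) p = ⊥-elim (¬p p)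

ι-no : (d : Dec Φ) → ¬ Φ → ι d ≡ 0ℤ
ι-no (yes p) ¬p = ⊥-elim (¬p p)
ι-no (no _)  _  = refl

ι-cong : (d : Dec Φ) (e : Dec Ψ) → (Φ → Ψ) → (Ψ → Φ) → ι d ≡ ι e
ι-cong (yes p) e f _ = sym (ι-yes e (f p))
ι-cong (no ¬p) e _ g = sym (ι-no e (¬p ∘ g))

ι-nonneg : (d : Dec Φ) → 0ℤ ℤ.≤ ι d
ι-nonneg (yes _) = ℤ.+≤+ ℕ.z≤n
ι-nonneg (no _)  = ℤ.+≤+ ℕ.z≤n

∑ : List 𝔸 → (𝔸 → ℤ) → ℤ
∑ []       f = 0ℤ
∑ (x ∷ xs) f = f x + ∑ xs f

∑-cong∈ : {f g : 𝔸 → ℤ} (xs : List 𝔸) → (∀ {x} → x ∈ xs → f x ≡ g x) → ∑ xs f ≡ ∑ xs g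
∑-cong∈ []       h = refl
∑-cong∈ (x ∷ xs) h = cong₂ _+_ (h (here refl)) (∑-cong∈ xs (h ∘ there))

∑-cong : {f g : 𝔸 → ℤ} (xs : List 𝔸) → (∀ x → f x ≡ g x) → ∑ xs f ≡ ∑ xs g
∑-cong xs h = ∑-cong∈ xs (λ {x} _ → h x)

∑-const : (xs : List 𝔸) (c : ℤ) → ∑ xs (λ _ → c) ≡ ℤ.+ length xs * c
∑-const []       c = sym (ℤₚ.*-zeroˡ c)
∑-const (x ∷ xs) c = begin
  c + ∑ xs (λ _ → c)        ≡⟨ cong (c +_) (∑-const xs c) ⟩
  c + ℤ.+ length xs * c       ≡⟨ lemma c (ℤ.+ length xs) ⟩
  (1ℤ + ℤ.+ length xs) * c    ∎
  where
  open ≡-Reasoning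
  lemma : ∀ c l → c + l * c ≡ (1ℤ + l) * c
  lemma = solve-∀

∑-zero : (xs : List 𝔸) → ∑ xs (λ _ → 0ℤ) ≡ 0ℤ
∑-zero xs = trans (∑-const xs 0ℤ) (ℤₚ.*-zeroʳ (ℤ.+ length xs))

∑-zero∈ : {f : 𝔸 → ℤ} (xs : List 𝔸) → (∀ {x} → x ∈ xs → f x ≡ 0ℤ) → ∑ xs f ≡ 0ℤ
∑-zero∈ xs h = trans (∑-cong∈ xs h) (∑-zero xs)

∑-+ : (xs : List 𝔸) (f g : 𝔸 → ℤ) → ∑ xs (λ x → f x + g x) ≡ ∑ xs f + ∑ xs g
∑-+ []       f g = refl
∑-+ (x ∷ xs) f g = trans (cong (f x + g x +_) (∑-+ xs f g)) (lemma (f x) (g x) (∑ xs f) (∑ xs g))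
  where
  lemma : ∀ a b c d → a + b + (c + d) ≡ a + c + (b + d)
  lemma = solve-∀

∑-*ˡ : (xs : List 𝔸) (c : ℤ) (f : 𝔸 → ℤ) → ∑ xs (λ x → c * f x) ≡ c * ∑ xs f
∑-*ˡ []       c f = sym (ℤₚ.*-zeroʳ c)
∑-*ˡ (x ∷ xs) c f = trans (cong (c * f x +_) (∑-*ˡ xs c f)) (sym (ℤₚ.*-distribˡ-+ c (f x) (∑ xs f)))

∑-*ʳ : (xs : List 𝔸) (c : ℤ) (f : 𝔸 → ℤ) → ∑ xs (λ x → f x * c) ≡ ∑ xs f * c
∑-*ʳ xs c f = trans (∑-cong xs (λ x → ℤₚ.*-comm (f x) c)) (trans (∑-*ˡ xs c f) (ℤₚ.*-comm c _))

∑-- : (xs : List 𝔸) (f g : 𝔸 → ℤ) → ∑ xs (λ x → f x - g x) ≡ ∑ xs f - ∑ xs g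
∑-- xs f g = begin
  ∑ xs (λ x → f x - g x)             ≡⟨ ∑-+ xs f (λ x → - g x) ⟩
  ∑ xs f + ∑ xs (λ x → - g x)        ≡⟨ cong (∑ xs f +_) (∑-cong xs (λ x → sym (ℤₚ.-1*i≡-i (g x)))) ⟩
  ∑ xs f + ∑ xs (λ x → -1ℤ * g x)    ≡⟨ cong (∑ xs f +_) (trans (∑-*ˡ xs -1ℤ g) (ℤₚ.-1*i≡-i _)) ⟩
  ∑ xs f - ∑ xs g                    ∎
  where open ≡-Reasoning

∑-swap : (xs : List 𝔸) (ys : List 𝔹) (f : 𝔸 → 𝔹 → ℤ) →
         ∑ xs (λ x → ∑ ys (f x)) ≡ ∑ ys (λ y → ∑ xs (λ x → f x y))
∑-swap []       ys f = sym (∑-zero ys)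
∑-swap (x ∷ xs) ys f =
  trans (cong (∑ ys (f x) +_) (∑-swap xs ys f)) (sym (∑-+ ys (f x) (λ y → ∑ xs (λ z → f z y))))

∑-++ : (xs ys : List 𝔸) (f : 𝔸 → ℤ) → ∑ (xs ++ ys) f ≡ ∑ xs f + ∑ ys f
∑-++ []       ys f = sym (ℤₚ.+-identityˡ _)
∑-++ (x ∷ xs) ys f = trans (cong (f x +_) (∑-++ xs ys f)) (sym (ℤₚ.+-assoc (f x) _ _))

∑-map : (h : 𝔸 → 𝔹) (xs : List 𝔸) (f : 𝔹 → ℤ) → ∑ (List.map h xs) f ≡ ∑ xs (f ∘ h)
∑-map h []       f = refl
∑-map h (x ∷ xs) f = cong (f (h x) +_) (∑-map h xs f)

∑-tabulate : ∀ {n} (h : Fin n → 𝔸) (f : 𝔸 → ℤ) → ∑ (List.tabulate h) f ≡ ∑ (allFin n) (f ∘ h)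
∑-tabulate {n = zero}  h f = refl
∑-tabulate {n = suc n} h f = cong (f (h zero) +_)
  (trans (∑-tabulate (h ∘ suc) f) (sym (∑-tabulate suc (f ∘ h))))

∑-Fin-suc : ∀ {n} (f : Fin (suc n) → ℤ) → ∑ (allFin (suc n)) f ≡ f zero + ∑ (allFin n) (f ∘ suc)
∑-Fin-suc f = cong (f zero +_) (∑-tabulate suc f)

∑-concatMap : (h : 𝔸 → List 𝔹) (xs : List 𝔸) (f : 𝔹 → ℤ) →
              ∑ (concatMap h xs) f ≡ ∑ xs (λ x → ∑ (h x) f)
∑-concatMap h []       f = refl
∑-concatMap h (x ∷ xs) f = trans (∑-++ (h x) (concatMap h xs) f) (cong (∑ (h x) f +_) (∑-concatMap h xs f))

∑-filterᵇ : (p : 𝔸 → Bool) (xs : List 𝔸) (f : 𝔸 → ℤ) →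
            ∑ (filterᵇ p xs) f ≡ ∑ xs (λ x → if p x then f x else 0ℤ)
∑-filterᵇ p []       f = refl
∑-filterᵇ p (x ∷ xs) f with p x
... | true  = cong (f x +_) (∑-filterᵇ p xs f)
... | false = trans (∑-filterᵇ p xs f) (sym (ℤₚ.+-identityˡ _))

length-∑ : (xs : List 𝔸) → ℤ.+ length xs ≡ ∑ xs (λ _ → 1ℤ)
length-∑ xs = trans (sym (ℤₚ.*-identityʳ _)) (sym (∑-const xs 1ℤ))

∑-point : {f : 𝔸 → ℤ} {xs : List 𝔸} {a : 𝔸} → Unique xs → a ∈ xs →
          (∀ {x} → x ∈ xs → x ≢ a → f x ≡ 0ℤ) → ∑ xs f ≡ f a
∑-point {f = f} {x ∷ xs} (x∉ ∷ u) (here refl) h =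
  trans (cong (f x +_) (∑-zero∈ xs (λ y∈ → h (there y∈) (λ { refl → All.lookup x∉ y∈ refl }))))
        (ℤₚ.+-identityʳ (f x))
∑-point {f = f} {x ∷ xs} (x∉ ∷ u) (there a∈) h =
  trans (cong₂ _+_ (h (here refl) (λ { refl → All.lookup x∉ a∈ refl })) (∑-point u a∈ (h ∘ there)))
        (ℤₚ.+-identityˡ _)

-- Summing the indicator of `φ x ≡ y` over one variable first or over the other gives the two sides,
-- so the orders in which the lists enumerate their entries never have to be compared.
∑-bij : DecidableEquality 𝔸 → DecidableEquality 𝔹 →
        {xs : List 𝔸} {ys : List 𝔹} → Unique xs → Unique ys → (φ : 𝔸 → 𝔹) (ψ : 𝔹 → 𝔸) →
        (∀ {x} → x ∈ xs → φ x ∈ ys) → (∀ {y} → y ∈ ys → ψ y ∈ xs) →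
        (∀ {x} → x ∈ xs → ψ (φ x) ≡ x) → (∀ {y} → y ∈ ys → φ (ψ y) ≡ y) →
        (f : 𝔹 → ℤ) → ∑ xs (f ∘ φ) ≡ ∑ ys f
∑-bij _≟𝔸_ _≟𝔹_ {xs} {ys} uxs uys φ ψ φ∈ ψ∈ ψφ φψ f = begin
  ∑ xs (f ∘ φ)                                      ≡⟨ ∑-cong∈ xs (λ x∈ → sym (pick x∈)) ⟩
  ∑ xs (λ x → ∑ ys (λ y → ι (φ x ≟𝔹 y) * f y))      ≡⟨ ∑-swap xs ys _ ⟩
  ∑ ys (λ y → ∑ xs (λ x → ι (φ x ≟𝔹 y) * f y))      ≡⟨ ∑-cong∈ ys pick′ ⟩
  ∑ ys f                                            ∎
  where
  open ≡-Reasoning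
  hit : ∀ {y} (d : Dec (φ (ψ y) ≡ y)) → φ (ψ y) ≡ y → ι d * f y ≡ f y
  hit {y} d e = trans (cong (_* f y) (ι-yes d e)) (ℤₚ.*-identityˡ (f y))
  pick : ∀ {x} → x ∈ xs → ∑ ys (λ y → ι (φ x ≟𝔹 y) * f y) ≡ f (φ x)
  pick {x} x∈ = trans
    (∑-point uys (φ∈ x∈) (λ {y} _ y≢ → trans (cong (_* f y) (ι-no (φ x ≟𝔹 y) (y≢ ∘ sym))) (ℤₚ.*-zeroˡ (f y))))
    (trans (cong (_* f (φ x)) (ι-yes (φ x ≟𝔹 φ x) refl)) (ℤₚ.*-identityˡ (f (φ x))))
  pick′ : ∀ {y} → y ∈ ys → ∑ xs (λ x → ι (φ x ≟𝔹 y) * f y) ≡ f y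
  pick′ {y} y∈ = trans
    (∑-point uxs (ψ∈ y∈) (λ {x} x∈ x≢ →
      trans (cong (_* f y) (ι-no (φ x ≟𝔹 y) (λ e → x≢ (trans (sym (ψφ x∈)) (cong ψ e))))) (ℤₚ.*-zeroˡ (f y))))
    (hit (φ (ψ y) ≟𝔹 y) (φψ y∈))

∑-mono∈ : {f g : 𝔸 → ℤ} (xs : List 𝔸) → (∀ {x} → x ∈ xs → f x ℤ.≤ g x) → ∑ xs f ℤ.≤ ∑ xs g
∑-mono∈ []       h = ℤₚ.≤-refl
∑-mono∈ (x ∷ xs) h = ℤₚ.+-mono-≤ (h (here refl)) (∑-mono∈ xs (h ∘ there))

∑-nonneg : {f : 𝔸 → ℤ} (xs : List 𝔸) → (∀ x → 0ℤ ℤ.≤ f x) → 0ℤ ℤ.≤ ∑ xs f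
∑-nonneg {f = f} xs h = subst (ℤ._≤ ∑ xs f) (∑-zero xs) (∑-mono∈ xs (λ {x} _ → h x))

∣∑∣≤ : {f : 𝔸 → ℤ} {b : ℕ} (xs : List 𝔸) → (∀ {x} → x ∈ xs → ∣ f x ∣ ℕ.≤ b) →
       ∣ ∑ xs f ∣ ℕ.≤ length xs ℕ.* b
∣∑∣≤ []       h = ℕ.z≤n
∣∑∣≤ {f = f} (x ∷ xs) h =
  ℕₚ.≤-trans (ℤₚ.∣i+j∣≤∣i∣+∣j∣ (f x) _) (ℕₚ.+-mono-≤ (h (here refl)) (∣∑∣≤ xs (h ∘ there)))

∏ : ∀ n → (Fin n → ℤ) → ℤ
∏ zero    f = 1ℤ
∏ (suc n) f = f zero * ∏ n (f ∘ suc)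

∏-cong : ∀ n {f g : Fin n → ℤ} → (∀ i → f i ≡ g i) → ∏ n f ≡ ∏ n g
∏-cong zero    h = refl
∏-cong (suc n) h = cong₂ _*_ (h zero) (∏-cong n (h ∘ suc))

∏-one : ∀ n {f : Fin n → ℤ} → (∀ i → f i ≡ 1ℤ) → ∏ n f ≡ 1ℤ
∏-one zero    h = refl
∏-one (suc n) h = cong₂ _*_ (h zero) (∏-one n (h ∘ suc))

∏-zero : ∀ {n} {f : Fin n → ℤ} i → f i ≡ 0ℤ → ∏ n f ≡ 0ℤ
∏-zero {f = f} zero    e = trans (cong (_* ∏ _ (f ∘ suc)) e) (ℤₚ.*-zeroˡ (∏ _ (f ∘ suc)))
∏-zero {f = f} (suc i) e = trans (cong (f zero *_) (∏-zero i e)) (ℤₚ.*-zeroʳ (f zero))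

-- Separates the one factor that depends on a parameter `b`. The cofactor `K` is common to all `b`,
-- which makes the product linear in that factor.
∏-extract : ∀ {n} (i₀ : Fin n) (f : 𝔹 → Fin n → ℤ) (b₀ : 𝔹) →
            (∀ b i → i ≢ i₀ → f b i ≡ f b₀ i) →
            ∃ λ K → ∀ b → ∏ n (f b) ≡ f b i₀ * K
∏-extract zero f b₀ h =
  ∏ _ (f b₀ ∘ suc) , λ b → cong (f b zero *_) (∏-cong _ (λ i → h b (suc i) λ ()))
∏-extract (suc i₀) f b₀ h
  with K , e ← ∏-extract i₀ (λ b → f b ∘ suc) b₀ (λ b i i≢ → h b (suc i) (i≢ ∘ λ { refl → refl }))
  = f b₀ zero * K , λ b → trans (cong₂ _*_ (h b zero λ ()) (e b)) (lemma (f b₀ zero) (f b (suc i₀)) K)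
  where
  lemma : ∀ a b c → a * (b * c) ≡ b * (a * c)
  lemma = solve-∀

-- Permutations

T⇒≡ : ∀ {b} → T b → b ≡ true
T⇒≡ {true} _ = refl

≡⇒T : ∀ {b} → b ≡ true → T b
≡⇒T refl = _

_≟P_ : DecidableEquality (Perm n)
_≟P_ = Vecₚ.≡-dec _≟_

record Inj (σ : Perm n) : Set where
  constructor mkInj
  field inj : ∀ {i j} → lookup σ i ≡ lookup σ j → i ≡ j
open Inj

ext : {σ τ : Perm n} → (∀ i → lookup σ i ≡ lookup τ i) → σ ≡ τ
ext {σ = σ} {τ} h = trans (sym (Vecₚ.tabulate∘lookup σ)) (trans (Vecₚ.tabulate-cong h) (Vecₚ.tabulate∘lookup τ))

infixl 7 _⊙_

-- An opaque copy of _·_, because unfolding tabulate under metavariables defeats unification.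
opaque
  _⊙_ : Perm n → Perm n → Perm n
  _⊙_ = _·_

  ⊙-def : (π σ : Perm n) → π ⊙ σ ≡ π · σ
  ⊙-def π σ = refl

  lookup-⊙ : (π σ : Perm n) (i : Fin n) → lookup (π ⊙ σ) i ≡ lookup π (lookup σ i)
  lookup-⊙ π σ = Vecₚ.lookup∘tabulate _

⊙-assoc : (π σ τ : Perm n) → (π ⊙ σ) ⊙ τ ≡ π ⊙ (σ ⊙ τ)
⊙-assoc π σ τ = ext λ i → begin
  lookup ((π ⊙ σ) ⊙ τ) i             ≡⟨ lookup-⊙ (π ⊙ σ) τ i ⟩
  lookup (π ⊙ σ) (lookup τ i)        ≡⟨ lookup-⊙ π σ _ ⟩
  lookup π (lookup σ (lookup τ i))   ≡⟨ cong (lookup π) (lookup-⊙ σ τ i) ⟨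
  lookup π (lookup (σ ⊙ τ) i)        ≡⟨ lookup-⊙ π (σ ⊙ τ) i ⟨
  lookup (π ⊙ (σ ⊙ τ)) i             ∎
  where open ≡-Reasoning

opaque
  idP : Perm n
  idP = tabulate id

  lookup-id : (i : Fin n) → lookup idP i ≡ i
  lookup-id = Vecₚ.lookup∘tabulate id

⊙-identityˡ : (σ : Perm n) → idP ⊙ σ ≡ σ
⊙-identityˡ σ = ext λ i → trans (lookup-⊙ idP σ i) (lookup-id _)

⊙-identityʳ : (σ : Perm n) → σ ⊙ idP ≡ σ
⊙-identityʳ σ = ext λ i → trans (lookup-⊙ σ idP i) (cong (lookup σ) (lookup-id i))

-- A missed value `j` could be punched out of the codomain, leaving an injection of `Fin (suc n)`
-- into `Fin n`.
injective⇒surjective : (f : Fin n → Fin n) → (∀ {i j} → f i ≡ f j → i ≡ j) → ∀ j → ∃ λ i → f i ≡ j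
injective⇒surjective {zero}  f inj ()
injective⇒surjective {suc n} f inj j with Finₚ.any? (λ i → f i ≟ j)
... | yes p = p
... | no ¬p = ⊥-elim (ℕₚ.1+n≰n (Finₚ.injective⇒≤ {f = λ i → Fin.punchOut (j≢ i)}
                        (λ {a} {b} e → inj (Finₚ.punchOut-injective (j≢ a) (j≢ b) e))))
  where
  j≢ : ∀ i → j ≢ f i
  j≢ i e = ¬p (i , sym e)

opaque
  preimage : Perm n → Fin n → Fin n
  preimage σ j with Finₚ.any? (λ i → lookup σ i ≟ j)
  ... | yes (i , _) = i
  -- Arbitrary: for an injective `σ` this case does not occur.
  ... | no _        = j

  inv : Perm n → Perm n
  inv σ = tabulate (preimage σ)

  lookup-invʳ : {σ : Perm n} → Inj σ → ∀ j → lookup σ (lookup (inv σ) j) ≡ j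
  lookup-invʳ {σ = σ} p j rewrite Vecₚ.lookup∘tabulate (preimage σ) j
    with Finₚ.any? (λ i → lookup σ i ≟ j)
  ... | yes (i , e) = e
  ... | no ¬p       = ⊥-elim (¬p (injective⇒surjective (lookup σ) (inj p) j))

lookup-invˡ : {σ : Perm n} → Inj σ → ∀ j → lookup (inv σ) (lookup σ j) ≡ j
lookup-invˡ p j = inj p (lookup-invʳ p _)

Inj-inv : {σ : Perm n} → Inj σ → Inj (inv σ)
Inj-inv {σ = σ} p .inj {i} {j} e = trans (sym (lookup-invʳ p i)) (trans (cong (lookup σ) e) (lookup-invʳ p j))

Inj-⊙ : {π σ : Perm n} → Inj π → Inj σ → Inj (π ⊙ σ)
Inj-⊙ {π = π} {σ} p q .inj {i} {j} e = inj q (inj p (trans (sym (lookup-⊙ π σ i)) (trans e (lookup-⊙ π σ j))))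

Inj-id : Inj (idP {n})
Inj-id .inj {i} {j} e = trans (sym (lookup-id i)) (trans e (lookup-id j))

⊙-invʳ : {σ : Perm n} → Inj σ → σ ⊙ inv σ ≡ idP
⊙-invʳ {σ = σ} p = ext λ i → trans (lookup-⊙ σ (inv σ) i) (trans (lookup-invʳ p i) (sym (lookup-id i)))

⊙-invˡ : {σ : Perm n} → Inj σ → inv σ ⊙ σ ≡ idP
⊙-invˡ {σ = σ} p = ext λ i → trans (lookup-⊙ (inv σ) σ i) (trans (lookup-invˡ p i) (sym (lookup-id i)))

inv-cancelˡ : {σ : Perm n} → Inj σ → ∀ τ → inv σ ⊙ (σ ⊙ τ) ≡ τ
inv-cancelˡ {σ = σ} p τ = trans (sym (⊙-assoc (inv σ) σ τ)) (trans (cong (_⊙ τ) (⊙-invˡ p)) (⊙-identityˡ τ))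

inv-cancelˡ′ : {σ : Perm n} → Inj σ → ∀ τ → σ ⊙ (inv σ ⊙ τ) ≡ τ
inv-cancelˡ′ {σ = σ} p τ = trans (sym (⊙-assoc σ (inv σ) τ)) (trans (cong (_⊙ τ) (⊙-invʳ p)) (⊙-identityˡ τ))

inv-cancelʳ : {σ : Perm n} → Inj σ → ∀ τ → (τ ⊙ σ) ⊙ inv σ ≡ τ
inv-cancelʳ {σ = σ} p τ = trans (⊙-assoc τ σ (inv σ)) (trans (cong (τ ⊙_) (⊙-invʳ p)) (⊙-identityʳ τ))

inv-cancelʳ′ : {σ : Perm n} → Inj σ → ∀ τ → (τ ⊙ inv σ) ⊙ σ ≡ τ
inv-cancelʳ′ {σ = σ} p τ = trans (⊙-assoc τ (inv σ) σ) (trans (cong (τ ⊙_) (⊙-invˡ p)) (⊙-identityʳ τ))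

inv-⊙ : {π σ : Perm n} → Inj π → Inj σ → inv (π ⊙ σ) ≡ inv σ ⊙ inv π
inv-⊙ {π = π} {σ} p q = ext λ i → inj (Inj-⊙ p q) (begin
  lookup (π ⊙ σ) (lookup (inv (π ⊙ σ)) i)              ≡⟨ lookup-invʳ (Inj-⊙ p q) i ⟩
  i                                                    ≡⟨ lookup-invʳ p i ⟨
  lookup π (lookup (inv π) i)                          ≡⟨ cong (lookup π) (lookup-invʳ q _) ⟨
  lookup π (lookup σ (lookup (inv σ) (lookup (inv π) i)))
    ≡⟨ cong (λ k → lookup π (lookup σ k)) (lookup-⊙ (inv σ) (inv π) i) ⟨
  lookup π (lookup σ (lookup (inv σ ⊙ inv π) i))       ≡⟨ lookup-⊙ π σ _ ⟨
  lookup (π ⊙ σ) (lookup (inv σ ⊙ inv π) i)            ∎)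
  where open ≡-Reasoning

opaque
  swap : Fin n → Fin n → Perm n
  swap a b = tabulate (transpose a b)

  swap-l : (a b : Fin n) → lookup (swap a b) a ≡ b
  swap-l a b rewrite Vecₚ.lookup∘tabulate (transpose a b) a with a ≟ a
  ... | yes _  = refl
  ... | no a≢a = ⊥-elim (a≢a refl)

  swap-r : (a b : Fin n) → lookup (swap a b) b ≡ a
  swap-r a b rewrite Vecₚ.lookup∘tabulate (transpose a b) b with b ≟ a
  ... | yes b≡a = b≡a
  ... | no _ with b ≟ b
  ...   | yes _  = refl
  ...   | no b≢b = ⊥-elim (b≢b refl)

  swap-o : (a b : Fin n) {i : Fin n} → i ≢ a → i ≢ b → lookup (swap a b) i ≡ i
  swap-o a b {i} i≢a i≢b rewrite Vecₚ.lookup∘tabulate (transpose a b) i with i ≟ a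
  ... | yes p = ⊥-elim (i≢a p)
  ... | no _ with i ≟ b
  ...   | yes p = ⊥-elim (i≢b p)
  ...   | no _  = refl

data SwapView (a b i : Fin n) : Set where
  isL : i ≡ a → lookup (swap a b) i ≡ b → SwapView a b i
  isR : i ≡ b → lookup (swap a b) i ≡ a → SwapView a b i
  isO : i ≢ a → i ≢ b → lookup (swap a b) i ≡ i → SwapView a b i

swapView : (a b i : Fin n) → SwapView a b i
swapView a b i with i ≟ a | i ≟ b
... | yes refl | _        = isL refl (swap-l a b)
... | no _     | yes refl = isR refl (swap-r a b)
... | no p     | no q     = isO p q (swap-o a b p q)

swap-invol : (a b i : Fin n) → lookup (swap a b) (lookup (swap a b) i) ≡ i
swap-invol a b i with swapView a b i
... | isL refl e rewrite e = swap-r a b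
... | isR refl e rewrite e = swap-l a b
... | isO p q e  rewrite e = e

Inj-swap : (a b : Fin n) → Inj (swap a b)
Inj-swap a b .inj {i} {j} e =
  trans (sym (swap-invol a b i)) (trans (cong (lookup (swap a b)) e) (swap-invol a b j))

∈allVecs : ∀ {m k} (v : Vec (Fin m) k) → v ∈ allVecs m k
∈allVecs []      = here refl
∈allVecs (i ∷ v) = ∈ₚ.∈-concatMap⁺ _ (go i)
  where
  go : ∀ i → _
  go i = Anyₚ.tabulate⁺ i (∈ₚ.∈-map⁺ (i ∷_) (∈allVecs v))

allVecs-unique : ∀ m k → Unique (allVecs m k)
allVecs-unique m zero    = All.[] ∷ []
allVecs-unique m (suc k) = Uniqueₚ.concat⁺
  (Allₚ.map⁺ (All.universal (λ i → Uniqueₚ.map⁺ Vecₚ.∷-injectiveʳ (allVecs-unique m k)) (allFin m)))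
  (AllPairsₚ.map⁺ (AllPairsₚ.tabulate⁺ λ {i} {j} i≢j → disj i≢j))
  where
  disj : ∀ {i j} → i ≢ j → ∀ {v} → ¬ (v ∈ List.map (i ∷_) (allVecs m k) × v ∈ List.map (j ∷_) (allVecs m k))
  disj i≢j (p , q) with ∈ₚ.∈-map⁻ _ p | ∈ₚ.∈-map⁻ _ q
  ... | _ , _ , refl | _ , _ , refl = i≢j refl

S-unique : ∀ n → Unique (S n)
S-unique n = Uniqueₚ.filter⁺ _ (allVecs-unique n n)

T-all-Fin : (p : Fin n → Bool) → T (List.foldr _∧_ true (List.map p (allFin n))) → ∀ i → T (p i)
T-all-Fin p t i = All.lookup (Allₚ.all⁺ p (allFin _) t) (∈ₚ.∈-tabulate⁺ i)

all-Fin-T : (p : Fin n → Bool) → (∀ i → T (p i)) → T (List.foldr _∧_ true (List.map p (allFin n)))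
all-Fin-T p h = Allₚ.all⁻ p {xs = allFin _} (All.universal h _)

∈S⇒Inj : {σ : Perm n} → σ ∈ S n → Inj σ
∈S⇒Inj {n} {σ} σ∈ .inj {i} {j} e = go (T-all-Fin _ (T-all-Fin _ (proj₂ (∈ₚ.∈-filter⁻ _ {xs = allVecs n n} σ∈)) i) j)
  where
  go : T (if lookup σ i ==F lookup σ j then i ==F j else true) → i ≡ j
  go t with lookup σ i ≟ lookup σ j | i ≟ j
  ... | yes _ | yes p = p
  ... | no ¬e | _     = ⊥-elim (¬e e)

Inj⇒∈S : {σ : Perm n} → Inj σ → σ ∈ S n
Inj⇒∈S {n} {σ} σ-inj = ∈ₚ.∈-filter⁺ _ (∈allVecs σ) (all-Fin-T _ λ i → all-Fin-T _ λ j → go i j)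
  where
  go : ∀ i j → T (if lookup σ i ==F lookup σ j then i ==F j else true)
  go i j with lookup σ i ≟ lookup σ j
  ... | no _  = _
  ... | yes e with i ≟ j
  ...   | yes _ = _
  ...   | no ¬p = ¬p (inj σ-inj e)

∑-translateˡ : {τ : Perm n} → Inj τ → (f : Perm n → ℤ) → ∑ (S n) (λ σ → f (τ ⊙ σ)) ≡ ∑ (S n) f
∑-translateˡ {n} {τ} p = ∑-bij _≟P_ _≟P_ (S-unique n) (S-unique n) (τ ⊙_) (inv τ ⊙_)
  (λ σ∈ → Inj⇒∈S (Inj-⊙ p (∈S⇒Inj σ∈))) (λ σ∈ → Inj⇒∈S (Inj-⊙ (Inj-inv p) (∈S⇒Inj σ∈)))
  (λ _ → inv-cancelˡ p _) (λ _ → inv-cancelˡ′ p _)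

∑-translateʳ : {τ : Perm n} → Inj τ → (f : Perm n → ℤ) → ∑ (S n) (λ σ → f (σ ⊙ τ)) ≡ ∑ (S n) f
∑-translateʳ {n} {τ} p = ∑-bij _≟P_ _≟P_ (S-unique n) (S-unique n) (_⊙ τ) (_⊙ inv τ)
  (λ σ∈ → Inj⇒∈S (Inj-⊙ (∈S⇒Inj σ∈) p)) (λ σ∈ → Inj⇒∈S (Inj-⊙ (∈S⇒Inj σ∈) (Inj-inv p)))
  (λ _ → inv-cancelʳ p _) (λ _ → inv-cancelʳ′ p _)

∈allFin : (i : Fin n) → i ∈ allFin n
∈allFin i = ∈ₚ.∈-tabulate⁺ {f = id} i

∑-permute : {τ : Perm n} → Inj τ → (f : Fin n → ℤ) → ∑ (allFin n) (λ i → f (lookup τ i)) ≡ ∑ (allFin n) f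
∑-permute {n} {τ} p = ∑-bij _≟_ _≟_ (Uniqueₚ.allFin⁺ n) (Uniqueₚ.allFin⁺ n) (lookup τ) (lookup (inv τ))
  (λ _ → ∈allFin _) (λ _ → ∈allFin _) (λ _ → lookup-invˡ p _) (λ _ → lookup-invʳ p _)

-- The sign of a permutation

parity : ℕ → ℤ
parity zero    = 1ℤ
parity (suc k) = - parity k

parity-+ : ∀ a b → parity (a ℕ.+ b) ≡ parity a * parity b
parity-+ zero    b = sym (ℤₚ.*-identityˡ (parity b))
parity-+ (suc a) b = trans (cong -_ (parity-+ a b)) (ℤₚ.neg-distribˡ-* (parity a) (parity b))

parity²≡1 : ∀ a → parity a * parity a ≡ 1ℤ
parity²≡1 zero    = refl
parity²≡1 (suc a) = trans (lemma (parity a)) (parity²≡1 a)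
  where
  lemma : ∀ p → (- p) * (- p) ≡ p * p
  lemma = solve-∀

parity-±1 : ∀ a → parity a ≡ 1ℤ ⊎ parity a ≡ -1ℤ
parity-±1 zero    = inj₁ refl
parity-±1 (suc a) with parity-±1 a
... | inj₁ e = inj₂ (cong -_ e)
... | inj₂ e = inj₁ (cong -_ e)

opaque
  inv# : Perm n → ℕ
  inv# = inversions

  inv#-def : (σ : Perm n) → inv# σ ≡ inversions σ
  inv#-def σ = refl

opaque
  sgn : Perm n → ℤ
  sgn σ = parity (inv# σ)

  sgn-parity : (σ : Perm n) → sgn σ ≡ parity (inv# σ)
  sgn-parity σ = refl

parity-even : ∀ k → parity k ≡ (if (k ℕ.% 2) ℕ.≡ᵇ 0 then 1ℤ else -1ℤ)
parity-even zero          = refl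
parity-even (suc zero)    = refl
parity-even (suc (suc k)) = begin
  - - parity k                                        ≡⟨ ℤₚ.neg-involutive (parity k) ⟩
  parity k                                            ≡⟨ parity-even k ⟩
  (if (k ℕ.% 2) ℕ.≡ᵇ 0 then 1ℤ else -1ℤ)
    ≡⟨ cong (λ r → if r ℕ.≡ᵇ 0 then 1ℤ else -1ℤ) (trans (sym (ℕD.[m+n]%n≡m%n k 2)) (cong (ℕ._% 2) (ℕₚ.+-comm k 2))) ⟩
  (if (suc (suc k) ℕ.% 2) ℕ.≡ᵇ 0 then 1ℤ else -1ℤ)    ∎
  where open ≡-Reasoning

sgn-isEven : (σ : Perm n) → sgn σ ≡ (if isEven σ then 1ℤ else -1ℤ)
sgn-isEven σ = trans (sgn-parity σ) (trans (cong parity (inv#-def σ)) (parity-even (inversions σ)))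

opaque
  lt : Fin n → Fin n → ℤ
  lt i j = ι (i Finₚ.<? j)

  lt-nonneg : (i j : Fin n) → 0ℤ ℤ.≤ lt i j
  lt-nonneg i j = ι-nonneg (i Finₚ.<? j)

  lt-self : (i : Fin n) → lt i i ≡ 0ℤ
  lt-self i = ι-no (i Finₚ.<? i) (ℕₚ.<-irrefl refl)

  lt-< : {i j : Fin n} → i Fin.< j → (lt i j ≡ 1ℤ) × (lt j i ≡ 0ℤ)
  lt-< {i = i} {j} p = ι-yes (i Finₚ.<? j) p , ι-no (j Finₚ.<? i) (ℕₚ.<-asym p)

lt-cases : (i j : Fin n) → (i ≡ j) ⊎ ((lt i j ≡ 1ℤ × lt j i ≡ 0ℤ) ⊎ (lt i j ≡ 0ℤ × lt j i ≡ 1ℤ))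
lt-cases i j with Finₚ.<-cmp i j
... | tri< p _ _ = inj₂ (inj₁ (lt-< p))
... | tri≈ _ e _ = inj₁ e
... | tri> _ _ p with lt-< p
...   | a , b = inj₂ (inj₂ (b , a))

lt-antisym : (i j : Fin n) → lt i j * lt j i ≡ 0ℤ
lt-antisym i j with lt-cases i j
... | inj₁ refl             = cong₂ _*_ (lt-self i) (lt-self i)
... | inj₂ (inj₁ (a , b))   = cong₂ _*_ a b
... | inj₂ (inj₂ (a , b))   = cong₂ _*_ a b

opaque
  ∑∑ : (Fin n → Fin n → ℤ) → ℤ
  ∑∑ f = ∑ (allFin _) λ i → ∑ (allFin _) (f i)

  ∑∑-cong : {f g : Fin n → Fin n → ℤ} → (∀ i j → f i j ≡ g i j) → ∑∑ f ≡ ∑∑ g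
  ∑∑-cong h = ∑-cong (allFin _) λ i → ∑-cong (allFin _) (h i)

  ∑∑-+ : (f g : Fin n → Fin n → ℤ) → ∑∑ (λ i j → f i j + g i j) ≡ ∑∑ f + ∑∑ g
  ∑∑-+ f g = trans (∑-cong (allFin _) λ i → ∑-+ (allFin _) (f i) (g i)) (∑-+ (allFin _) (λ i → ∑ (allFin _) (f i)) (λ i → ∑ (allFin _) (g i)))

  ∑∑-permute : {τ : Perm n} → Inj τ → (f : Fin n → Fin n → ℤ) →
               ∑∑ (λ i j → f (lookup τ i) (lookup τ j)) ≡ ∑∑ f
  ∑∑-permute {n} {τ} p f = trans
    (∑-cong (allFin n) (λ i → ∑-permute p (f (lookup τ i))))
    (∑-permute p (λ i → ∑ (allFin n) (f i)))

∑-cartesian : {A B : Set} (xs : List A) (ys : List B) (f : A × B → ℤ) →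
              ∑ (cartesianProduct xs ys) f ≡ ∑ xs (λ x → ∑ ys (λ y → f (x , y)))
∑-cartesian []       ys f = refl
∑-cartesian (x ∷ xs) ys f = trans (∑-++ (List.map (x ,_) ys) _ f)
  (cong₂ _+_ (∑-map (x ,_) ys f) (∑-cartesian xs ys f))

opaque
  unfolding inv# lt ∑∑

  -- In this form the inversion number can be re-indexed along permutations of the points.
  inv#-∑∑ : (σ : Perm n) → ℤ.+ inv# σ ≡ ∑∑ (λ i j → lt i j * lt (lookup σ j) (lookup σ i))
  inv#-∑∑ {n} σ = begin
    ℤ.+ inv# σ                                      ≡⟨ length-∑ (filterᵇ p (cartesianProduct F F)) ⟩
    ∑ (filterᵇ p (cartesianProduct F F)) (λ _ → 1ℤ)       ≡⟨ ∑-filterᵇ p (cartesianProduct F F) (λ _ → 1ℤ) ⟩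
    ∑ (cartesianProduct F F) (λ x → if p x then 1ℤ else 0ℤ) ≡⟨ ∑-cartesian F F (λ x → if p x then 1ℤ else 0ℤ) ⟩
    ∑∑ (λ i j → if p (i , j) then 1ℤ else 0ℤ)
      ≡⟨ ∑∑-cong (λ i j → and-* (toℕ i ℕ.<ᵇ toℕ j) (toℕ (lookup σ j) ℕ.<ᵇ toℕ (lookup σ i))) ⟩
    ∑∑ (λ i j → lt i j * lt (lookup σ j) (lookup σ i))    ∎
    where
    open ≡-Reasoning
    F : List (Fin n)
    F = allFin n
    p : Fin n × Fin n → Bool
    p x = (toℕ (proj₁ x) ℕ.<ᵇ toℕ (proj₂ x)) ∧ (toℕ (lookup σ (proj₂ x)) ℕ.<ᵇ toℕ (lookup σ (proj₁ x)))
    and-* : ∀ a b → (if a ∧ b then 1ℤ else 0ℤ) ≡ (if a then 1ℤ else 0ℤ) * (if b then 1ℤ else 0ℤ)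
    and-* true  true  = refl
    and-* true  false = refl
    and-* false true  = refl
    and-* false false = refl

-- flips is symmetric in the two points, so its sum over i < j is half its sum over all (i , j), which is
-- invariant under relabelling the points: this gives the multiplicativity of sgn.
opaque
  flips : Perm n → Fin n → Fin n → ℤ
  flips π a b = lt a b * lt (lookup π b) (lookup π a) + lt b a * lt (lookup π a) (lookup π b)

  flips-def : (π : Perm n) (a b : Fin n) →
              flips π a b ≡ lt a b * lt (lookup π b) (lookup π a) + lt b a * lt (lookup π a) (lookup π b)
  flips-def π a b = refl

  flips-sym : (π : Perm n) (a b : Fin n) → flips π a b ≡ flips π b a
  flips-sym π a b = ℤₚ.+-comm (lt a b * lt (lookup π b) (lookup π a)) (lt b a * lt (lookup π a) (lookup π b))

  flips-self : (π : Perm n) (a : Fin n) → flips π a a ≡ 0ℤ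
  flips-self π a = cong₂ (λ s t → s * lt (lookup π a) (lookup π a) + t * lt (lookup π a) (lookup π a)) (lt-self a) (lt-self a)

opaque
  unfolding ∑∑ flips

  ∑∑-symmetric : (f : Fin n → Fin n → ℤ) → (∀ i j → f i j ≡ f j i) → (∀ i → f i i ≡ 0ℤ) →
                 ∑∑ f ≡ ∑∑ (λ i j → lt i j * f i j) + ∑∑ (λ i j → lt i j * f i j)
  ∑∑-symmetric {n} f f-sym f-self = begin
    ∑∑ f
      ≡⟨ ∑∑-cong split ⟩
    ∑∑ (λ i j → lt i j * f i j + lt j i * f j i)
      ≡⟨ ∑∑-+ (λ i j → lt i j * f i j) (λ i j → lt j i * f j i) ⟩
    ∑∑ (λ i j → lt i j * f i j) + ∑∑ (λ i j → lt j i * f j i)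
      ≡⟨ cong (∑∑ (λ i j → lt i j * f i j) +_) (∑-swap (allFin n) (allFin n) (λ i j → lt j i * f j i)) ⟩
    ∑∑ (λ i j → lt i j * f i j) + ∑∑ (λ i j → lt i j * f i j)
      ∎
    where
    open ≡-Reasoning
    l1 : ∀ a b → a ≡ 1ℤ * a + 0ℤ * b
    l1 = solve-∀
    l2 : ∀ a b → b ≡ 0ℤ * a + 1ℤ * b
    l2 = solve-∀
    split : ∀ i j → f i j ≡ lt i j * f i j + lt j i * f j i
    split i j with lt-cases i j
    ... | inj₁ refl rewrite f-self i | ℤₚ.*-zeroʳ (lt i i) = refl
    ... | inj₂ (inj₁ (a , b)) rewrite a | b = l1 (f i j) (f j i)
    ... | inj₂ (inj₂ (a , b)) rewrite a | b = trans (f-sym i j) (l2 (f i j) (f j i))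

  ∑∑-flips : (π : Perm n) → ∑∑ (flips π) ≡ ℤ.+ inv# π + ℤ.+ inv# π
  ∑∑-flips {n} π = begin
    ∑∑ (flips π)
      ≡⟨ ∑∑-+ (λ a b → lt a b * lt (lookup π b) (lookup π a)) (λ a b → lt b a * lt (lookup π a) (lookup π b)) ⟩
    X + ∑∑ (λ a b → lt b a * lt (lookup π a) (lookup π b))
      ≡⟨ cong (X +_) (∑-swap (allFin n) (allFin n) (λ a b → lt b a * lt (lookup π a) (lookup π b))) ⟩
    X + X
      ≡⟨ cong₂ _+_ (inv#-∑∑ π) (inv#-∑∑ π) ⟨
    ℤ.+ inv# π + ℤ.+ inv# π
      ∎
    where
    open ≡-Reasoning
    X : ℤ
    X = ∑∑ (λ a b → lt a b * lt (lookup π b) (lookup π a))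

halve : ∀ a b → a + a ≡ b + b → a ≡ b
halve a b e = ℤₚ.*-cancelˡ-≡ (ℤ.+ 2) a b (trans (double a) (trans e (sym (double b))))
  where
  double : ∀ c → ℤ.+ 2 * c ≡ c + c
  double = solve-∀

∑∑-flips< : (π : Perm n) {σ : Perm n} → Inj σ →
            ∑∑ (λ i j → lt i j * flips π (lookup σ i) (lookup σ j)) ≡ ℤ.+ inv# π
∑∑-flips< {n} π {σ} p = halve X (ℤ.+ inv# π) (begin
  X + X              ≡⟨ ∑∑-symmetric f (λ i j → flips-sym π (lookup σ i) (lookup σ j)) (λ i → flips-self π (lookup σ i)) ⟨
  ∑∑ f               ≡⟨ ∑∑-permute p (flips π) ⟩
  ∑∑ (flips π)       ≡⟨ ∑∑-flips π ⟩
  ℤ.+ inv# π + ℤ.+ inv# π ∎)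
  where
  open ≡-Reasoning
  f : Fin n → Fin n → ℤ
  f i j = flips π (lookup σ i) (lookup σ j)
  X : ℤ
  X = ∑∑ (λ i j → lt i j * f i j)

nonneg-* : ∀ a b → 0ℤ ℤ.≤ a → 0ℤ ℤ.≤ b → 0ℤ ℤ.≤ a * b
nonneg-* (ℤ.+ a) (ℤ.+ b) _ _ = subst (0ℤ ℤ.≤_) (ℤₚ.pos-* a b) (ℤ.+≤+ ℕ.z≤n)

opaque
  unfolding flips

  -- Marks the pairs inverted by `σ` whose images are inverted again by `π`; in the composite these
  -- two inversions undo each other.
  common : Perm n → Perm n → Fin n → Fin n → ℤ
  common π σ i j = lt i j * (lt (lookup σ j) (lookup σ i) * flips π (lookup σ i) (lookup σ j))

  common-def : (π σ : Perm n) (i j : Fin n) →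
               common π σ i j ≡ lt i j * (lt (lookup σ j) (lookup σ i) * flips π (lookup σ i) (lookup σ j))
  common-def π σ i j = refl

  flips-nonneg : (π : Perm n) (a b : Fin n) → 0ℤ ℤ.≤ flips π a b
  flips-nonneg π a b = ℤₚ.+-mono-≤
    (nonneg-* (lt a b) (lt (lookup π b) (lookup π a)) (lt-nonneg a b) (lt-nonneg _ _))
    (nonneg-* (lt b a) (lt (lookup π a) (lookup π b)) (lt-nonneg b a) (lt-nonneg _ _))

  common-nonneg : (π σ : Perm n) (i j : Fin n) → 0ℤ ℤ.≤ common π σ i j
  common-nonneg π σ i j = nonneg-* (lt i j) (s * H) (lt-nonneg i j)
      (nonneg-* s H (lt-nonneg (lookup σ j) (lookup σ i)) (flips-nonneg π (lookup σ i) (lookup σ j)))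
    where
    s H : ℤ
    s = lt (lookup σ j) (lookup σ i)
    H = flips π (lookup σ i) (lookup σ j)

lt-ordered : {i j : Fin n} → lt i j ≡ 1ℤ → i ≢ j
lt-ordered {i = i} e refl with trans (sym e) (lt-self i)
... | ()

lt-≢ : {i j : Fin n} → i ≢ j → (lt i j ≡ 1ℤ × lt j i ≡ 0ℤ) ⊎ (lt i j ≡ 0ℤ × lt j i ≡ 1ℤ)
lt-≢ {i = i} {j} i≢j with lt-cases i j
... | inj₁ e = ⊥-elim (i≢j e)
... | inj₂ c = c

-- For `i` before `j` the composite inverts the pair when exactly one of `σ` and `π` does, and the
-- indicator of an exclusive or is a + b - 2ab. The factor `lt i j` clears all other pairs.
inv#-⊙-at : (π σ : Perm n) → Inj π → Inj σ → ∀ i j →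
  lt i j * lt (lookup π (lookup σ j)) (lookup π (lookup σ i)) + (common π σ i j + common π σ i j) ≡
  lt i j * lt (lookup σ j) (lookup σ i) + lt i j * flips π (lookup σ i) (lookup σ j)
inv#-⊙-at {n} π σ p q i j = go (lt-cases i j)
  where
  L s s′ u u′ H : ℤ
  L  = lt i j
  s  = lt (lookup σ j) (lookup σ i)
  s′ = lt (lookup σ i) (lookup σ j)
  u  = lt (lookup π (lookup σ j)) (lookup π (lookup σ i))
  u′ = lt (lookup π (lookup σ i)) (lookup π (lookup σ j))
  H  = flips π (lookup σ i) (lookup σ j)
  arith : ∀ {L s s′ u u′} → L ≡ 1ℤ → (s′ ≡ 1ℤ × s ≡ 0ℤ) ⊎ (s′ ≡ 0ℤ × s ≡ 1ℤ) →
          (u′ ≡ 1ℤ × u ≡ 0ℤ) ⊎ (u′ ≡ 0ℤ × u ≡ 1ℤ) → ∀ {H c} → H ≡ s′ * u + s * u′ → c ≡ L * (s * H) →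
          L * u + (c + c) ≡ L * s + L * H
  arith refl (inj₁ (refl , refl)) (inj₁ (refl , refl)) refl refl = refl
  arith refl (inj₁ (refl , refl)) (inj₂ (refl , refl)) refl refl = refl
  arith refl (inj₂ (refl , refl)) (inj₁ (refl , refl)) refl refl = refl
  arith refl (inj₂ (refl , refl)) (inj₂ (refl , refl)) refl refl = refl
  arith₀ : ∀ {L} s u H {c} → L ≡ 0ℤ → c ≡ L * (s * H) → L * u + (c + c) ≡ L * s + L * H
  arith₀ s u H refl refl = refl
  go : (i ≡ j) ⊎ ((lt i j ≡ 1ℤ × lt j i ≡ 0ℤ) ⊎ (lt i j ≡ 0ℤ × lt j i ≡ 1ℤ)) →
       L * u + (common π σ i j + common π σ i j) ≡ L * s + L * H
  go (inj₁ e)              = arith₀ {L} s u H {common π σ i j} (trans (cong (lt i) (sym e)) (lt-self i)) (common-def π σ i j)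
  go (inj₂ (inj₂ (a , _))) = arith₀ {L} s u H {common π σ i j} a (common-def π σ i j)
  go (inj₂ (inj₁ (a , _))) = arith {L} {s} {s′} {u} {u′} a (lt-≢ σ≢) (lt-≢ (σ≢ ∘ inj p)) {H} {common π σ i j}
                               (flips-def π (lookup σ i) (lookup σ j)) (common-def π σ i j)
    where
    σ≢ : lookup σ i ≢ lookup σ j
    σ≢ = lt-ordered a ∘ inj q

inv#-⊙ : (π σ : Perm n) → Inj π → Inj σ →
  ℤ.+ inv# (π ⊙ σ) + (∑∑ (common π σ) + ∑∑ (common π σ)) ≡ ℤ.+ inv# σ + ℤ.+ inv# π
inv#-⊙ {n} π σ p q = begin
  ℤ.+ inv# (π ⊙ σ) + (Y + Y)
    ≡⟨ cong (_+ (Y + Y)) (trans (inv#-∑∑ (π ⊙ σ)) (∑∑-cong (λ i j →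
         cong₂ (λ a b → lt i j * lt a b) (lookup-⊙ π σ j) (lookup-⊙ π σ i)))) ⟩
  ∑∑ f + (Y + Y)
    ≡⟨ cong (∑∑ f +_) (∑∑-+ (common π σ) (common π σ)) ⟨
  ∑∑ f + ∑∑ cc
    ≡⟨ ∑∑-+ f cc ⟨
  ∑∑ (λ i j → f i j + cc i j)
    ≡⟨ ∑∑-cong (inv#-⊙-at π σ p q) ⟩
  ∑∑ (λ i j → g i j + h i j)
    ≡⟨ ∑∑-+ g h ⟩
  ∑∑ g + ∑∑ h
    ≡⟨ cong₂ _+_ (sym (inv#-∑∑ σ)) (∑∑-flips< π q) ⟩
  ℤ.+ inv# σ + ℤ.+ inv# π
    ∎
  where
  open ≡-Reasoning
  Y : ℤ
  Y = ∑∑ (common π σ)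
  f g h cc : Fin n → Fin n → ℤ
  f i j = lt i j * lt (lookup π (lookup σ j)) (lookup π (lookup σ i))
  g i j = lt i j * lt (lookup σ j) (lookup σ i)
  h i j = lt i j * flips π (lookup σ i) (lookup σ j)
  cc i j = common π σ i j + common π σ i j

opaque
  unfolding ∑∑

  ∑∑-nonneg : (f : Fin n → Fin n → ℤ) → (∀ i j → 0ℤ ℤ.≤ f i j) → 0ℤ ℤ.≤ ∑∑ f
  ∑∑-nonneg f h = ∑-nonneg (allFin _) λ i → ∑-nonneg (allFin _) (h i)

sgn-⊙ : {π σ : Perm n} → Inj π → Inj σ → sgn (π ⊙ σ) ≡ sgn π * sgn σ
sgn-⊙ {n} {π} {σ} p q = begin
  sgn (π ⊙ σ)                                    ≡⟨ sgn-parity (π ⊙ σ) ⟩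
  parity k                                       ≡⟨ ℤₚ.*-identityʳ (parity k) ⟨
  parity k * 1ℤ                                  ≡⟨ cong (parity k *_) (trans (parity-+ y y) (parity²≡1 y)) ⟨
  parity k * parity (y ℕ.+ y)                    ≡⟨ parity-+ k (y ℕ.+ y) ⟨
  parity (k ℕ.+ (y ℕ.+ y))                       ≡⟨ cong parity (ℤₚ.+-injective {k ℕ.+ (y ℕ.+ y)} {a ℕ.+ b} eq) ⟩
  parity (a ℕ.+ b)                               ≡⟨ parity-+ a b ⟩
  parity a * parity b                            ≡⟨ cong₂ _*_ (sgn-parity π) (sgn-parity σ) ⟨
  sgn π * sgn σ                                  ∎
  where
  open ≡-Reasoning
  k a b y : ℕ
  k = inv# (π ⊙ σ)
  a = inv# π
  b = inv# σ
  Y : ℤ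
  Y = ∑∑ (common π σ)
  y = ∣ Y ∣
  +y : ℤ.+ y ≡ Y
  +y = ℤₚ.0≤i⇒+∣i∣≡i (∑∑-nonneg (common π σ) (common-nonneg π σ))
  eq : ℤ.+ (k ℕ.+ (y ℕ.+ y)) ≡ ℤ.+ (a ℕ.+ b)
  eq = begin
    ℤ.+ k + (ℤ.+ y + ℤ.+ y)   ≡⟨ cong (λ t → ℤ.+ k + (t + t)) +y ⟩
    ℤ.+ k + (Y + Y)           ≡⟨ inv#-⊙ π σ p q ⟩
    ℤ.+ b + ℤ.+ a             ≡⟨ ℤₚ.+-comm (ℤ.+ b) (ℤ.+ a) ⟩
    ℤ.+ a + ℤ.+ b             ∎

sgn²≡1 : (σ : Perm n) → sgn σ * sgn σ ≡ 1ℤ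
sgn²≡1 σ = trans (cong₂ _*_ (sgn-parity σ) (sgn-parity σ)) (parity²≡1 (inv# σ))

sgn-id : sgn (idP {n}) ≡ 1ℤ
sgn-id {n} = trans (cong sgn (sym (⊙-identityˡ (idP {n})))) (trans (sgn-⊙ (Inj-id {n}) (Inj-id {n})) (sgn²≡1 (idP {n})))

sgn-inv : {σ : Perm n} → Inj σ → sgn (inv σ) ≡ sgn σ
sgn-inv {σ = σ} p = begin
  sgn (inv σ)                        ≡⟨ ℤₚ.*-identityʳ (sgn (inv σ)) ⟨
  sgn (inv σ) * 1ℤ                   ≡⟨ cong (sgn (inv σ) *_) (sgn²≡1 σ) ⟨
  sgn (inv σ) * (sgn σ * sgn σ)      ≡⟨ ℤₚ.*-assoc (sgn (inv σ)) (sgn σ) (sgn σ) ⟨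
  sgn (inv σ) * sgn σ * sgn σ        ≡⟨ cong (_* sgn σ) (sgn-⊙ (Inj-inv p) p) ⟨
  sgn (inv σ ⊙ σ) * sgn σ            ≡⟨ cong (_* sgn σ) (trans (cong sgn (⊙-invˡ p)) sgn-id) ⟩
  1ℤ * sgn σ                         ≡⟨ ℤₚ.*-identityˡ (sgn σ) ⟩
  sgn σ                              ∎
  where open ≡-Reasoning

sgn-conj : {w σ : Perm n} → Inj w → Inj σ → sgn (w ⊙ (σ ⊙ inv w)) ≡ sgn σ
sgn-conj {w = w} {σ} p q = begin
  sgn (w ⊙ (σ ⊙ inv w))           ≡⟨ sgn-⊙ p (Inj-⊙ q (Inj-inv p)) ⟩
  sgn w * sgn (σ ⊙ inv w)         ≡⟨ cong (sgn w *_) (trans (sgn-⊙ q (Inj-inv p)) (cong (sgn σ *_) (sgn-inv p))) ⟩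
  sgn w * (sgn σ * sgn w)         ≡⟨ lemma (sgn w) (sgn σ) ⟩
  sgn w * sgn w * sgn σ           ≡⟨ cong (_* sgn σ) (sgn²≡1 w) ⟩
  1ℤ * sgn σ                      ≡⟨ ℤₚ.*-identityˡ (sgn σ) ⟩
  sgn σ                           ∎
  where
  open ≡-Reasoning
  lemma : ∀ a b → a * (b * a) ≡ a * a * b
  lemma = solve-∀

opaque
  unfolding lt ∑∑ swap

  -- The pair of the points 0 and 1 is the only inversion.
  sgn-swap01 : ∀ m → sgn (swap {suc (suc m)} zero (suc zero)) ≡ -1ℤ
  sgn-swap01 m = trans (sgn-parity t) (cong parity (ℤₚ.+-injective {inv# t} {1} (trans (inv#-∑∑ t)
    (trans (∑-point (Uniqueₚ.allFin⁺ top) (∈allFin zero) (λ {i} _ i≢ → ∑-zero∈ (allFin top) (λ {j} _ → row i j i≢)))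
           (∑-point (Uniqueₚ.allFin⁺ top) (∈allFin (suc zero)) (λ {j} _ → first j))))))
    where
    top : ℕ
    top = suc (suc m)
    t : Perm top
    t = swap {top} zero (suc zero)
    fixed : ∀ j → lookup t (suc (suc j)) ≡ suc (suc j)
    fixed j = swap-o zero (suc zero) (λ ()) (λ ())
    row : ∀ i j → i ≢ zero → lt i j * lt (lookup t j) (lookup t i) ≡ 0ℤ
    row zero                j                h = ⊥-elim (h refl)
    row (suc zero)          j                h = ℤₚ.*-zeroʳ (lt (suc zero) j)
    row (suc (suc i))       zero             h = refl
    row (suc (suc i))       (suc zero)       h = refl
    row (suc (suc i))       (suc (suc j))    h =
      trans (cong₂ (λ x y → lt (suc (suc i)) (suc (suc j)) * lt x y) (fixed j) (fixed i)) (lt-antisym (suc (suc i)) (suc (suc j)))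
    first : ∀ j → j ≢ suc zero → lt zero j * lt (lookup t j) (lookup t zero) ≡ 0ℤ
    first zero          h = refl
    first (suc zero)    h = ⊥-elim (h refl)
    first (suc (suc j)) h rewrite fixed j = refl

swap-conj : {w : Perm n} → Inj w → ∀ a b → w ⊙ (swap a b ⊙ inv w) ≡ swap (lookup w a) (lookup w b)
swap-conj {w = w} p a b = ext λ i →
  trans (lookup-⊙ w (swap a b ⊙ inv w) i) (trans (cong (lookup w) (lookup-⊙ (swap a b) (inv w) i))
    (trans (go (lookup (inv w) i)) (cong (lookup (swap (lookup w a) (lookup w b))) (lookup-invʳ p i))))
  where
  go : ∀ j → lookup w (lookup (swap a b) j) ≡ lookup (swap (lookup w a) (lookup w b)) (lookup w j)
  go j with swapView a b j
  ... | isL refl e rewrite e = sym (swap-l (lookup w a) (lookup w b))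
  ... | isR refl e rewrite e = sym (swap-r (lookup w a) (lookup w b))
  ... | isO h k e rewrite e = sym (swap-o (lookup w a) (lookup w b) (h ∘ inj p) (k ∘ inj p))

-- Inversions are counted only for the transposition of 0 and 1. Any other transposition is its
-- conjugate by a `w` that takes 0 to `a` and 1 to `b`.
sgn-swap : {a b : Fin n} → a ≢ b → sgn (swap a b) ≡ -1ℤ
sgn-swap {suc zero} {zero} {zero} a≢b = ⊥-elim (a≢b refl)
sgn-swap {suc (suc m)} {a} {b} a≢b = begin
  sgn (swap a b)                                            ≡⟨ cong₂ (λ x y → sgn (swap x y)) w0 w1 ⟨
  sgn (swap (lookup w zero) (lookup w (suc zero)))          ≡⟨ cong sgn (swap-conj w-inj zero (suc zero)) ⟨
  sgn (w ⊙ (swap zero (suc zero) ⊙ inv w))                  ≡⟨ sgn-conj w-inj (Inj-swap zero (suc zero)) ⟩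
  sgn (swap {suc (suc m)} zero (suc zero))                  ≡⟨ sgn-swap01 m ⟩
  -1ℤ                                                       ∎
  where
  open ≡-Reasoning
  s = swap zero a
  -- `s` is applied last in `w`, so 1 must first go to the point that `s` takes to `b`; `s` is an
  -- involution.
  b′ = lookup s b
  b′≢0 : b′ ≢ zero
  b′≢0 e = a≢b (sym (trans (sym (swap-invol zero a b)) (trans (cong (lookup s) e) (swap-l zero a))))
  w = s ⊙ swap (suc zero) b′
  w-inj = Inj-⊙ (Inj-swap zero a) (Inj-swap (suc zero) b′)
  w0 : lookup w zero ≡ a
  w0 = trans (lookup-⊙ s (swap (suc zero) b′) zero) (trans (cong (lookup s) (swap-o (suc zero) b′ (λ ()) (b′≢0 ∘ sym))) (swap-l zero a))
  w1 : lookup w (suc zero) ≡ b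
  w1 = trans (lookup-⊙ s (swap (suc zero) b′) (suc zero)) (trans (cong (lookup s) (swap-l (suc zero) b′)) (swap-invol zero a b))

-- Hook coefficients

-- A ⊆ Fin N stands for the set of points suc i, i ∈ A; the point zero is never in it.
tgt : Perm (suc N) → Vec Bool N → Fin N → Fin (suc N)
tgt x A i = if lookup A i then lookup x (suc i) else suc i

tgt-in : (x : Perm (suc N)) (A : Vec Bool N) {i : Fin N} → lookup A i ≡ true → tgt x A i ≡ lookup x (suc i)
tgt-in x A {i} e rewrite e = refl

tgt-out : (x : Perm (suc N)) (A : Vec Bool N) {i : Fin N} → lookup A i ≡ false → tgt x A i ≡ suc i
tgt-out x A {i} e rewrite e = refl

record Agrees (c x : Perm (suc N)) (A : Vec Bool N) : Set where
  constructor mkAgrees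
  field agrees : ∀ i → lookup c (suc i) ≡ tgt x A i
open Agrees

agrees? : (c x : Perm (suc N)) (A : Vec Bool N) → Dec (Agrees c x A)
agrees? c x A with Finₚ.all? (λ i → lookup c (suc i) ≟ tgt x A i)
... | yes h = yes (mkAgrees h)
... | no ¬h = no (¬h ∘ agrees)

agrees-in : {c x : Perm (suc N)} {A : Vec Bool N} → Agrees c x A → ∀ {i} → lookup A i ≡ true →
            lookup c (suc i) ≡ lookup x (suc i)
agrees-in {x = x} {A} h {i} e = trans (agrees h i) (tgt-in x A e)

agrees-out : {c x : Perm (suc N)} {A : Vec Bool N} → Agrees c x A → ∀ {i} → lookup A i ≡ false →
             lookup c (suc i) ≡ suc i
agrees-out {x = x} {A} h {i} e = trans (agrees h i) (tgt-out x A e)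

bool-cases : (b : Bool) → b ≡ true ⊎ b ≡ false
bool-cases true  = inj₁ refl
bool-cases false = inj₂ refl

true≢false : {b : Bool} → b ≡ true → b ≢ false
true≢false refl ()

mk-agrees : {c x : Perm (suc N)} {A : Vec Bool N} →
            (∀ {i} → lookup A i ≡ true → lookup c (suc i) ≡ lookup x (suc i)) →
            (∀ {i} → lookup A i ≡ false → lookup c (suc i) ≡ suc i) → Agrees c x A
mk-agrees {c = c} {x} {A} h k = mkAgrees go
  where
  go : ∀ i → lookup c (suc i) ≡ tgt x A i
  go i with bool-cases (lookup A i)
  ... | inj₁ e = trans (h e) (sym (tgt-in x A e))
  ... | inj₂ e = trans (k e) (sym (tgt-out x A e))

-- The image of the point zero is forced, being the one value left over. Hence at most one
-- permutation contributes to `F A x`.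
agree-off-zero : {c d : Perm (suc N)} → Inj c → Inj d →
                 (∀ i → lookup c (suc i) ≡ lookup d (suc i)) → c ≡ d
agree-off-zero {c = c} {d} p q h = ext go
  where
  at-zero : ∀ j → lookup c j ≡ lookup d zero → lookup c zero ≡ lookup d zero
  at-zero zero    e = e
  at-zero (suc i) e with inj q (trans (sym (h i)) e)
  ... | ()
  go : ∀ i → lookup c i ≡ lookup d i
  go zero    = at-zero (lookup (inv c) (lookup d zero)) (lookup-invʳ p (lookup d zero))
  go (suc i) = h i

-- At most one c contributes, so F A x is 0 or ±1. It is a matrix coefficient of the hook representation
-- (n - |A| , 1^|A|) of S_n.
opaque
  F : Vec Bool N → Perm (suc N) → ℤ
  F {N} A x = ∑ (S (suc N)) λ c → sgn c * ι (agrees? c x A)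

  F-∑ : (A : Vec Bool N) (x : Perm (suc N)) → F A x ≡ ∑ (S (suc N)) λ c → sgn c * ι (agrees? c x A)
  F-∑ A x = refl

F-value : {A : Vec Bool N} {x c : Perm (suc N)} → Inj c → Agrees c x A → F A x ≡ sgn c
F-value {N} {A} {x} {c} p h = begin
  F A x                                               ≡⟨ F-∑ A x ⟩
  ∑ (S (suc N)) (λ d → sgn d * ι (agrees? d x A))     ≡⟨ ∑-point (S-unique (suc N)) (Inj⇒∈S p) other ⟩
  sgn c * ι (agrees? c x A)                           ≡⟨ cong (sgn c *_) (ι-yes (agrees? c x A) h) ⟩
  sgn c * 1ℤ                                          ≡⟨ ℤₚ.*-identityʳ (sgn c) ⟩
  sgn c                                               ∎
  where
  open ≡-Reasoning
  other : ∀ {d} → d ∈ S (suc N) → d ≢ c → sgn d * ι (agrees? d x A) ≡ 0ℤ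
  other {d} d∈ d≢c = trans (cong (sgn d *_) (ι-no (agrees? d x A) λ k →
    d≢c (agree-off-zero (∈S⇒Inj d∈) p (λ i → trans (agrees k i) (sym (agrees h i)))))) (ℤₚ.*-zeroʳ (sgn d))

F-zero : {A : Vec Bool N} {x : Perm (suc N)} → (∀ {c} → Inj c → ¬ Agrees c x A) → F A x ≡ 0ℤ
F-zero {N} {A} {x} h = trans (F-∑ A x) (∑-zero∈ (S (suc N)) λ {d} d∈ →
  trans (cong (sgn d *_) (ι-no (agrees? d x A) (h (∈S⇒Inj d∈)))) (ℤₚ.*-zeroʳ (sgn d)))

-- Otherwise a choice of preimages would inject `Fin (suc m)` into `Fin m`.
missed-value : ∀ {m} (h : Fin m → Fin (suc m)) → ∃ λ j → ∀ i → h i ≢ j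
missed-value {m} h with Finₚ.any? (λ j → Finₚ.all? (λ i → ¬? (h i ≟ j)))
... | yes p = p
... | no ¬p = ⊥-elim (clash (Finₚ.pigeonhole (ℕₚ.n<1+n m) s))
  where
  hit : ∀ j → ∃ λ i → h i ≡ j
  hit j with Finₚ.any? (λ i → h i ≟ j)
  ... | yes q = q
  ... | no ¬q = ⊥-elim (¬p (j , λ i e → ¬q (i , e)))
  s : Fin (suc m) → Fin m
  s = proj₁ ∘ hit
  clash : (∃₂ λ i j → i Fin.< j × s i ≡ s j) → _
  clash (i , j , i<j , e) = Finₚ.<⇒≢ i<j (trans (sym (proj₂ (hit i))) (trans (cong h e) (proj₂ (hit j))))

extend : (g : Fin N → Fin (suc N)) → (∀ {i j} → g i ≡ g j → i ≡ j) →
         ∃ λ c → Inj c × (∀ i → lookup c (suc i) ≡ g i)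
extend {N} g g-inj with missed-value g
... | j , j∉ = c , mkInj (λ {a} {b} → c-inj a b) , (λ i → c-suc i)
  where
  c : Perm (suc N)
  c = j ∷ tabulate g
  c-suc : ∀ i → lookup c (suc i) ≡ g i
  c-suc = Vecₚ.lookup∘tabulate g
  c-inj : ∀ a b → lookup c a ≡ lookup c b → a ≡ b
  c-inj zero    zero    e = refl
  c-inj zero    (suc b) e = ⊥-elim (j∉ b (sym (trans e (c-suc b))))
  c-inj (suc a) zero    e = ⊥-elim (j∉ a (trans (sym (c-suc a)) e))
  c-inj (suc a) (suc b) e = cong suc (g-inj (trans (sym (c-suc a)) (trans e (c-suc b))))

-- A repeated value is not lost when `i` is dropped, and this frees one slot. The slot holds an
-- arbitrary point in the first search and `j` in the second, so that the second missed value
-- differs from `j`.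
two-missed-values : (g : Fin N → Fin (suc N)) {i i′ : Fin N} → i ≢ i′ → g i ≡ g i′ →
                    ∃₂ λ j j′ → j ≢ j′ × (∀ k → g k ≢ j) × (∀ k → g k ≢ j′)
two-missed-values {suc N} g {i} {i′} i≢i′ e =
  j , j′ , proj₂ m′ zero , avoid j (proj₂ m ∘ suc) , avoid j′ (proj₂ m′ ∘ suc)
  where
  h : Fin (suc (suc N)) → Fin (suc N) → Fin (suc (suc N))
  h a zero    = a
  h a (suc k) = g (Fin.punchIn i k)
  m  = missed-value (h zero)
  j  = proj₁ m
  m′ = missed-value (h j)
  j′ = proj₁ m′
  avoid : ∀ b → (∀ k → g (Fin.punchIn i k) ≢ b) → ∀ k → g k ≢ b
  avoid b hb k gk≡b with i ≟ k
  ... | yes refl = hb (Fin.punchOut i≢i′) (trans (cong g (Finₚ.punchIn-punchOut i≢i′)) (trans (sym e) gk≡b))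
  ... | no i≢k   = hb (Fin.punchOut i≢k) (trans (cong g (Finₚ.punchIn-punchOut i≢k)) gk≡b)

record Clash (x : Perm (suc N)) (A : Vec Bool N) : Set where
  constructor mkClash
  field
    {i i′} : Fin N
    in-A   : lookup A i ≡ true
    out-A  : lookup A i′ ≡ false
    maps   : lookup x (suc i) ≡ suc i′

-- The values of `tgt x A` on `A` are distinct, and so are those off `A`. A repetition therefore
-- pairs a point of `A` with one outside it, which is a clash. Without one, `tgt x A` is injective
-- and extends to the point zero.
dichotomy : {x : Perm (suc N)} → Inj x → (A : Vec Bool N) → (∃ λ c → Inj c × Agrees c x A) ⊎ Clash x A
dichotomy {N} {x} p A
  with Finₚ.any? (λ i → Finₚ.any? λ i′ → (lookup A i Boolₚ.≟ true) ×-dec (lookup A i′ Boolₚ.≟ false)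
                                         ×-dec (lookup x (suc i) ≟ suc i′))
... | yes (_ , _ , a , b , e) = inj₂ (mkClash a b e)
... | no ¬clash = inj₁ (proj₁ E , proj₁ (proj₂ E) , mkAgrees (proj₂ (proj₂ E)))
  where
  tgt-inj : ∀ {i j} → tgt x A i ≡ tgt x A j → i ≡ j
  tgt-inj {i} {j} e with bool-cases (lookup A i) | bool-cases (lookup A j)
  ... | inj₁ a | inj₁ b =
    Finₚ.suc-injective (inj p (trans (sym (tgt-in x A a)) (trans e (tgt-in x A b))))
  ... | inj₁ a | inj₂ b =
    ⊥-elim (¬clash (i , j , a , b , trans (sym (tgt-in x A a)) (trans e (tgt-out x A b))))
  ... | inj₂ a | inj₁ b =
    ⊥-elim (¬clash (j , i , b , a , trans (sym (tgt-in x A b)) (trans (sym e) (tgt-out x A a))))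
  ... | inj₂ a | inj₂ b =
    Finₚ.suc-injective (trans (sym (tgt-out x A a)) (trans e (tgt-out x A b)))
  E = extend (tgt x A) (λ {i} {j} → tgt-inj {i} {j})

clash-¬agrees : {c x : Perm (suc N)} {A : Vec Bool N} → Clash x A → Inj c → ¬ Agrees c x A
clash-¬agrees (mkClash a b e) p h
  with refl ← Finₚ.suc-injective (inj p (trans (agrees-in h a) (trans e (sym (agrees-out h b)))))
  = true≢false a b

-- A clash makes `tgt x A` repeat a value, so two values are missed. The transposition of these two
-- is the sign-reversing element in `bi-equivariant`.
clash-missed : {x : Perm (suc N)} {A : Vec Bool N} → Clash x A →
               ∃₂ λ j j′ → j ≢ j′ × (∀ k → tgt x A k ≢ j) × (∀ k → tgt x A k ≢ j′)
clash-missed {x = x} {A} (mkClash a b e) = two-missed-values (tgt x A)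
  (λ { refl → true≢false a b }) (trans (tgt-in x A a) (trans e (sym (tgt-out x A b))))

-- The conditions for the column and the row group of the hook tableau with `zero` in the corner,
-- `A` down the first column and the complement of `A` along the first row.
Col Row : Perm (suc N) → Vec Bool N → Set
Col c A = ∀ i → lookup A i ≡ false → lookup c (suc i) ≡ suc i
Row r A = ∀ i → lookup A i ≡ true  → lookup r (suc i) ≡ suc i

neg-fixed⇒zero : ∀ a → a ≡ -1ℤ * a → a ≡ 0ℤ
neg-fixed⇒zero (ℤ.+ zero)    _ = refl
neg-fixed⇒zero (ℤ.+ suc k)   ()
neg-fixed⇒zero (ℤ.-[1+ k ])  ()

-- Von Neumann's lemma for hooks. If x is not in Col A · Row A, some transposition t in Col A satisfies
-- x⁻¹ t x ∈ Row A, which forces φ x = - φ x.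
bi-equivariant : (A : Vec Bool N) (φ : Perm (suc N) → ℤ) →
  (∀ c x → Inj c → Inj x → Col c A → φ (c ⊙ x) ≡ sgn c * φ x) →
  (∀ r x → Inj r → Inj x → Row r A → φ (x ⊙ r) ≡ φ x) →
  ∀ {x} → Inj x → φ x ≡ F A x * φ idP
bi-equivariant {N} A φ col row {x} p with dichotomy p A
... | inj₁ (c , q , h) = begin
  φ x                   ≡⟨ cong φ (inv-cancelˡ′ q x) ⟨
  φ (c ⊙ r)             ≡⟨ col c r q r-inj (λ i e → agrees-out h e) ⟩
  sgn c * φ r           ≡⟨ cong (λ s → sgn c * φ s) (⊙-identityˡ r) ⟨
  sgn c * φ (idP ⊙ r)   ≡⟨ cong (sgn c *_) (row r idP r-inj Inj-id r-row) ⟩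
  sgn c * φ idP         ≡⟨ cong (_* φ idP) (F-value q h) ⟨
  F A x * φ idP         ∎
  where
  open ≡-Reasoning
  r = inv c ⊙ x
  r-inj : Inj r
  r-inj = Inj-⊙ (Inj-inv q) p
  r-row : Row r A
  r-row i e = trans (lookup-⊙ (inv c) x (suc i))
                    (trans (cong (lookup (inv c)) (sym (agrees-in h e))) (lookup-invˡ q (suc i)))
... | inj₂ cl = trans (neg-fixed⇒zero (φ x) self-neg) (sym (trans (cong (_* φ idP) (F-zero (clash-¬agrees cl))) (ℤₚ.*-zeroˡ (φ idP))))
  where
  open ≡-Reasoning
  missed = clash-missed cl
  j  = proj₁ missed
  j′ = proj₁ (proj₂ missed)
  j≢j′ = proj₁ (proj₂ (proj₂ missed))
  j∉  = proj₁ (proj₂ (proj₂ (proj₂ missed)))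
  j′∉ = proj₂ (proj₂ (proj₂ (proj₂ missed)))
  t = swap j j′
  t-fixes : ∀ {k} i → k ≡ tgt x A i → lookup t k ≡ k
  t-fixes i refl = swap-o j j′ (j∉ i) (j′∉ i)
  r = inv x ⊙ (t ⊙ x)
  r-row : Row r A
  r-row i e = begin
    lookup r (suc i)                                     ≡⟨ lookup-⊙ (inv x) (t ⊙ x) (suc i) ⟩
    lookup (inv x) (lookup (t ⊙ x) (suc i))              ≡⟨ cong (lookup (inv x)) (lookup-⊙ t x (suc i)) ⟩
    lookup (inv x) (lookup t (lookup x (suc i)))         ≡⟨ cong (lookup (inv x)) (t-fixes i (sym (tgt-in x A e))) ⟩
    lookup (inv x) (lookup x (suc i))                    ≡⟨ lookup-invˡ p (suc i) ⟩
    suc i                                                ∎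
  self-neg : φ x ≡ -1ℤ * φ x
  self-neg = begin
    φ x            ≡⟨ row r x (Inj-⊙ (Inj-inv p) (Inj-⊙ (Inj-swap j j′) p)) p r-row ⟨
    φ (x ⊙ r)      ≡⟨ cong φ (inv-cancelˡ′ p (t ⊙ x)) ⟩
    φ (t ⊙ x)      ≡⟨ col t x (Inj-swap j j′) p (λ i e → t-fixes i (sym (tgt-out x A e))) ⟩
    sgn t * φ x    ≡⟨ cong (_* φ x) (sgn-swap j≢j′) ⟩
    -1ℤ * φ x      ∎

-- Multiplication by `c` permutes the candidates: since `c` fixes the points outside `A`, agreement
-- with `x` becomes agreement with `c ⊙ x`.
F-col : (A : Vec Bool N) {c x : Perm (suc N)} → Inj c → Inj x → Col c A → F A (c ⊙ x) ≡ sgn c * F A x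
F-col {N} A {c} {x} p q col = begin
  F A (c ⊙ x)
    ≡⟨ F-∑ A (c ⊙ x) ⟩
  ∑ Sₙ (λ d → sgn d * ι (agrees? d (c ⊙ x) A))
    ≡⟨ ∑-translateˡ p (λ d → sgn d * ι (agrees? d (c ⊙ x) A)) ⟨
  ∑ Sₙ (λ d → sgn (c ⊙ d) * ι (agrees? (c ⊙ d) (c ⊙ x) A))
    ≡⟨ ∑-cong∈ Sₙ (λ {d} d∈ → trans
         (cong₂ _*_ (sgn-⊙ p (∈S⇒Inj d∈)) (ι-cong (agrees? (c ⊙ d) (c ⊙ x) A) (agrees? d x A) to from))
         (ℤₚ.*-assoc (sgn c) (sgn d) (ι (agrees? d x A)))) ⟩
  ∑ Sₙ (λ d → sgn c * (sgn d * ι (agrees? d x A)))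
    ≡⟨ ∑-*ˡ Sₙ (sgn c) (λ d → sgn d * ι (agrees? d x A)) ⟩
  sgn c * ∑ Sₙ (λ d → sgn d * ι (agrees? d x A))
    ≡⟨ cong (sgn c *_) (F-∑ A x) ⟨
  sgn c * F A x
    ∎
  where
  open ≡-Reasoning
  Sₙ = S (suc N)
  to : ∀ {d} → Agrees (c ⊙ d) (c ⊙ x) A → Agrees d x A
  to {d} h = mk-agrees
    (λ {i} e → inj p (trans (sym (lookup-⊙ c d (suc i))) (trans (agrees-in h e) (lookup-⊙ c x (suc i)))))
    (λ {i} e → inj p (trans (sym (lookup-⊙ c d (suc i))) (trans (agrees-out h e) (sym (col i e)))))
  from : ∀ {d} → Agrees d x A → Agrees (c ⊙ d) (c ⊙ x) A
  from {d} h = mk-agrees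
    (λ {i} e → trans (lookup-⊙ c d (suc i)) (trans (cong (lookup c) (agrees-in h e)) (sym (lookup-⊙ c x (suc i)))))
    (λ {i} e → trans (lookup-⊙ c d (suc i)) (trans (cong (lookup c) (agrees-out h e)) (col i e)))

F-cong : (A : Vec Bool N) {x y : Perm (suc N)} →
         (∀ {i} → lookup A i ≡ true → lookup x (suc i) ≡ lookup y (suc i)) → F A x ≡ F A y
F-cong {N} A {x} {y} h = trans (F-∑ A x) (trans
  (∑-cong (S (suc N)) (λ d → cong (sgn d *_) (ι-cong (agrees? d x A) (agrees? d y A)
     (λ k → mk-agrees (λ e → trans (agrees-in k e) (h e)) (agrees-out k))
     (λ k → mk-agrees (λ e → trans (agrees-in k e) (sym (h e))) (agrees-out k)))))
  (sym (F-∑ A y)))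

F-row : (A : Vec Bool N) {r x : Perm (suc N)} → Row r A → F A (x ⊙ r) ≡ F A x
F-row A {r} {x} row = F-cong A λ {i} e → trans (lookup-⊙ x r (suc i)) (cong (lookup x) (row i e))

opaque
  conj : Perm n → Perm n → Perm n
  conj y z = y ⊙ (z ⊙ inv y)

  conj-def : (y z : Perm n) → conj y z ≡ y ⊙ (z ⊙ inv y)
  conj-def y z = refl

  Inj-conj : {y z : Perm n} → Inj y → Inj z → Inj (conj y z)
  Inj-conj p q = Inj-⊙ p (Inj-⊙ q (Inj-inv p))

  conj-⊙ : {r y z : Perm n} → Inj r → Inj y → conj (r ⊙ y) z ≡ conj r (conj y z)
  conj-⊙ {r = r} {y} {z} p q = begin
    (r ⊙ y) ⊙ (z ⊙ inv (r ⊙ y))             ≡⟨ cong (λ t → (r ⊙ y) ⊙ (z ⊙ t)) (inv-⊙ p q) ⟩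
    (r ⊙ y) ⊙ (z ⊙ (inv y ⊙ inv r))         ≡⟨ ⊙-assoc r y _ ⟩
    r ⊙ (y ⊙ (z ⊙ (inv y ⊙ inv r)))         ≡⟨ cong (λ t → r ⊙ (y ⊙ t)) (⊙-assoc z (inv y) (inv r)) ⟨
    r ⊙ (y ⊙ ((z ⊙ inv y) ⊙ inv r))         ≡⟨ cong (r ⊙_) (⊙-assoc y (z ⊙ inv y) (inv r)) ⟨
    r ⊙ ((y ⊙ (z ⊙ inv y)) ⊙ inv r)         ∎
    where open ≡-Reasoning

-- n! times the normalised character of the hook (n - |A| , 1^|A|).
opaque
  R : Vec Bool N → Perm (suc N) → ℤ
  R {N} A z = ∑ (S (suc N)) λ y → F A (conj y z)

  R-∑ : (A : Vec Bool N) (z : Perm (suc N)) → R A z ≡ ∑ (S (suc N)) λ y → F A (conj y z)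
  R-∑ A z = refl

Row-inv : {r : Perm (suc N)} (A : Vec Bool N) → Inj r → Row r A → Row (inv r) A
Row-inv {r = r} A p row i e = inj p (trans (lookup-invʳ p (suc i)) (sym (row i e)))

-- The counterpart of Schur's lemma: averaged over its conjugates, `z` acts by a scalar. A row
-- permutation `r` passes through `conj y z` at the price of turning `y` into `r ⊙ y`, which the sum
-- over `y` absorbs, and is then swallowed by `F-row`. So `bi-equivariant` applies, and the scalar
-- is the value at `idP`.
schur : (A : Vec Bool N) {x z : Perm (suc N)} → Inj x → Inj z →
        ∑ (S (suc N)) (λ y → F A (x ⊙ conj y z)) ≡ F A x * R A z
schur {N} A {x} {z} p q = trans (bi-equivariant A φ col row p) (cong (F A x *_) φ-id)
  where
  open ≡-Reasoning
  Sₙ = S (suc N)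
  φ : Perm (suc N) → ℤ
  φ x = ∑ Sₙ λ y → F A (x ⊙ conj y z)
  col : ∀ c x → Inj c → Inj x → Col c A → φ (c ⊙ x) ≡ sgn c * φ x
  col c x p-c p-x cc = begin
    ∑ Sₙ (λ y → F A ((c ⊙ x) ⊙ conj y z))      ≡⟨ ∑-cong∈ Sₙ (λ {y} y∈ → trans (cong (F A) (⊙-assoc c x (conj y z)))
                                                   (F-col A p-c (Inj-⊙ p-x (Inj-conj (∈S⇒Inj y∈) q)) cc)) ⟩
    ∑ Sₙ (λ y → sgn c * F A (x ⊙ conj y z))    ≡⟨ ∑-*ˡ Sₙ (sgn c) (λ y → F A (x ⊙ conj y z)) ⟩
    sgn c * φ x                                ∎
  row : ∀ r x → Inj r → Inj x → Row r A → φ (x ⊙ r) ≡ φ x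
  row r x p-r p-x rr = begin
    ∑ Sₙ (λ y → F A ((x ⊙ r) ⊙ conj y z))        ≡⟨ ∑-cong∈ Sₙ (λ {y} y∈ → step y (∈S⇒Inj y∈)) ⟩
    ∑ Sₙ (λ y → F A (x ⊙ conj (r ⊙ y) z))        ≡⟨ ∑-translateˡ p-r (λ y → F A (x ⊙ conj y z)) ⟩
    φ x                                          ∎
    where
    step : ∀ y → Inj y → F A ((x ⊙ r) ⊙ conj y z) ≡ F A (x ⊙ conj (r ⊙ y) z)
    step y p-y = begin
      F A ((x ⊙ r) ⊙ conj y z)               ≡⟨ F-row A (Row-inv A p-r rr) ⟨
      F A (((x ⊙ r) ⊙ conj y z) ⊙ inv r)     ≡⟨ cong (F A) (trans (⊙-assoc (x ⊙ r) (conj y z) (inv r)) (trans (⊙-assoc x r (conj y z ⊙ inv r))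
                                                  (cong (x ⊙_) (sym (conj-def r (conj y z)))))) ⟩
      F A (x ⊙ conj r (conj y z))            ≡⟨ cong (λ t → F A (x ⊙ t)) (conj-⊙ p-r p-y) ⟨
      F A (x ⊙ conj (r ⊙ y) z)               ∎
  φ-id : φ idP ≡ R A z
  φ-id = trans (∑-cong Sₙ (λ y → cong (F A) (⊙-identityˡ (conj y z)))) (sym (R-∑ A z))

complement : Vec Bool N → Vec Bool N
complement = Vec.map not

-- Tensoring with the sign transposes a hook. Concretely, on the nonzero points `inv x ⊙ c` is the
-- identity where `c` agrees with `x`, and agrees with `inv x` where `c` is the identity.
F-complement : (A : Vec Bool N) {x : Perm (suc N)} → Inj x → F A x ≡ sgn x * F (complement A) (inv x)
F-complement {N} A {x} p = begin
  F A x
    ≡⟨ F-∑ A x ⟩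
  ∑ Sₙ (λ c → sgn c * ι (agrees? c x A))
    ≡⟨ ∑-cong∈ Sₙ (λ {c} c∈ → trans
         (cong₂ _*_ (sgn-split c (∈S⇒Inj c∈)) (ι-cong (agrees? c x A) (agrees? (inv x ⊙ c) (inv x) Aᶜ) to from))
         (ℤₚ.*-assoc (sgn x) (sgn (inv x ⊙ c)) (ι (agrees? (inv x ⊙ c) (inv x) Aᶜ)))) ⟩
  ∑ Sₙ (λ c → sgn x * (sgn (inv x ⊙ c) * ι (agrees? (inv x ⊙ c) (inv x) Aᶜ)))
    ≡⟨ ∑-*ˡ Sₙ (sgn x) (λ c → sgn (inv x ⊙ c) * ι (agrees? (inv x ⊙ c) (inv x) Aᶜ)) ⟩
  sgn x * ∑ Sₙ (λ c → sgn (inv x ⊙ c) * ι (agrees? (inv x ⊙ c) (inv x) Aᶜ))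
    ≡⟨ cong (sgn x *_) (∑-translateˡ (Inj-inv p) (λ d → sgn d * ι (agrees? d (inv x) Aᶜ))) ⟩
  sgn x * ∑ Sₙ (λ d → sgn d * ι (agrees? d (inv x) Aᶜ))
    ≡⟨ cong (sgn x *_) (F-∑ Aᶜ (inv x)) ⟨
  sgn x * F Aᶜ (inv x)
    ∎
  where
  open ≡-Reasoning
  Sₙ = S (suc N)
  Aᶜ = complement A
  sgn-split : ∀ c → Inj c → sgn c ≡ sgn x * sgn (inv x ⊙ c)
  sgn-split c q = trans (cong sgn (sym (inv-cancelˡ′ p c))) (sgn-⊙ p (Inj-⊙ (Inj-inv p) q))
  flip : ∀ {i b} → lookup Aᶜ i ≡ b → lookup A i ≡ not b
  flip {i} e = trans (sym (Boolₚ.not-involutive (lookup A i)))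
                     (cong not (trans (sym (Vecₚ.lookup-map i not A)) e))
  flip′ : ∀ {i b} → lookup A i ≡ b → lookup Aᶜ i ≡ not b
  flip′ {i} e = trans (Vecₚ.lookup-map i not A) (cong not e)
  to : ∀ {c} → Agrees c x A → Agrees (inv x ⊙ c) (inv x) Aᶜ
  to {c} h = mk-agrees
    (λ {i} e → trans (lookup-⊙ (inv x) c (suc i)) (cong (lookup (inv x)) (agrees-out h (flip e))))
    (λ {i} e → trans (lookup-⊙ (inv x) c (suc i))
      (trans (cong (lookup (inv x)) (agrees-in h (flip e))) (lookup-invˡ p (suc i))))
  from : ∀ {c} → Agrees (inv x ⊙ c) (inv x) Aᶜ → Agrees c x A
  from {c} h = mk-agrees
    (λ {i} e → inj (Inj-inv p) (trans (sym (lookup-⊙ (inv x) c (suc i)))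
      (trans (agrees-out h (flip′ e)) (sym (lookup-invˡ p (suc i))))))
    (λ {i} e → inj (Inj-inv p) (trans (sym (lookup-⊙ (inv x) c (suc i))) (agrees-in h (flip′ e))))

-- Bounds for hook characters

size : Vec Bool N → ℕ
size []          = 0
size (true ∷ A)  = suc (size A)
size (false ∷ A) = size A

insert : Vec Bool N → Fin N → Vec Bool N
insert A b = A Vec.[ b ]≔ true

insert-at : (A : Vec Bool N) (b : Fin N) → lookup (insert A b) b ≡ true
insert-at A b = Vecₚ.lookup∘update b A true

insert-off : (A : Vec Bool N) {b i : Fin N} → i ≢ b → lookup (insert A b) i ≡ lookup A i
insert-off A i≢b = Vecₚ.lookup∘update′ i≢b A true

insert-keeps : (A : Vec Bool N) (b : Fin N) {i : Fin N} → lookup A i ≡ true → lookup (insert A b) i ≡ true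
insert-keeps A b {i} e with i ≟ b
... | yes refl = insert-at A b
... | no i≢b   = trans (insert-off A i≢b) e

insert-true : (A : Vec Bool N) (b : Fin N) {i : Fin N} → lookup (insert A b) i ≡ true → i ≡ b ⊎ lookup A i ≡ true
insert-true A b {i} e with i ≟ b
... | yes p  = inj₁ p
... | no i≢b = inj₂ (trans (sym (insert-off A i≢b)) e)

insert-false : (A : Vec Bool N) (b : Fin N) {i : Fin N} → lookup (insert A b) i ≡ false → i ≢ b × lookup A i ≡ false
insert-false A b {i} e = i≢b , trans (sym (insert-off A i≢b)) e
  where
  i≢b : i ≢ b
  i≢b refl = true≢false (insert-at A b) e

opaque
  out : Vec Bool N → Fin N → ℤ
  out A b = ι (lookup A b Boolₚ.≟ false)

  out-out : (A : Vec Bool N) (b : Fin N) → lookup A b ≡ false → out A b ≡ 1ℤ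
  out-out A b = ι-yes (lookup A b Boolₚ.≟ false)

  out-in : (A : Vec Bool N) (b : Fin N) → lookup A b ≡ true → out A b ≡ 0ℤ
  out-in A b e = ι-no (lookup A b Boolₚ.≟ false) (true≢false e)

  out-total : (A : Vec Bool N) → ∑ (allFin N) (out A) ≡ ℤ.+ size (complement A)
  out-total []            = refl
  out-total {suc N} (true ∷ A)  = trans (∑-Fin-suc (out (true ∷ A))) (trans (ℤₚ.+-identityˡ (∑ (allFin N) (out A))) (out-total A))
  out-total {suc N} (false ∷ A) = trans (∑-Fin-suc (out (false ∷ A))) (cong (λ s → 1ℤ + s) (out-total A))

opaque
  isFixed : Perm n → Fin n → ℤ
  isFixed z i = ι (lookup z i ≟ i)

  isFixed-yes : (z : Perm n) (i : Fin n) → lookup z i ≡ i → isFixed z i ≡ 1ℤ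
  isFixed-yes z i = ι-yes (lookup z i ≟ i)

  isFixed-no : (z : Perm n) (i : Fin n) → lookup z i ≢ i → isFixed z i ≡ 0ℤ
  isFixed-no z i = ι-no (lookup z i ≟ i)

  isFixed-nonneg : (z : Perm n) (i : Fin n) → 0ℤ ℤ.≤ isFixed z i
  isFixed-nonneg z i = ι-nonneg (lookup z i ≟ i)

  isFixed-cong : (z : Perm n) (i : Fin n) {m : ℕ} (y : Perm m) (j : Fin m) →
                 (lookup z i ≡ i → lookup y j ≡ j) → (lookup y j ≡ j → lookup z i ≡ i) → isFixed z i ≡ isFixed y j
  isFixed-cong z i y j = ι-cong (lookup z i ≟ i) (lookup y j ≟ j)

fixpts : Perm n → ℤ
fixpts {n} z = ∑ (allFin n) (isFixed z)

fixpts-inv : {z : Perm n} → Inj z → fixpts (inv z) ≡ fixpts z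
fixpts-inv {n} {z} p = ∑-cong (allFin n) λ i → isFixed-cong (inv z) i z i
  (λ e → trans (cong (lookup z) (sym e)) (lookup-invʳ p i))
  (λ e → trans (cong (lookup (inv z)) (sym e)) (lookup-invˡ p i))

lookup-conj : {y z : Perm n} → Inj y → ∀ i → lookup (conj y z) (lookup y i) ≡ lookup y (lookup z i)
lookup-conj {y = y} {z} p i = begin
  lookup (conj y z) (lookup y i)                       ≡⟨ cong (λ t → lookup t (lookup y i)) (conj-def y z) ⟩
  lookup (y ⊙ (z ⊙ inv y)) (lookup y i)                ≡⟨ lookup-⊙ y (z ⊙ inv y) (lookup y i) ⟩
  lookup y (lookup (z ⊙ inv y) (lookup y i))           ≡⟨ cong (lookup y) (lookup-⊙ z (inv y) (lookup y i)) ⟩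
  lookup y (lookup z (lookup (inv y) (lookup y i)))    ≡⟨ cong (λ k → lookup y (lookup z k)) (lookup-invˡ p i) ⟩
  lookup y (lookup z i)                                ∎
  where open ≡-Reasoning

fixpts-conj : {y z : Perm n} → Inj y → fixpts (conj y z) ≡ fixpts z
fixpts-conj {n} {y} {z} p = trans (sym (∑-permute p (isFixed (conj y z)))) (∑-cong (allFin n) λ i →
  isFixed-cong (conj y z) (lookup y i) z i
    (λ e → inj p (trans (sym (lookup-conj p i)) e))
    (λ e → trans (lookup-conj p i) (cong (lookup y) e)))

∣sgn∣ : (σ : Perm n) → ∣ sgn σ ∣ ≡ 1
∣sgn∣ σ with parity-±1 (inv# σ)
... | inj₁ e = cong ∣_∣ (trans (sgn-parity σ) e)
... | inj₂ e = cong ∣_∣ (trans (sgn-parity σ) e)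

∣F∣≤1 : (A : Vec Bool N) {x : Perm (suc N)} → Inj x → ∣ F A x ∣ ℕ.≤ 1
∣F∣≤1 A {x} p with dichotomy p A
... | inj₁ (c , q , h) = ℕₚ.≤-reflexive (trans (cong ∣_∣ (F-value q h)) (∣sgn∣ c))
... | inj₂ cl          = ℕₚ.≤-trans (ℕₚ.≤-reflexive (cong ∣_∣ (F-zero {A = A} (clash-¬agrees cl)))) ℕ.z≤n

clash-insert : {z : Perm (suc N)} {A : Vec Bool N} (cl : Clash z A) {b : Fin N} → b ≢ Clash.i′ cl → Clash z (insert A b)
clash-insert {A = A} (mkClash {i} {i′} a e m) {b} b≢ =
  mkClash (insert-keeps A b a) (trans (insert-off A (b≢ ∘ sym)) e) m

opaque
  hits : Perm (suc N) → Fin (suc N) → Fin N → ℤ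
  hits z j b = ι (lookup z (suc b) ≟ j)

  hits-yes : (z : Perm (suc N)) (j : Fin (suc N)) (b : Fin N) → lookup z (suc b) ≡ j → hits z j b ≡ 1ℤ
  hits-yes z j b = ι-yes (lookup z (suc b) ≟ j)

  hits-no : (z : Perm (suc N)) (j : Fin (suc N)) (b : Fin N) → lookup z (suc b) ≢ j → hits z j b ≡ 0ℤ
  hits-no z j b = ι-no (lookup z (suc b) ≟ j)

  hits-nonneg : (z : Perm (suc N)) (j : Fin (suc N)) (b : Fin N) → 0ℤ ℤ.≤ hits z j b
  hits-nonneg z j b = ι-nonneg (lookup z (suc b) ≟ j)

  -- Only an upper bound, because the preimage of `j` may be the point zero, which the sum leaves
  -- out.
  hits-total : {z : Perm (suc N)} → Inj z → ∀ j → ∑ (allFin N) (hits z j) ℤ.≤ 1ℤ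
  hits-total {N} {z} p j = ℤₚ.≤-trans
    (subst (ℤ._≤ g zero + ∑ (allFin N) (hits z j)) (ℤₚ.+-identityˡ (∑ (allFin N) (hits z j)))
           (ℤₚ.+-monoˡ-≤ (∑ (allFin N) (hits z j)) (ι-nonneg (lookup z zero ≟ j))))
    (ℤₚ.≤-reflexive (trans (sym (∑-Fin-suc g)) (trans (∑-permute p (λ i → ι (i ≟ j)))
      (trans (∑-point (Uniqueₚ.allFin⁺ (suc N)) (∈allFin j) (λ {i} _ i≢j → ι-no (i ≟ j) i≢j)) (ι-yes (j ≟ j) refl)))))
    where
    g : Fin (suc N) → ℤ
    g i = ι (lookup z i ≟ j)

-- If c₀ agrees with z on A, then enlarging A by b keeps c₀ when b is fixed by z, and otherwise the only
-- candidate is c₀ composed with the transposition (zero b), of opposite sign.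
F-insert : {A : Vec Bool N} {z c₀ : Perm (suc N)} → Inj z → Inj c₀ → Agrees c₀ z A → ∀ b → lookup A b ≡ false →
           F (insert A b) z ≡ sgn c₀ * (isFixed z (suc b) - hits z (lookup c₀ zero) b)
F-insert {N} {A} {z} {c₀} p q h b b∉ = go (lookup z (suc b) ≟ suc b) (lookup z (suc b) ≟ lookup c₀ zero)
  where
  open ≡-Reasoning
  A′ = insert A b
  c₀b : lookup c₀ (suc b) ≡ suc b
  c₀b = agrees-out h b∉
  fixed-agrees : lookup z (suc b) ≡ suc b → Agrees c₀ z A′
  fixed-agrees zb = mk-agrees
    (λ {i} e → [ (λ { refl → trans c₀b (sym zb) }) , agrees-in h ]′ (insert-true A b e))
    (λ {i} e → agrees-out h (proj₂ (insert-false A b e)))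
  t c₁ : Perm (suc N)
  t = swap zero (suc b)
  c₁ = c₀ ⊙ t
  c₁-off : ∀ {i} → i ≢ b → lookup c₁ (suc i) ≡ lookup c₀ (suc i)
  c₁-off {i} i≢b = trans (lookup-⊙ c₀ t (suc i))
    (cong (lookup c₀) (swap-o zero (suc b) (λ ()) (i≢b ∘ Finₚ.suc-injective)))
  c₁-at : lookup c₁ (suc b) ≡ lookup c₀ zero
  c₁-at = trans (lookup-⊙ c₀ t (suc b)) (cong (lookup c₀) (swap-r zero (suc b)))
  moved-agrees : lookup z (suc b) ≡ lookup c₀ zero → Agrees c₁ z A′
  moved-agrees zb = mk-agrees moved-in (λ {i} e → trans (c₁-off (proj₁ (insert-false A b e)))
                                                        (agrees-out h (proj₂ (insert-false A b e))))
    where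
    moved-in : ∀ {i} → lookup A′ i ≡ true → lookup c₁ (suc i) ≡ lookup z (suc i)
    moved-in {i} e with i ≟ b
    ... | yes refl = trans c₁-at (sym zb)
    ... | no i≢b   = trans (c₁-off i≢b) (agrees-in h (trans (sym (insert-off A i≢b)) e))
  none : lookup z (suc b) ≢ suc b → lookup z (suc b) ≢ lookup c₀ zero → ∀ {c} → Inj c → ¬ Agrees c z A′
  -- Consider the point at which `c₀` takes the value of `c` at `suc b`. The points zero and `suc b`
  -- are excluded by the assumptions on `z`; at any other point `c` and `c₀` coincide, against the
  -- injectivity of `c`.
  none zb≢ zb≢′ {c} r k = absurd (lookup (inv c₀) (lookup c (suc b))) (lookup-invʳ q (lookup c (suc b)))
    where
    cb : lookup c (suc b) ≡ lookup z (suc b)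
    cb = agrees-in k (insert-at A b)
    absurd : ∀ j → lookup c₀ j ≢ lookup c (suc b)
    absurd zero    e = zb≢′ (trans (sym cb) (sym e))
    absurd (suc i) e with i ≟ b
    ... | yes refl = zb≢ (trans (sym cb) (trans (sym e) c₀b))
    ... | no i≢b   = i≢b (Finₚ.suc-injective (inj r (trans same e)))
      where
      same : lookup c (suc i) ≡ lookup c₀ (suc i)
      same with bool-cases (lookup A i)
      ... | inj₁ e′ = trans (agrees-in k (insert-keeps A b e′)) (sym (agrees-in h e′))
      ... | inj₂ e′ = trans (agrees-out k (trans (insert-off A i≢b) e′)) (sym (agrees-out h e′))
  rhs : ∀ u v → isFixed z (suc b) ≡ u → hits z (lookup c₀ zero) b ≡ v →
        sgn c₀ * (u - v) ≡ sgn c₀ * (isFixed z (suc b) - hits z (lookup c₀ zero) b)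
  rhs u v refl refl = refl
  go : Dec (lookup z (suc b) ≡ suc b) → Dec (lookup z (suc b) ≡ lookup c₀ zero) →
       F A′ z ≡ sgn c₀ * (isFixed z (suc b) - hits z (lookup c₀ zero) b)
  go (yes zb) _ = begin
    F A′ z               ≡⟨ F-value q (fixed-agrees zb) ⟩
    sgn c₀               ≡⟨ ℤₚ.*-identityʳ (sgn c₀) ⟨
    sgn c₀ * (1ℤ - 0ℤ)   ≡⟨ rhs 1ℤ 0ℤ (isFixed-yes z (suc b) zb) (hits-no z (lookup c₀ zero) b not-both) ⟩
    sgn c₀ * (isFixed z (suc b) - hits z (lookup c₀ zero) b) ∎
    where
    not-both : lookup z (suc b) ≢ lookup c₀ zero
    not-both e with inj q (trans (sym e) (trans zb (sym c₀b)))
    ... | ()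
  go (no zb) (yes zb′) = begin
    F A′ z               ≡⟨ F-value (Inj-⊙ q (Inj-swap zero (suc b))) (moved-agrees zb′) ⟩
    sgn c₁               ≡⟨ sgn-⊙ q (Inj-swap zero (suc b)) ⟩
    sgn c₀ * sgn t       ≡⟨ cong (sgn c₀ *_) (sgn-swap (λ ())) ⟩
    sgn c₀ * (0ℤ - 1ℤ)   ≡⟨ rhs 0ℤ 1ℤ (isFixed-no z (suc b) zb) (hits-yes z (lookup c₀ zero) b zb′) ⟩
    sgn c₀ * (isFixed z (suc b) - hits z (lookup c₀ zero) b) ∎
  go (no zb) (no zb′) = begin
    F A′ z               ≡⟨ F-zero (none zb zb′) ⟩
    0ℤ                   ≡⟨ ℤₚ.*-zeroʳ (sgn c₀) ⟨
    sgn c₀ * (0ℤ - 0ℤ)   ≡⟨ rhs 0ℤ 0ℤ (isFixed-no z (suc b) zb) (hits-no z (lookup c₀ zero) b zb′) ⟩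
    sgn c₀ * (isFixed z (suc b) - hits z (lookup c₀ zero) b) ∎

out-≤ : (A : Vec Bool N) (b : Fin N) {a : ℤ} → 0ℤ ℤ.≤ a → out A b * a ℤ.≤ a
out-≤ A b {a} 0≤a with bool-cases (lookup A b)
... | inj₁ e = subst (ℤ._≤ a) (sym (trans (cong (_* a) (out-in A b e)) (ℤₚ.*-zeroˡ a))) 0≤a
... | inj₂ e = ℤₚ.≤-reflexive (trans (cong (_* a) (out-out A b e)) (ℤₚ.*-identityˡ a))

out-*-nonneg : (A : Vec Bool N) (b : Fin N) {a : ℤ} → 0ℤ ℤ.≤ a → 0ℤ ℤ.≤ out A b * a
out-*-nonneg A b {a} 0≤a with bool-cases (lookup A b)
... | inj₁ e = ℤₚ.≤-reflexive (sym (trans (cong (_* a) (out-in A b e)) (ℤₚ.*-zeroˡ a)))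
... | inj₂ e = subst (0ℤ ℤ.≤_) (sym (trans (cong (_* a) (out-out A b e)) (ℤₚ.*-identityˡ a))) 0≤a

∣x-y∣≤ : (x y : ℤ) (m : ℕ) → 0ℤ ℤ.≤ x → x ℤ.≤ ℤ.+ m → 0ℤ ℤ.≤ y → y ℤ.≤ ℤ.+ m → ∣ x - y ∣ ℕ.≤ m
∣x-y∣≤ (ℤ.+ x) (ℤ.+ y) m _ (ℤ.+≤+ x≤) _ (ℤ.+≤+ y≤) =
  subst (λ t → ∣ t ∣ ℕ.≤ m) (sym (ℤₚ.m-n≡m⊖n x y)) (ℕₚ.≤-trans (ℤₚ.∣m⊝n∣≤m⊔n x y) (ℕₚ.⊔-lub x≤ y≤))

-- This is where max(1, ℓ) arises. After a clash, only adding its image `i′` can help, which leaves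
-- a single term. Otherwise `F-insert` turns the sum into ±(X - Y), where `X` counts fixed points of
-- `z` outside `A` and `Y` is 0 or 1. Both lie between 0 and `m`, hence so does the absolute
-- difference.
∣∑F-insert∣≤ : (A : Vec Bool N) {z : Perm (suc N)} → Inj z → {m : ℕ} → 1 ℕ.≤ m → fixpts z ℤ.≤ ℤ.+ m →
               ∣ ∑ (allFin N) (λ b → out A b * F (insert A b) z) ∣ ℕ.≤ m
∣∑F-insert∣≤ {N} A {z} p {m} 1≤m fix≤m with dichotomy p A
... | inj₂ cl = ℕₚ.≤-trans (ℕₚ.≤-reflexive (cong ∣_∣ single)) (ℕₚ.≤-trans (∣F∣≤1 (insert A i′) p) 1≤m)
  where
  i′ = Clash.i′ cl
  single : ∑ (allFin N) (λ b → out A b * F (insert A b) z) ≡ F (insert A i′) z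
  single = trans
    (∑-point (Uniqueₚ.allFin⁺ N) (∈allFin i′) (λ {b} _ b≢ →
      trans (cong (out A b *_) (F-zero {A = insert A b} (clash-¬agrees (clash-insert cl b≢)))) (ℤₚ.*-zeroʳ (out A b))))
    (trans (cong (_* F (insert A i′) z) (out-out A i′ (Clash.out-A cl))) (ℤₚ.*-identityˡ (F (insert A i′) z)))
... | inj₁ (c₀ , q , h) = ℕₚ.≤-trans (ℕₚ.≤-reflexive size-eq)
        (∣x-y∣≤ X Y m X≥0 X≤m Y≥0 (ℤₚ.≤-trans Y≤1 (ℤ.+≤+ 1≤m)))
  where
  open ≡-Reasoning
  Fs = allFin N
  fx ht : Fin N → ℤ
  fx b = isFixed z (suc b)
  ht b = hits z (lookup c₀ zero) b
  X Y : ℤ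
  X = ∑ Fs λ b → out A b * fx b
  Y = ∑ Fs λ b → out A b * ht b
  distrib : ∀ o s a b → o * (s * (a - b)) ≡ s * (o * a - o * b)
  distrib = solve-∀
  pointwise : ∀ b → out A b * F (insert A b) z ≡ sgn c₀ * (out A b * fx b - out A b * ht b)
  pointwise b with bool-cases (lookup A b)
  ... | inj₂ e = trans (cong (out A b *_) (F-insert p q h b e)) (distrib (out A b) (sgn c₀) (fx b) (ht b))
  ... | inj₁ e = begin
    out A b * F (insert A b) z                           ≡⟨ cong (_* F (insert A b) z) (out-in A b e) ⟩
    0ℤ * F (insert A b) z                                ≡⟨ ℤₚ.*-zeroˡ (F (insert A b) z) ⟩
    0ℤ                                                   ≡⟨ ℤₚ.*-zeroˡ (sgn c₀ * (fx b - ht b)) ⟨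
    0ℤ * (sgn c₀ * (fx b - ht b))                        ≡⟨ cong (_* (sgn c₀ * (fx b - ht b))) (out-in A b e) ⟨
    out A b * (sgn c₀ * (fx b - ht b))                   ≡⟨ distrib (out A b) (sgn c₀) (fx b) (ht b) ⟩
    sgn c₀ * (out A b * fx b - out A b * ht b)           ∎
  total : ∑ Fs (λ b → out A b * F (insert A b) z) ≡ sgn c₀ * (X - Y)
  total = trans (∑-cong Fs pointwise) (trans (∑-*ˡ Fs (sgn c₀) (λ b → out A b * fx b - out A b * ht b))
            (cong (sgn c₀ *_) (∑-- Fs (λ b → out A b * fx b) (λ b → out A b * ht b))))
  size-eq : ∣ ∑ Fs (λ b → out A b * F (insert A b) z) ∣ ≡ ∣ X - Y ∣
  size-eq = trans (cong ∣_∣ total) (trans (ℤₚ.abs-* (sgn c₀) (X - Y))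
              (trans (cong (ℕ._* ∣ X - Y ∣) (∣sgn∣ c₀)) (ℕₚ.*-identityˡ ∣ X - Y ∣)))
  X≥0 : 0ℤ ℤ.≤ X
  X≥0 = ∑-nonneg Fs λ b → out-*-nonneg A b (isFixed-nonneg z (suc b))
  Y≥0 : 0ℤ ℤ.≤ Y
  Y≥0 = ∑-nonneg Fs λ b → out-*-nonneg A b (hits-nonneg z (lookup c₀ zero) b)
  Y≤1 : Y ℤ.≤ 1ℤ
  Y≤1 = ℤₚ.≤-trans (∑-mono∈ Fs (λ {b} _ → out-≤ A b (hits-nonneg z (lookup c₀ zero) b))) (hits-total p (lookup c₀ zero))
  X≤m : X ℤ.≤ ℤ.+ m
  X≤m = ℤₚ.≤-trans (∑-mono∈ Fs (λ {b} _ → out-≤ A b (isFixed-nonneg z (suc b))))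
    (ℤₚ.≤-trans (subst (ℤ._≤ isFixed z zero + ∑ Fs fx) (ℤₚ.+-identityˡ (∑ Fs fx))
                   (ℤₚ.+-monoˡ-≤ (∑ Fs fx) (isFixed-nonneg z zero)))
    (ℤₚ.≤-trans (ℤₚ.≤-reflexive (sym (∑-Fin-suc (isFixed z)))) fix≤m))

-- `t` fixes the point zero, so conjugation by it respects the special role of zero and merely
-- renames the points of the subset.
F-relabel : (A B : Vec Bool N) {t : Perm (suc N)} → Inj t → (τ : Fin N → Fin N) →
            (∀ k → lookup t (suc k) ≡ suc (τ k)) → (∀ k → lookup A (τ k) ≡ lookup B k) →
            ∀ {x} → Inj x → F A (conj t x) ≡ F B x
F-relabel {N} A B {t} p τ t-suc A-τ {x} q = begin
  F A (conj t x)
    ≡⟨ F-∑ A (conj t x) ⟩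
  ∑ Sₙ (λ c → sgn c * ι (agrees? c (conj t x) A))
    ≡⟨ conj-bij (λ c → sgn c * ι (agrees? c (conj t x) A)) ⟨
  ∑ Sₙ (λ c → sgn (conj t c) * ι (agrees? (conj t c) (conj t x) A))
    ≡⟨ ∑-cong∈ Sₙ (λ {c} c∈ → cong₂ _*_ (trans (cong sgn (conj-def t c)) (sgn-conj p (∈S⇒Inj c∈)))
         (ι-cong (agrees? (conj t c) (conj t x) A) (agrees? c x B) to from)) ⟩
  ∑ Sₙ (λ c → sgn c * ι (agrees? c x B))
    ≡⟨ F-∑ B x ⟨
  F B x
    ∎
  where
  open ≡-Reasoning
  Sₙ = S (suc N)
  conj-bij : (f : Perm (suc N) → ℤ) → ∑ Sₙ (λ c → f (conj t c)) ≡ ∑ Sₙ f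
  conj-bij f = begin
    ∑ Sₙ (λ c → f (conj t c))              ≡⟨ ∑-cong Sₙ (λ c → cong f (conj-def t c)) ⟩
    ∑ Sₙ (λ c → f (t ⊙ (c ⊙ inv t)))       ≡⟨ ∑-translateʳ (Inj-inv p) (λ c → f (t ⊙ c)) ⟩
    ∑ Sₙ (λ c → f (t ⊙ c))                 ≡⟨ ∑-translateˡ p f ⟩
    ∑ Sₙ f                                 ∎
  τ-inj : ∀ {i j} → τ i ≡ τ j → i ≡ j
  τ-inj {i} {j} e = Finₚ.suc-injective (inj p (trans (t-suc i) (trans (cong suc e) (sym (t-suc j)))))
  conj-at : ∀ c k → lookup (conj t c) (suc (τ k)) ≡ lookup t (lookup c (suc k))
  conj-at c k = trans (cong (lookup (conj t c)) (sym (t-suc k))) (lookup-conj p (suc k))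
  to : ∀ {c} → Agrees (conj t c) (conj t x) A → Agrees c x B
  to {c} h = mk-agrees
    (λ {k} e → inj p (trans (sym (conj-at c k)) (trans (agrees-in h (trans (A-τ k) e)) (conj-at x k))))
    (λ {k} e → inj p (trans (sym (conj-at c k)) (trans (agrees-out h (trans (A-τ k) e)) (sym (t-suc k)))))
  from : ∀ {c} → Agrees c x B → Agrees (conj t c) (conj t x) A
  from {c} h = mkAgrees λ i → at i (injective⇒surjective τ τ-inj i)
    where
    at : ∀ i → (∃ λ k → τ k ≡ i) → lookup (conj t c) (suc i) ≡ tgt (conj t x) A i
    at i (k , refl) with bool-cases (lookup B k)
    ... | inj₁ e = trans (conj-at c k) (trans (cong (lookup t) (agrees-in h e))
                     (trans (sym (conj-at x k)) (sym (tgt-in (conj t x) A (trans (A-τ k) e)))))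
    ... | inj₂ e = trans (conj-at c k) (trans (cong (lookup t) (agrees-out h e))
                     (trans (t-suc k) (sym (tgt-out (conj t x) A (trans (A-τ k) e)))))

-- Conjugation by the transposition of `a` and `b` turns one subset into the other, and the sum over
-- all conjugators absorbs it.
R-insert : (A : Vec Bool N) {a b : Fin N} → lookup A a ≡ false → lookup A b ≡ false →
           ∀ {z} → Inj z → R (insert A a) z ≡ R (insert A b) z
R-insert {N} A {a} {b} a∉ b∉ {z} p = begin
  R (insert A a) z                                          ≡⟨ R-∑ (insert A a) z ⟩
  ∑ Sₙ (λ w → F (insert A a) (conj w z))                    ≡⟨ ∑-translateˡ t-inj (λ w → F (insert A a) (conj w z)) ⟨
  ∑ Sₙ (λ w → F (insert A a) (conj (t ⊙ w) z))              ≡⟨ ∑-cong∈ Sₙ (λ {w} w∈ → trans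
                                                                 (cong (F (insert A a)) (conj-⊙ t-inj (∈S⇒Inj w∈)))
                                                                 (F-relabel (insert A a) (insert A b) t-inj (lookup s) t-suc
                                                                   swapped (Inj-conj (∈S⇒Inj w∈) p))) ⟩
  ∑ Sₙ (λ w → F (insert A b) (conj w z))                    ≡⟨ R-∑ (insert A b) z ⟨
  R (insert A b) z                                          ∎
  where
  open ≡-Reasoning
  Sₙ = S (suc N)
  s : Perm N
  s = swap a b
  t : Perm (suc N)
  t = swap (suc a) (suc b)
  t-inj : Inj t
  t-inj = Inj-swap (suc a) (suc b)
  t-suc : ∀ k → lookup t (suc k) ≡ suc (lookup s k)
  t-suc k with swapView a b k
  ... | isL refl e  = trans (swap-l (suc a) (suc b)) (cong suc (sym e))
  ... | isR refl e  = trans (swap-r (suc a) (suc b)) (cong suc (sym e))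
  ... | isO k≢a k≢b e =
    trans (swap-o (suc a) (suc b) (k≢a ∘ Finₚ.suc-injective) (k≢b ∘ Finₚ.suc-injective)) (cong suc (sym e))
  swapped : ∀ k → lookup (insert A a) (lookup s k) ≡ lookup (insert A b) k
  swapped k with swapView a b k
  ... | isR refl e  = trans (cong (lookup (insert A a)) e) (trans (insert-at A a) (sym (insert-at A b)))
  ... | isO k≢a k≢b e = trans (cong (lookup (insert A a)) e) (trans (insert-off A k≢a) (sym (insert-off A k≢b)))
  ... | isL refl e with a ≟ b
  ...   | yes refl = cong (lookup (insert A a)) e
  ...   | no a≢b   = trans (cong (lookup (insert A a)) e) (trans (trans (insert-off A (a≢b ∘ sym)) b∉)
                           (sym (trans (insert-off A a≢b) a∉)))

∣R∣≤ : (A : Vec Bool N) {z : Perm (suc N)} → Inj z → ∣ R A z ∣ ℕ.≤ length (S (suc N))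
∣R∣≤ {N} A {z} p = subst (λ t → ∣ t ∣ ℕ.≤ length (S (suc N))) (sym (R-∑ A z))
  (ℕₚ.≤-trans (∣∑∣≤ {b = 1} (S (suc N)) (λ w∈ → ∣F∣≤1 A (Inj-conj (∈S⇒Inj w∈) p)))
              (ℕₚ.≤-reflexive (ℕₚ.*-identityʳ (length (S (suc N))))))

-- All enlargements of `A` by one point have the same `R`, so a multiple of it equals their sum,
-- with one summand for each point outside `A`. For every conjugate of `z` the corresponding sum of
-- `F` is at most `m`, since conjugation keeps the number of fixed points.
∣R-insert∣≤ : (A : Vec Bool N) {a : Fin N} → lookup A a ≡ false → {z : Perm (suc N)} → Inj z →
              {m : ℕ} → 1 ℕ.≤ m → fixpts z ℤ.≤ ℤ.+ m →
              size (complement A) ℕ.* ∣ R (insert A a) z ∣ ℕ.≤ length (S (suc N)) ℕ.* m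
∣R-insert∣≤ {N} A {a} a∉ {z} p {m} 1≤m fix≤m =
  subst (ℕ._≤ length (S (suc N)) ℕ.* m) (trans (cong ∣_∣ (sym total)) (ℤₚ.abs-* (ℤ.+ size (complement A)) r))
    (∣∑∣≤ Sₙ (λ {w} w∈ → ∣∑F-insert∣≤ A (Inj-conj (∈S⇒Inj w∈) p) 1≤m
                           (subst (ℤ._≤ ℤ.+ m) (sym (fixpts-conj (∈S⇒Inj w∈))) fix≤m)))
  where
  open ≡-Reasoning
  Sₙ = S (suc N)
  Fs = allFin N
  r : ℤ
  r = R (insert A a) z
  pointwise : ∀ b → out A b * r ≡ out A b * R (insert A b) z
  pointwise b with bool-cases (lookup A b)
  ... | inj₂ e = cong (out A b *_) (R-insert A a∉ e p)
  ... | inj₁ e = trans (cong (_* r) (out-in A b e)) (sym (cong (_* R (insert A b) z) (out-in A b e)))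
  total : ℤ.+ size (complement A) * r ≡ ∑ Sₙ (λ w → ∑ Fs (λ b → out A b * F (insert A b) (conj w z)))
  total = begin
    ℤ.+ size (complement A) * r                                          ≡⟨ cong (_* r) (out-total A) ⟨
    ∑ Fs (out A) * r                                                     ≡⟨ ∑-*ʳ Fs r (out A) ⟨
    ∑ Fs (λ b → out A b * r)                                             ≡⟨ ∑-cong Fs pointwise ⟩
    ∑ Fs (λ b → out A b * R (insert A b) z)
      ≡⟨ ∑-cong Fs (λ b → trans (cong (out A b *_) (R-∑ (insert A b) z))
                                (sym (∑-*ˡ Sₙ (out A b) (λ w → F (insert A b) (conj w z))))) ⟩
    ∑ Fs (λ b → ∑ Sₙ (λ w → out A b * F (insert A b) (conj w z)))        ≡⟨ ∑-swap Fs Sₙ (λ b w → out A b * F (insert A b) (conj w z)) ⟩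
    ∑ Sₙ (λ w → ∑ Fs (λ b → out A b * F (insert A b) (conj w z)))        ∎

size-remove : (A : Vec Bool N) (a : Fin N) → lookup A a ≡ true →
              size (complement (A Vec.[ a ]≔ false)) ≡ suc (size (complement A))
size-remove (true ∷ A)  zero    refl = refl
size-remove (true ∷ A)  (suc a) e    = size-remove A a e
size-remove (false ∷ A) (suc a) e    = cong suc (size-remove A a e)

insert-remove : (A : Vec Bool N) (a : Fin N) → lookup A a ≡ true → insert (A Vec.[ a ]≔ false) a ≡ A
insert-remove A a e = trans (Vecₚ.[]≔-idempotent A a) (trans (cong (A Vec.[ a ]≔_) (sym e)) (Vecₚ.[]≔-lookup A a))

-- `A` is the enlargement of the set without `a`, whose complement has one point more: hence the
-- `suc`.
∣R∣-boundˡ : (A : Vec Bool N) {a : Fin N} → lookup A a ≡ true → {z : Perm (suc N)} → Inj z →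
             {m : ℕ} → 1 ℕ.≤ m → fixpts z ℤ.≤ ℤ.+ m →
             suc (size (complement A)) ℕ.* ∣ R A z ∣ ℕ.≤ length (S (suc N)) ℕ.* m
∣R∣-boundˡ {N} A {a} a∈ {z} p {m} 1≤m fix≤m =
  subst₂ (λ k B → k ℕ.* ∣ R B z ∣ ℕ.≤ length (S (suc N)) ℕ.* m) (size-remove A a a∈) (insert-remove A a a∈)
    (∣R-insert∣≤ (A Vec.[ a ]≔ false) {a} (Vecₚ.lookup∘update a A false) p 1≤m fix≤m)

complement-involutive : (A : Vec Bool N) → complement (complement A) ≡ A
complement-involutive []      = refl
complement-involutive (b ∷ A) = cong₂ _∷_ (Boolₚ.not-involutive b) (complement-involutive A)

inv-conj : {y z : Perm n} → Inj y → Inj z → inv (conj y z) ≡ conj y (inv z)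
inv-conj {y = y} {z} p q = ext λ i → inj (Inj-conj p q) (begin
  lookup (conj y z) (lookup (inv (conj y z)) i)                ≡⟨ lookup-invʳ (Inj-conj p q) i ⟩
  i                                                            ≡⟨ at i (injective⇒surjective (lookup y) (inj p) i) ⟨
  lookup (conj y z) (lookup (conj y (inv z)) i)                ∎)
  where
  open ≡-Reasoning
  at : ∀ i → (∃ λ k → lookup y k ≡ i) → lookup (conj y z) (lookup (conj y (inv z)) i) ≡ i
  at _ (k , refl) = begin
    lookup (conj y z) (lookup (conj y (inv z)) (lookup y k))   ≡⟨ cong (lookup (conj y z)) (lookup-conj p k) ⟩
    lookup (conj y z) (lookup y (lookup (inv z) k))            ≡⟨ lookup-conj p (lookup (inv z) k) ⟩
    lookup y (lookup z (lookup (inv z) k))                     ≡⟨ cong (lookup y) (lookup-invʳ q k) ⟩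
    lookup y k                                                 ∎

R-complement : (A : Vec Bool N) {z : Perm (suc N)} → Inj z → R A z ≡ sgn z * R (complement A) (inv z)
R-complement {N} A {z} p = begin
  R A z                                                            ≡⟨ R-∑ A z ⟩
  ∑ Sₙ (λ y → F A (conj y z))                                      ≡⟨ ∑-cong∈ Sₙ (λ {y} y∈ → step y (∈S⇒Inj y∈)) ⟩
  ∑ Sₙ (λ y → sgn z * F (complement A) (conj y (inv z)))           ≡⟨ ∑-*ˡ Sₙ (sgn z) (λ y → F (complement A) (conj y (inv z))) ⟩
  sgn z * ∑ Sₙ (λ y → F (complement A) (conj y (inv z)))           ≡⟨ cong (sgn z *_) (R-∑ (complement A) (inv z)) ⟨
  sgn z * R (complement A) (inv z)                                 ∎
  where
  open ≡-Reasoning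
  Sₙ = S (suc N)
  step : ∀ y → Inj y → F A (conj y z) ≡ sgn z * F (complement A) (conj y (inv z))
  step y q = trans (F-complement A (Inj-conj q p)) (cong₂ _*_
    (trans (cong sgn (conj-def y z)) (sgn-conj q p)) (cong (F (complement A)) (inv-conj q p)))

-- The previous bound for the complement and the inverse, transported by `R-complement`: the sign
-- has absolute value 1, and `inv z` has as many fixed points as `z`.
∣R∣-boundʳ : (A : Vec Bool N) {a : Fin N} → lookup A a ≡ false → {z : Perm (suc N)} → Inj z →
             {m : ℕ} → 1 ℕ.≤ m → fixpts z ℤ.≤ ℤ.+ m →
             suc (size A) ℕ.* ∣ R A z ∣ ℕ.≤ length (S (suc N)) ℕ.* m
∣R∣-boundʳ {N} A {a} a∉ {z} p {m} 1≤m fix≤m =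
  subst₂ (λ B k → suc (size B) ℕ.* k ℕ.≤ length (S (suc N)) ℕ.* m) (complement-involutive A) (sym abs-eq)
    (∣R∣-boundˡ (complement A) {a} (trans (Vecₚ.lookup-map a not A) (cong not a∉))
      (Inj-inv p) 1≤m (subst (ℤ._≤ ℤ.+ m) (sym (fixpts-inv p)) fix≤m))
  where
  abs-eq : ∣ R A z ∣ ≡ ∣ R (complement A) (inv z) ∣
  abs-eq = trans (cong ∣_∣ (R-complement A p)) (trans (ℤₚ.abs-* (sgn z) (R (complement A) (inv z)))
             (trans (cong (ℕ._* ∣ R (complement A) (inv z) ∣) (∣sgn∣ z)) (ℕₚ.*-identityˡ ∣ R (complement A) (inv z) ∣)))

-- Orbits

iter-+ : (σ : Perm n) (a b : ℕ) (i : Fin n) → iter σ (a ℕ.+ b) i ≡ iter σ a (iter σ b i)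
iter-+ σ zero    b i = refl
iter-+ σ (suc a) b i = cong (lookup σ) (iter-+ σ a b i)

iter-inj : {σ : Perm n} → Inj σ → ∀ a {i j} → iter σ a i ≡ iter σ a j → i ≡ j
iter-inj p zero    e = e
iter-inj p (suc a) e = iter-inj p a (inj p e)

iter-* : (σ : Perm n) (d : ℕ) {i : Fin n} → iter σ d i ≡ i → ∀ q → iter σ (q ℕ.* d) i ≡ i
iter-* σ d e zero    = refl
iter-* σ d {i} e (suc q) = trans (iter-+ σ d (q ℕ.* d) i) (trans (cong (iter σ d) (iter-* σ d e q)) e)

opaque
  -- Two of the first n + 1 iterates coincide, and injectivity cancels the shorter one.
  period : {σ : Perm n} → Inj σ → ∀ i → ∃ λ d → suc d ℕ.≤ n × iter σ (suc d) i ≡ i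
  period {n} {σ} p i with Finₚ.pigeonhole (ℕₚ.n<1+n n) (λ k → iter σ (toℕ k) i)
  ... | a , b , a<b , e = d , d<n , iter-inj p (toℕ a) eq
    where
    d : ℕ
    d = toℕ b ℕ.∸ suc (toℕ a)
    b≡ : toℕ a ℕ.+ suc d ≡ toℕ b
    b≡ = trans (ℕₚ.+-suc (toℕ a) d) (ℕₚ.m+[n∸m]≡n a<b)
    d<n : suc d ℕ.≤ n
    d<n = ℕₚ.≤-trans (ℕₚ.m≤n+m (suc d) (toℕ a)) (subst (ℕ._≤ n) (sym b≡) (ℕ.s≤s⁻¹ (Finₚ.toℕ<n b)))
    eq : iter σ (toℕ a) (iter σ (suc d) i) ≡ iter σ (toℕ a) i
    eq = trans (sym (iter-+ σ (toℕ a) (suc d) i)) (trans (cong (λ k → iter σ k i) b≡) (sym e))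

iter-% : (σ : Perm n) (d : ℕ) {i : Fin n} → iter σ (suc d) i ≡ i → ∀ k → iter σ k i ≡ iter σ (k ℕ.% suc d) i
iter-% σ d {i} e k = begin
  iter σ k i                                                       ≡⟨ cong (λ m → iter σ m i) (ℕD.m≡m%n+[m/n]*n k (suc d)) ⟩
  iter σ (k ℕ.% suc d ℕ.+ (k ℕ./ suc d) ℕ.* suc d) i               ≡⟨ iter-+ σ (k ℕ.% suc d) ((k ℕ./ suc d) ℕ.* suc d) i ⟩
  iter σ (k ℕ.% suc d) (iter σ ((k ℕ./ suc d) ℕ.* suc d) i)        ≡⟨ cong (iter σ (k ℕ.% suc d)) (iter-* σ (suc d) e (k ℕ./ suc d)) ⟩
  iter σ (k ℕ.% suc d) i                                           ∎
  where open ≡-Reasoning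

record Orb (σ : Perm n) (i j : Fin n) : Set where
  constructor orb
  field
    steps : ℕ
    reach : iter σ steps i ≡ j
open Orb

-- Step counts are reduced modulo a period of at most n, which makes membership in an orbit a finite
-- search.
orb-bounded : {σ : Perm n} → Inj σ → ∀ {i j} → Orb σ i j → ∃ λ (k : Fin n) → iter σ (toℕ k) i ≡ j
orb-bounded {n} {σ} p {i} (orb k e) with period p i
... | d , d<n , pe = Fin.fromℕ< k<n , trans (cong (λ m → iter σ m i) (Finₚ.toℕ-fromℕ< k<n)) (trans (sym (iter-% σ d pe k)) e)
  where
  k<n : k ℕ.% suc d ℕ.< n
  k<n = ℕₚ.<-≤-trans (ℕD.m%n<n k (suc d)) d<n

opaque
  orb? : {σ : Perm n} → Inj σ → ∀ i j → Dec (Orb σ i j)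
  orb? {n} {σ} p i j = map′ (λ { (k , e) → orb (toℕ k) e }) (orb-bounded p) (Finₚ.any? (λ k → iter σ (toℕ k) i ≟ j))

orb-refl : {σ : Perm n} {i : Fin n} → Orb σ i i
orb-refl = orb 0 refl

orb-trans : {σ : Perm n} {i j k : Fin n} → Orb σ i j → Orb σ j k → Orb σ i k
orb-trans {σ = σ} {i} (orb a e) (orb b f) = orb (b ℕ.+ a) (trans (iter-+ σ b a i) (trans (cong (iter σ b) e) f))

orb-sym : {σ : Perm n} → Inj σ → {i j : Fin n} → Orb σ i j → Orb σ j i
orb-sym {σ = σ} p {i} {j} (orb k e) with period p i
-- Continuing until `k` whole periods are complete leads back to `i`.
... | d , _ , pe = orb (k ℕ.* suc d ℕ.∸ k) (begin
  iter σ (k ℕ.* suc d ℕ.∸ k) j                ≡⟨ cong (iter σ (k ℕ.* suc d ℕ.∸ k)) e ⟨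
  iter σ (k ℕ.* suc d ℕ.∸ k) (iter σ k i)     ≡⟨ iter-+ σ (k ℕ.* suc d ℕ.∸ k) k i ⟨
  iter σ (k ℕ.* suc d ℕ.∸ k ℕ.+ k) i          ≡⟨ cong (λ m → iter σ m i) (ℕₚ.m∸n+n≡m (ℕₚ.m≤m*n k (suc d))) ⟩
  iter σ (k ℕ.* suc d) i                      ≡⟨ iter-* σ (suc d) pe k ⟩
  i                                           ∎)
  where open ≡-Reasoning

orb-step : {σ : Perm n} (i : Fin n) → Orb σ i (lookup σ i)
orb-step i = orb 1 refl

record Transitive (x : Perm (suc N)) : Set where
  constructor mkTransitive
  field covers : ∀ j → Orb x zero j
open Transitive

-- The alternating sum over subsets

subsets : ∀ N → List (Vec Bool N)
subsets zero    = [] ∷ []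
subsets (suc N) = List.map (true ∷_) (subsets N) ++ List.map (false ∷_) (subsets N)

∈subsets : (A : Vec Bool N) → A ∈ subsets N
∈subsets []          = here refl
∈subsets (true ∷ A)  = ∈ₚ.∈-++⁺ˡ (∈ₚ.∈-map⁺ (true ∷_) (∈subsets A))
∈subsets {suc N} (false ∷ A) = ∈ₚ.∈-++⁺ʳ (List.map (true ∷_) (subsets N)) (∈ₚ.∈-map⁺ (false ∷_) (∈subsets A))

subsets-unique : ∀ N → Unique (subsets N)
subsets-unique zero    = All.[] ∷ []
subsets-unique (suc N) = Uniqueₚ.++⁺ (Uniqueₚ.map⁺ Vecₚ.∷-injectiveʳ (subsets-unique N))
                                     (Uniqueₚ.map⁺ Vecₚ.∷-injectiveʳ (subsets-unique N)) disjoint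
  where
  disjoint : ∀ {v} → ¬ (v ∈ List.map (true ∷_) (subsets N) × v ∈ List.map (false ∷_) (subsets N))
  disjoint (p , q) with ∈ₚ.∈-map⁻ (true ∷_) p | ∈ₚ.∈-map⁻ (false ∷_) q
  ... | _ , _ , refl | _ , _ , ()

∑-subsets-suc : ∀ N (h : Vec Bool (suc N) → ℤ) →
                ∑ (subsets (suc N)) h ≡ ∑ (subsets N) (λ A → h (true ∷ A)) + ∑ (subsets N) (λ A → h (false ∷ A))
∑-subsets-suc N h = trans (∑-++ (List.map (true ∷_) (subsets N)) (List.map (false ∷_) (subsets N)) h)
  (cong₂ _+_ (∑-map (true ∷_) (subsets N) h) (∑-map (false ∷_) (subsets N) h))

expand-∏ : ∀ N (g f : Fin N → ℤ) →
           ∏ N (λ i → g i - f i) ≡ ∑ (subsets N) (λ A → parity (size A) * ∏ N (λ i → if lookup A i then f i else g i))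
expand-∏ zero    g f = refl
expand-∏ (suc N) g f = begin
  (g zero - f zero) * ∏ N (λ i → g (suc i) - f (suc i))
    ≡⟨ cong ((g zero - f zero) *_) (expand-∏ N (g ∘ suc) (f ∘ suc)) ⟩
  (g zero - f zero) * ∑ (subsets N) h
    ≡⟨ split (g zero) (f zero) (∑ (subsets N) h) ⟩
  (- f zero) * ∑ (subsets N) h + g zero * ∑ (subsets N) h
    ≡⟨ cong₂ _+_ (∑-*ˡ (subsets N) (- f zero) h) (∑-*ˡ (subsets N) (g zero) h) ⟨
  ∑ (subsets N) (λ A → (- f zero) * h A) + ∑ (subsets N) (λ A → g zero * h A)
    ≡⟨ cong₂ _+_ (∑-cong (subsets N) (λ A → move₁ (f zero) (parity (size A)) (body A)))
                 (∑-cong (subsets N) (λ A → move₂ (g zero) (parity (size A)) (body A))) ⟩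
  ∑ (subsets N) (λ A → k (true ∷ A)) + ∑ (subsets N) (λ A → k (false ∷ A))
    ≡⟨ ∑-subsets-suc N k ⟨
  ∑ (subsets (suc N)) k
    ∎
  where
  open ≡-Reasoning
  body : Vec Bool N → ℤ
  body A = ∏ N (λ i → if lookup A i then f (suc i) else g (suc i))
  h : Vec Bool N → ℤ
  h A = parity (size A) * body A
  k : Vec Bool (suc N) → ℤ
  k A = parity (size A) * ∏ (suc N) (λ i → if lookup A i then f i else g i)
  split : ∀ a b s → (a - b) * s ≡ (- b) * s + a * s
  split = solve-∀
  move₁ : ∀ a p q → (- a) * (p * q) ≡ (- p) * (a * q)
  move₁ = solve-∀
  move₂ : ∀ a p q → a * (p * q) ≡ p * (a * q)
  move₂ = solve-∀

module _ (x : Perm (suc N)) where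

  stays moves : Perm (suc N) → Fin N → ℤ
  stays c i = ι (lookup c (suc i) ≟ suc i)
  moves c i = ι (lookup c (suc i) ≟ lookup x (suc i))

  ι-agrees : (c : Perm (suc N)) (A : Vec Bool N) →
             ι (agrees? c x A) ≡ ∏ N (λ i → if lookup A i then moves c i else stays c i)
  ι-agrees c A with agrees? c x A
  ... | yes h = sym (∏-one N one)
    where
    one : ∀ i → (if lookup A i then moves c i else stays c i) ≡ 1ℤ
    one i with lookup A i in e
    ... | true  = ι-yes (lookup c (suc i) ≟ lookup x (suc i)) (agrees-in h e)
    ... | false = ι-yes (lookup c (suc i) ≟ suc i) (agrees-out h e)
  ... | no ¬h = sym (∏-zero (proj₁ bad) zer)
    where
    bad : ∃ λ i → ¬ (lookup c (suc i) ≡ tgt x A i)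
    bad = Finₚ.¬∀⟶∃¬ N _ (λ i → lookup c (suc i) ≟ tgt x A i) (¬h ∘ mkAgrees)
    zer : (if lookup A (proj₁ bad) then moves c (proj₁ bad) else stays c (proj₁ bad)) ≡ 0ℤ
    zer with lookup A (proj₁ bad) | proj₂ bad
    ... | true  | ne = ι-no (lookup c (suc (proj₁ bad)) ≟ lookup x (suc (proj₁ bad))) ne
    ... | false | ne = ι-no (lookup c (suc (proj₁ bad)) ≟ suc (proj₁ bad)) ne

  -- The right side is Leibniz's formula with the row of zero equal to ones, as the value of `c` at
  -- zero contributes no factor. The subsets come from multiplying out the product over the
  -- remaining rows.
  alt-∏ : ∑ (subsets N) (λ A → parity (size A) * F A x) ≡
          ∑ (S (suc N)) (λ c → sgn c * ∏ N (λ i → stays c i - moves c i))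
  alt-∏ = begin
    ∑ Us (λ A → parity (size A) * F A x)
      ≡⟨ ∑-cong Us (λ A → trans (cong (parity (size A) *_) (F-∑ A x))
           (sym (∑-*ˡ Sₙ (parity (size A)) (λ c → sgn c * ι (agrees? c x A))))) ⟩
    ∑ Us (λ A → ∑ Sₙ (λ c → parity (size A) * (sgn c * ι (agrees? c x A))))
      ≡⟨ ∑-swap Us Sₙ (λ A c → parity (size A) * (sgn c * ι (agrees? c x A))) ⟩
    ∑ Sₙ (λ c → ∑ Us (λ A → parity (size A) * (sgn c * ι (agrees? c x A))))
      ≡⟨ ∑-cong Sₙ (λ c → trans (∑-cong Us (λ A → term c A)) (∑-*ˡ Us (sgn c) (h c))) ⟩
    ∑ Sₙ (λ c → sgn c * ∑ Us (h c))
      ≡⟨ ∑-cong Sₙ (λ c → cong (sgn c *_) (expand-∏ N (stays c) (moves c))) ⟨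
    ∑ Sₙ (λ c → sgn c * ∏ N (λ i → stays c i - moves c i))
      ∎
    where
    open ≡-Reasoning
    Us = subsets N
    Sₙ = S (suc N)
    h : Perm (suc N) → Vec Bool N → ℤ
    h c A = parity (size A) * ∏ N (λ i → if lookup A i then moves c i else stays c i)
    move : ∀ a b c → a * (b * c) ≡ b * (a * c)
    move = solve-∀
    term : ∀ c A → parity (size A) * (sgn c * ι (agrees? c x A)) ≡ sgn c * h c A
    term c A = trans (move (parity (size A)) (sgn c) (ι (agrees? c x A)))
                     (cong (λ t → sgn c * (parity (size A) * t)) (ι-agrees c A))

-- Determinants with dependent columns

module _ (M : Fin n → Fin n → ℤ) where

  private
    replace : Fin n → Fin n → Fin n → Fin n
    replace j₀ j k = if does (k ≟ j₀) then j else k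

    replace-yes : ∀ j₀ j {k} → k ≡ j₀ → replace j₀ j k ≡ j
    replace-yes j₀ j {k} e with k ≟ j₀
    ... | yes _ = refl
    ... | no ¬e = ⊥-elim (¬e e)

    replace-no : ∀ j₀ j {k} → k ≢ j₀ → replace j₀ j k ≡ k
    replace-no j₀ j {k} ne with k ≟ j₀
    ... | yes e = ⊥-elim (ne e)
    ... | no _  = refl

    term : Fin n → Fin n → Perm n → ℤ
    term j₀ j c = ∏ n (λ i → M i (replace j₀ j (lookup c i)))

    -- The determinant of `M` with column `j₀` overwritten by column `j`.
    col-det : Fin n → Fin n → ℤ
    col-det j₀ j = ∑ (S n) (λ c → sgn c * term j₀ j c)

    -- Columns `j` and `j₀` are now equal: composing with their transposition changes the sign of
    -- every summand and nothing else.
    repeated-col : ∀ {j₀ j} → j ≢ j₀ → col-det j₀ j ≡ 0ℤ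
    repeated-col {j₀} {j} j≢ = neg-fixed⇒zero (col-det j₀ j) (begin
      col-det j₀ j
        ≡⟨ ∑-translateˡ (Inj-swap j j₀) (λ c → sgn c * term j₀ j c) ⟨
      ∑ (S n) (λ c → sgn (t ⊙ c) * term j₀ j (t ⊙ c))
        ≡⟨ ∑-cong∈ (S n) (λ {c} c∈ → cong₂ _*_
             (trans (sgn-⊙ (Inj-swap j j₀) (∈S⇒Inj c∈)) (cong (_* sgn c) (sgn-swap j≢)))
             (∏-cong n (λ i → cong (M i) (trans (cong (replace j₀ j) (lookup-⊙ t c i)) (absorb (lookup c i)))))) ⟩
      ∑ (S n) (λ c → (-1ℤ * sgn c) * term j₀ j c)
        ≡⟨ ∑-cong (S n) (λ c → ℤₚ.*-assoc -1ℤ (sgn c) (term j₀ j c)) ⟩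
      ∑ (S n) (λ c → -1ℤ * (sgn c * term j₀ j c))
        ≡⟨ ∑-*ˡ (S n) -1ℤ (λ c → sgn c * term j₀ j c) ⟩
      -1ℤ * col-det j₀ j
        ∎)
      where
      open ≡-Reasoning
      t : Perm n
      t = swap j j₀
      absorb : ∀ k → replace j₀ j (lookup t k) ≡ replace j₀ j k
      absorb k with swapView j j₀ k
      ... | isL refl e = trans (cong (replace j₀ j) e) (trans (replace-yes j₀ j refl) (sym (replace-no j₀ j j≢)))
      ... | isR refl e = trans (cong (replace j₀ j) e) (trans (replace-no j₀ j j≢) (sym (replace-yes j₀ j refl)))
      ... | isO _ _ e  = cong (replace j₀ j) e

  -- Cramer's rule: replacing column j₀ by the combination Mv multiplies the determinant by v j₀.
  kernel⇒det-zero : (v : Fin n → ℤ) → (∀ i → ∑ (allFin n) (λ j → v j * M i j) ≡ 0ℤ) → ∀ {j₀} → v j₀ ≢ 0ℤ →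
                    ∑ (S n) (λ c → sgn c * ∏ n (λ i → M i (lookup c i))) ≡ 0ℤ
  kernel⇒det-zero v Mv≡0 {j₀} v≢0 = [ ⊥-elim ∘ v≢0 , id ]′ (ℤₚ.i*j≡0⇒i≡0∨j≡0 (v j₀) (begin
    v j₀ * ∑ (S n) (λ c → sgn c * ∏ n (λ i → M i (lookup c i)))
      ≡⟨ cong (v j₀ *_) (∑-cong (S n) (λ c → cong (sgn c *_) (∏-cong n (λ i → cong (M i) (trivial (lookup c i)))))) ⟩
    v j₀ * col-det j₀ j₀
      ≡⟨ ∑-point (Uniqueₚ.allFin⁺ n) (∈allFin j₀) (λ {j} _ j≢ →
           trans (cong (v j *_) (repeated-col j≢)) (ℤₚ.*-zeroʳ (v j))) ⟨
    ∑ Fs (λ j → v j * col-det j₀ j)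
      ≡⟨ ∑-cong Fs (λ j → sym (∑-*ˡ (S n) (v j) (λ c → sgn c * term j₀ j c))) ⟩
    ∑ Fs (λ j → ∑ (S n) (λ c → v j * (sgn c * term j₀ j c)))
      ≡⟨ ∑-swap Fs (S n) (λ j c → v j * (sgn c * term j₀ j c)) ⟩
    ∑ (S n) (λ c → ∑ Fs (λ j → v j * (sgn c * term j₀ j c)))
      ≡⟨ ∑-zero∈ (S n) (λ {c} c∈ → trans
           (∑-cong Fs (λ j → move (v j) (sgn c) (term j₀ j c)))
           (trans (∑-*ˡ Fs (sgn c) (λ j → v j * term j₀ j c))
                  (trans (cong (sgn c *_) (combined c (∈S⇒Inj c∈))) (ℤₚ.*-zeroʳ (sgn c))))) ⟩
    0ℤ
      ∎))
    where
    open ≡-Reasoning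
    Fs = allFin n
    move : ∀ a b c → a * (b * c) ≡ b * (a * c)
    move = solve-∀
    trivial : ∀ k → k ≡ replace j₀ j₀ k
    trivial k with k ≟ j₀
    ... | yes e = e
    ... | no _  = refl
    combined : ∀ c → Inj c → ∑ Fs (λ j → v j * term j₀ j c) ≡ 0ℤ
    combined c p = begin
      ∑ Fs (λ j → v j * term j₀ j c)       ≡⟨ ∑-cong Fs (λ j → trans (cong (v j *_) (factor j)) (sym (ℤₚ.*-assoc (v j) (M i₀ j) K))) ⟩
      ∑ Fs (λ j → v j * M i₀ j * K)        ≡⟨ ∑-*ʳ Fs K (λ j → v j * M i₀ j) ⟩
      ∑ Fs (λ j → v j * M i₀ j) * K        ≡⟨ cong (_* K) (Mv≡0 i₀) ⟩
      0ℤ * K                               ≡⟨ ℤₚ.*-zeroˡ K ⟩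
      0ℤ                                   ∎
      where
      i₀ : Fin n
      -- The row whose entry is taken from column `j₀`: its factor is the only one that the
      -- overwriting affects.
      i₀ = lookup (inv c) j₀
      off : ∀ {i} → i ≢ i₀ → lookup c i ≢ j₀
      off {i} i≢ e = i≢ (trans (sym (lookup-invˡ p i)) (cong (lookup (inv c)) e))
      E : ∃ λ K → ∀ j → term j₀ j c ≡ M i₀ (replace j₀ j (lookup c i₀)) * K
      E = ∏-extract i₀ (λ j i → M i (replace j₀ j (lookup c i))) j₀
            (λ j i i≢ → cong (M i) (trans (replace-no j₀ j (off i≢)) (sym (replace-no j₀ j₀ (off i≢)))))
      K : ℤ
      K = proj₁ E
      factor : ∀ j → term j₀ j c ≡ M i₀ j * K
      factor j = trans (proj₂ E j) (cong (λ k → M i₀ k * K) (replace-yes j₀ j (lookup-invʳ p j₀)))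

∑-delta : (v : Fin n → ℤ) (a : Fin n) → ∑ (allFin n) (λ j → v j * ι (j ≟ a)) ≡ v a
∑-delta {n} v a = trans
  (∑-point (Uniqueₚ.allFin⁺ n) (∈allFin a) (λ {j} _ j≢ → trans (cong (v j *_) (ι-no (j ≟ a) j≢)) (ℤₚ.*-zeroʳ (v j))))
  (trans (cong (v a *_) (ι-yes (a ≟ a) refl)) (ℤₚ.*-identityʳ (v a)))

-- Up to the row of ones the matrix is 1 - x, so an x-invariant v of total 0 is in its kernel.
alt-invariant : (x : Perm (suc N)) (v : Fin (suc N) → ℤ) → (∀ i → v (lookup x (suc i)) ≡ v (suc i)) →
                ∑ (allFin (suc N)) v ≡ 0ℤ → ∀ {j₀} → v j₀ ≢ 0ℤ →
                ∑ (subsets N) (λ A → parity (size A) * F A x) ≡ 0ℤ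
alt-invariant {N} x v v-inv v-total v≢0 = trans (alt-∏ x) (trans
  (∑-cong (S (suc N)) (λ c → cong (sgn c *_) (sym (ℤₚ.*-identityˡ (∏ N (λ i → stays x c i - moves x c i))))))
  (kernel⇒det-zero M v Mv v≢0))
  where
  open ≡-Reasoning
  Fs = allFin (suc N)
  M : Fin (suc N) → Fin (suc N) → ℤ
  M zero    j = 1ℤ
  M (suc i) j = ι (j ≟ suc i) - ι (j ≟ lookup x (suc i))
  distrib : ∀ a b c → a * (b - c) ≡ a * b - a * c
  distrib = solve-∀
  Mv : ∀ i → ∑ Fs (λ j → v j * M i j) ≡ 0ℤ
  Mv zero    = trans (∑-cong Fs (λ j → ℤₚ.*-identityʳ (v j))) v-total
  Mv (suc i) = begin
    ∑ Fs (λ j → v j * (ι (j ≟ suc i) - ι (j ≟ y)))             ≡⟨ ∑-cong Fs (λ j → distrib (v j) (ι (j ≟ suc i)) (ι (j ≟ y))) ⟩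
    ∑ Fs (λ j → v j * ι (j ≟ suc i) - v j * ι (j ≟ y))         ≡⟨ ∑-- Fs (λ j → v j * ι (j ≟ suc i)) (λ j → v j * ι (j ≟ y)) ⟩
    ∑ Fs (λ j → v j * ι (j ≟ suc i)) - ∑ Fs (λ j → v j * ι (j ≟ y)) ≡⟨ cong₂ _-_ (∑-delta v (suc i)) (∑-delta v y) ⟩
    v (suc i) - v y                                            ≡⟨ cong (λ t → v (suc i) - t) (v-inv i) ⟩
    v (suc i) - v (suc i)                                      ≡⟨ ℤₚ.+-inverseʳ (v (suc i)) ⟩
    0ℤ                                                         ∎
    where
    y : Fin (suc N)
    y = lookup x (suc i)

transitive? : {x : Perm (suc N)} → Inj x → Transitive x ⊎ ∃ λ j → ¬ Orb x zero j
transitive? {N} {x} p with Finₚ.all? (orb? p zero)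
... | yes h = inj₁ (mkTransitive h)
... | no ¬h = inj₂ (Finₚ.¬∀⟶∃¬ (suc N) _ (orb? p zero) ¬h)

-- The kernel vector is n times the indicator of the orbit of zero, minus the size `μ` of that
-- orbit. It is constant on cycles and has total 0. At a point outside the orbit it equals `- μ`,
-- which is nonzero because zero lies in its own orbit.
alt-intransitive : {x : Perm (suc N)} → Inj x → (∃ λ j → ¬ Orb x zero j) →
                   ∑ (subsets N) (λ A → parity (size A) * F A x) ≡ 0ℤ
alt-intransitive {N} {x} p (j₀ , j₀∉) = alt-invariant x v v-inv v-total {j₀} v≢0
  where
  open ≡-Reasoning
  Fs = allFin (suc N)
  w : Fin (suc N) → ℤ
  w j = ι (orb? p zero j)
  μ nn : ℤ
  μ = ∑ Fs w
  nn = ℤ.+ suc N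
  v : Fin (suc N) → ℤ
  v j = nn * w j - μ
  v-inv : ∀ i → v (lookup x (suc i)) ≡ v (suc i)
  v-inv i = cong (λ t → nn * t - μ) (ι-cong (orb? p zero (lookup x (suc i))) (orb? p zero (suc i))
    (λ o → orb-trans o (orb-sym p (orb-step (suc i)))) (λ o → orb-trans o (orb-step (suc i))))
  v-total : ∑ Fs v ≡ 0ℤ
  v-total = begin
    ∑ Fs v                                         ≡⟨ ∑-- Fs (λ j → nn * w j) (λ _ → μ) ⟩
    ∑ Fs (λ j → nn * w j) - ∑ Fs (λ _ → μ)         ≡⟨ cong₂ _-_ (∑-*ˡ Fs nn w) (∑-const Fs μ) ⟩
    nn * μ - ℤ.+ length Fs * μ                     ≡⟨ cong (λ l → nn * μ - ℤ.+ l * μ) (Listₚ.length-tabulate {n = suc N} id) ⟩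
    nn * μ - nn * μ                                ≡⟨ ℤₚ.+-inverseʳ (nn * μ) ⟩
    0ℤ                                             ∎
  μ≥1 : 1ℤ ℤ.≤ μ
  μ≥1 = ℤₚ.≤-trans (ℤₚ.≤-reflexive (sym (trans (∑-delta w zero′) (ι-yes (orb? p zero zero′) orb-refl))))
          (∑-mono∈ Fs (λ {j} _ → small j))
    where
    zero′ : Fin (suc N)
    zero′ = zero
    small : ∀ j → w j * ι (j ≟ zero) ℤ.≤ w j
    small j with j ≟ zero
    ... | yes _ = ℤₚ.≤-reflexive (ℤₚ.*-identityʳ (w j))
    ... | no _  = subst (ℤ._≤ w j) (sym (ℤₚ.*-zeroʳ (w j))) (ι-nonneg (orb? p zero j))
  v≢0 : v j₀ ≢ 0ℤ
  v≢0 e = ℤₚ.<⇒≢ (ℤ.+<+ (ℕ.s≤s ℕ.z≤n)) (sym (ℤₚ.≤-antisym (subst (1ℤ ℤ.≤_) μ≡0 μ≥1) (ℤ.+≤+ ℕ.z≤n)))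
    where
    w0 : w j₀ ≡ 0ℤ
    w0 = ι-no (orb? p zero j₀) j₀∉
    μ≡0 : μ ≡ 0ℤ
    μ≡0 = begin
      μ                       ≡⟨ flip μ ⟨
      - (0ℤ - μ)              ≡⟨ cong (λ t → - (t - μ)) (trans (cong (nn *_) w0) (ℤₚ.*-zeroʳ nn)) ⟨
      - (nn * w j₀ - μ)       ≡⟨ cong -_ e ⟩
      0ℤ                      ∎
      where
      flip : ∀ a → - (0ℤ - a) ≡ a
      flip = solve-∀

-- The subsets that contribute for a full cycle

_≟V_ : DecidableEquality (Vec Bool N)
_≟V_ = Vecₚ.≡-dec Boolₚ._≟_

iter-inv : {x : Perm n} → Inj x → ∀ k j → iter (inv x) k (iter x k j) ≡ j
iter-inv p zero    j = refl
iter-inv {x = x} p (suc k) j = begin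
  iter (inv x) (suc k) (lookup x (iter x k j))                ≡⟨ cong (λ m → iter (inv x) m (lookup x (iter x k j))) (ℕₚ.+-comm 1 k) ⟩
  iter (inv x) (k ℕ.+ 1) (lookup x (iter x k j))              ≡⟨ iter-+ (inv x) k 1 (lookup x (iter x k j)) ⟩
  iter (inv x) k (lookup (inv x) (lookup x (iter x k j)))     ≡⟨ cong (iter (inv x) k) (lookup-invˡ p (iter x k j)) ⟩
  iter (inv x) k (iter x k j)                                 ≡⟨ iter-inv p k j ⟩
  j                                                           ∎
  where open ≡-Reasoning

V-ext : {A B : Vec Bool N} → (∀ i → lookup A i ≡ lookup B i) → A ≡ B
V-ext {A = A} {B} h = trans (sym (Vecₚ.tabulate∘lookup A)) (trans (Vecₚ.tabulate-cong h) (Vecₚ.tabulate∘lookup B))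

-- The point zero counts as a member, because mapping a point of `A` to zero is no clash.
member : Vec Bool N → Fin (suc N) → Bool
member A zero    = true
member A (suc i) = lookup A i

initial-segment : ∀ N (a : ℕ → Bool) → a 0 ≡ true → (∀ {m} → suc m ℕ.≤ N → a (suc m) ≡ true → a m ≡ true) →
                  ∃ λ k → k ℕ.≤ N × (∀ {m} → m ℕ.≤ N → a m ≡ (m ℕ.≤ᵇ k))
initial-segment zero    a a0 down = 0 , ℕ.z≤n , λ { ℕ.z≤n → a0 }
initial-segment (suc N) a a0 down with bool-cases (a (suc N))
... | inj₁ e = suc N , ℕₚ.≤-refl , λ {m} m≤ → trans (all-true m m≤) (sym (T⇒≡ (ℕₚ.≤⇒≤ᵇ m≤)))
  where
  descend : ∀ d m → d ℕ.+ m ≡ suc N → a m ≡ true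
  descend zero    m eq = trans (cong a eq) e
  descend (suc d) m eq = down (subst (suc m ℕ.≤_) eq (ℕ.s≤s (ℕₚ.m≤n+m m d)))
                              (descend d (suc m) (trans (ℕₚ.+-suc d m) eq))
  all-true : ∀ m → m ℕ.≤ suc N → a m ≡ true
  all-true m m≤ = descend (suc N ℕ.∸ m) m (ℕₚ.m∸n+n≡m m≤)
... | inj₂ e with initial-segment N a a0 (down ∘ ℕₚ.m≤n⇒m≤1+n)
...   | k , k≤N , h = k , ℕₚ.m≤n⇒m≤1+n k≤N , λ {m} m≤ → go m (ℕₚ.m≤n⇒m<n∨m≡n m≤)
  where
  go : ∀ m → m ℕ.< suc N ⊎ m ≡ suc N → a m ≡ (m ℕ.≤ᵇ k)
  go m (inj₁ m<)   = h (ℕ.s≤s⁻¹ m<)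
  go m (inj₂ refl) with bool-cases (suc N ℕ.≤ᵇ k)
  ... | inj₁ t = ⊥-elim (ℕₚ.<⇒≱ (ℕ.s≤s k≤N) (ℕₚ.≤ᵇ⇒≤ (suc N) k (≡⇒T t)))
  ... | inj₂ f = trans e (sym f)

-- For an n-cycle x the points are s k = x⁻ᵏ zero, k ≤ N. The only subsets with F A x ≠ 0 are the
-- initial segments {s 1 , … , s k}, on which x agrees with the (k+1)-cycle cyc k.
module Cycle {x : Perm (suc N)} (p : Inj x) (tr : Transitive x) where

  s : ℕ → Fin (suc N)
  s k = iter (inv x) k zero

  x-s : ∀ k → lookup x (s (suc k)) ≡ s k
  x-s k = lookup-invʳ p (s k)

  private
    opaque
      located : ∀ j → ∃ λ (k : Fin (suc N)) → s (toℕ k) ≡ j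
      located j with orb-sym p (covers tr j)
      ... | orb k e = orb-bounded (Inj-inv p) (orb k (trans (cong (iter (inv x) k) (sym e)) (iter-inv p k j)))

  opaque
    ixF : Fin (suc N) → Fin (suc N)
    ixF j = proj₁ (located j)

    s-ixF : ∀ j → s (toℕ (ixF j)) ≡ j
    s-ixF j = proj₂ (located j)

  opaque
    ix : Fin (suc N) → ℕ
    ix j = toℕ (ixF j)

    ix-def : ∀ j → ix j ≡ toℕ (ixF j)
    ix-def j = refl

    ix≤ : ∀ j → ix j ℕ.≤ N
    ix≤ j = ℕ.s≤s⁻¹ (Finₚ.toℕ<n (ixF j))

    s-ix : ∀ j → s (ix j) ≡ j
    s-ix j = s-ixF j

  -- `ixF` is injective, since `s` undoes it, and therefore onto. So every index up to N belongs to
  -- a point, and that point can only be `s k`.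
  ix-s : ∀ {k} → k ℕ.≤ N → ix (s k) ≡ k
  ix-s {k} k≤ = begin
    ix (s k)                    ≡⟨ cong (λ m → ix (s m)) (trans (sym toℕ-kf) (trans (cong toℕ (sym (proj₂ onto))) (sym (ix-def j)))) ⟩
    ix (s (ix j))               ≡⟨ cong ix (s-ix j) ⟩
    ix j                        ≡⟨ ix-def j ⟩
    toℕ (ixF j)                 ≡⟨ cong toℕ (proj₂ onto) ⟩
    toℕ kf                      ≡⟨ toℕ-kf ⟩
    k                           ∎
    where
    open ≡-Reasoning
    kf : Fin (suc N)
    kf = Fin.fromℕ< (ℕ.s≤s k≤)
    toℕ-kf : toℕ kf ≡ k
    toℕ-kf = Finₚ.toℕ-fromℕ< (ℕ.s≤s k≤)
    ixF-inj : ∀ {i j} → ixF i ≡ ixF j → i ≡ j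
    ixF-inj {i} {j} e = trans (sym (s-ixF i)) (trans (cong (λ m → s (toℕ m)) e) (s-ixF j))
    onto : ∃ λ j → ixF j ≡ kf
    onto = injective⇒surjective ixF ixF-inj kf
    j : Fin (suc N)
    j = proj₁ onto

  s-inj : ∀ {a b} → a ℕ.≤ N → b ℕ.≤ N → s a ≡ s b → a ≡ b
  s-inj a≤ b≤ e = trans (sym (ix-s a≤)) (trans (cong ix e) (ix-s b≤))

  opaque
    segment : ℕ → Vec Bool N
    segment k = tabulate λ i → ix (suc i) ℕ.≤ᵇ k

    lookup-segment : ∀ k i → lookup (segment k) i ≡ (ix (suc i) ℕ.≤ᵇ k)
    lookup-segment k = Vecₚ.lookup∘tabulate (λ i → ix (suc i) ℕ.≤ᵇ k)

  segment-in : ∀ {k i} → lookup (segment k) i ≡ true → ix (suc i) ℕ.≤ k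
  segment-in {k} {i} e = ℕₚ.≤ᵇ⇒≤ (ix (suc i)) k (≡⇒T (trans (sym (lookup-segment k i)) e))

  segment-in⁻ : ∀ {k i} → ix (suc i) ℕ.≤ k → lookup (segment k) i ≡ true
  segment-in⁻ {k} {i} le = trans (lookup-segment k i) (T⇒≡ (ℕₚ.≤⇒≤ᵇ le))

  segment-out : ∀ {k i} → lookup (segment k) i ≡ false → k ℕ.< ix (suc i)
  segment-out e = ℕₚ.≰⇒> λ le → true≢false (segment-in⁻ le) e

  segment-out⁻ : ∀ {k i} → k ℕ.< ix (suc i) → lookup (segment k) i ≡ false
  segment-out⁻ {k} {i} lt′ with bool-cases (lookup (segment k) i)
  ... | inj₁ e = ⊥-elim (ℕₚ.<⇒≱ lt′ (segment-in e))
  ... | inj₂ e = e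

  -- For `k` up to N this is the cycle taking `s (suc m)` to `s m` for `m` below `k`, and `s 0` to
  -- `s k`. It is written with `k` transpositions so that its sign can be read off.
  cyc : ℕ → Perm (suc N)
  cyc zero    = idP
  cyc (suc k) = swap (s k) (s (suc k)) ⊙ cyc k

  Inj-cyc : ∀ k → Inj (cyc k)
  Inj-cyc zero    = Inj-id
  Inj-cyc (suc k) = Inj-⊙ (Inj-swap (s k) (s (suc k))) (Inj-cyc k)

  private
    cyc-suc : ∀ k i → lookup (cyc (suc k)) i ≡ lookup (swap (s k) (s (suc k))) (lookup (cyc k) i)
    cyc-suc k i = lookup-⊙ (swap (s k) (s (suc k))) (cyc k) i

    apart : ∀ {a b} → a ℕ.≤ N → b ℕ.≤ N → a ≢ b → s a ≢ s b
    apart a≤ b≤ a≢b e = a≢b (s-inj a≤ b≤ e)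

  cyc-above : ∀ k {m} → k ℕ.< m → m ℕ.≤ N → lookup (cyc k) (s m) ≡ s m
  cyc-above zero    _ _ = lookup-id _
  cyc-above (suc k) {m} k<m m≤ = trans (cyc-suc k (s m))
    (trans (cong (lookup (swap (s k) (s (suc k)))) (cyc-above k k<m′ m≤))
           (swap-o (s k) (s (suc k)) (apart m≤ (ℕₚ.≤-trans (ℕₚ.<⇒≤ k<m′) m≤) (ℕₚ.>⇒≢ k<m′))
                                     (apart m≤ (ℕₚ.≤-trans (ℕₚ.<⇒≤ k<m) m≤) (ℕₚ.>⇒≢ k<m))))
    where
    k<m′ : k ℕ.< m
    k<m′ = ℕₚ.<-trans (ℕₚ.n<1+n k) k<m

  cyc-below : ∀ k {m} → m ℕ.< k → k ℕ.≤ N → lookup (cyc k) (s (suc m)) ≡ s m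
  cyc-below (suc k) {m} m<k k≤ = trans (cyc-suc k (s (suc m))) (go (ℕₚ.m≤n⇒m<n∨m≡n (ℕ.s≤s⁻¹ m<k)))
    where
    k≤N : k ℕ.≤ N
    k≤N = ℕₚ.≤-trans (ℕₚ.n≤1+n k) k≤
    go : m ℕ.< k ⊎ m ≡ k → lookup (swap (s k) (s (suc k))) (lookup (cyc k) (s (suc m))) ≡ s m
    go (inj₂ refl) = trans (cong (lookup (swap (s k) (s (suc k)))) (cyc-above k (ℕₚ.n<1+n k) k≤)) (swap-r (s k) (s (suc k)))
    go (inj₁ lt′)  = trans (cong (lookup (swap (s k) (s (suc k)))) (cyc-below k lt′ k≤N))
      (swap-o (s k) (s (suc k)) (apart m≤N k≤N (ℕₚ.<⇒≢ lt′)) (apart m≤N k≤ (ℕₚ.<⇒≢ m<k)))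
      where
      m≤N : m ℕ.≤ N
      m≤N = ℕₚ.≤-trans (ℕₚ.<⇒≤ lt′) k≤N

  cyc-agrees : ∀ {k} → k ℕ.≤ N → Agrees (cyc k) x (segment k)
  cyc-agrees {k} k≤ = mk-agrees
    (λ {i} e → inside i (ix (suc i)) refl (segment-in e))
    (λ {i} e → trans (cong (lookup (cyc k)) (sym (s-ix (suc i)))) (trans (cyc-above k (segment-out e) (ix≤ (suc i))) (s-ix (suc i))))
    where
    inside : ∀ i m → ix (suc i) ≡ m → m ℕ.≤ k → lookup (cyc k) (suc i) ≡ lookup x (suc i)
    -- Index 0 belongs to the point zero, never to a `suc i`.
    inside i zero    eq m≤ with trans (sym (s-ix (suc i))) (cong s eq)
    ... | ()
    inside i (suc m) eq m≤ = trans (cong (lookup (cyc k)) pt) (trans (cyc-below k m≤ k≤) (trans (sym (x-s m)) (cong (lookup x) (sym pt))))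
      where
      pt : suc i ≡ s (suc m)
      pt = trans (sym (s-ix (suc i))) (cong s eq)

  sgn-cyc : ∀ k → k ℕ.≤ N → sgn (cyc k) ≡ parity k
  sgn-cyc zero    _  = sgn-id
  sgn-cyc (suc k) k≤ = begin
    sgn (cyc (suc k))                          ≡⟨ sgn-⊙ (Inj-swap (s k) (s (suc k))) (Inj-cyc k) ⟩
    sgn (swap (s k) (s (suc k))) * sgn (cyc k) ≡⟨ cong₂ _*_ (sgn-swap (apart k≤N k≤ (ℕₚ.<⇒≢ (ℕₚ.n<1+n k)))) (sgn-cyc k k≤N) ⟩
    -1ℤ * parity k                             ≡⟨ ℤₚ.-1*i≡-i (parity k) ⟩
    - parity k                                 ∎
    where
    open ≡-Reasoning
    k≤N : k ℕ.≤ N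
    k≤N = ℕₚ.≤-trans (ℕₚ.n≤1+n k) k≤

  F-segment : ∀ {k} → k ℕ.≤ N → F (segment k) x ≡ parity k
  F-segment {k} k≤ = trans (F-value (Inj-cyc k) (cyc-agrees k≤)) (sgn-cyc k k≤)

  size-segment : ∀ k → k ℕ.≤ N → size (segment k) ≡ k
  size-segment zero    _  = all-false (segment 0) (λ i → segment-out⁻ (positive i (ix (suc i)) refl))
    where
    all-false : ∀ {M} (A : Vec Bool M) → (∀ i → lookup A i ≡ false) → size A ≡ 0
    all-false []          h = refl
    all-false (true ∷ A)  h with h zero
    ... | ()
    all-false (false ∷ A) h = all-false A (h ∘ suc)
    positive : ∀ i m → ix (suc i) ≡ m → 0 ℕ.< ix (suc i)
    positive i zero    eq with trans (sym (s-ix (suc i))) (cong s eq)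
    ... | ()
    positive i (suc m) eq = subst (0 ℕ.<_) (sym eq) (ℕ.s≤s ℕ.z≤n)
  size-segment (suc k) k≤ = at (s (suc k)) refl
    where
    k≤N : k ℕ.≤ N
    k≤N = ℕₚ.≤-trans (ℕₚ.n≤1+n k) k≤
    size-insert : ∀ {M} (A : Vec Bool M) b → lookup A b ≡ false → size (insert A b) ≡ suc (size A)
    size-insert (false ∷ A) zero    e = refl
    size-insert (true ∷ A)  (suc b) e = cong suc (size-insert A b e)
    size-insert (false ∷ A) (suc b) e = size-insert A b e
    at : ∀ j → s (suc k) ≡ j → size (segment (suc k)) ≡ suc k
    at zero    e with s-inj {suc k} {0} k≤ ℕ.z≤n e
    ... | ()
    -- Raising `k` by one adds exactly the point `s (suc k)` to the segment.
    at (suc b) e = begin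
      size (segment (suc k))           ≡⟨ cong size (V-ext {A = segment (suc k)} {insert (segment k) b} grow) ⟩
      size (insert (segment k) b)      ≡⟨ size-insert (segment k) b (segment-out⁻ (ℕₚ.≤-reflexive (sym ix-b))) ⟩
      suc (size (segment k))           ≡⟨ cong suc (size-segment k k≤N) ⟩
      suc k                            ∎
      where
      open ≡-Reasoning
      ix-b : ix (suc b) ≡ suc k
      ix-b = trans (cong ix (sym e)) (ix-s k≤)
      grow : ∀ i → lookup (segment (suc k)) i ≡ lookup (insert (segment k) b) i
      grow i with i ≟ b
      ... | yes refl = trans (segment-in⁻ (ℕₚ.≤-reflexive ix-b)) (sym (insert-at (segment k) b))
      ... | no i≢b with bool-cases (lookup (segment k) i)
      ...   | inj₁ f = trans (segment-in⁻ (ℕₚ.m≤n⇒m≤1+n (segment-in f))) (sym (trans (insert-off (segment k) i≢b) f))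
      ...   | inj₂ f = trans (segment-out⁻ (ℕₚ.≤∧≢⇒< (segment-out f) other)) (sym (trans (insert-off (segment k) i≢b) f))
        where
        other : suc k ≢ ix (suc i)
        other eq = i≢b (Finₚ.suc-injective (trans (sym (s-ix (suc i))) (trans (cong s (sym eq)) e)))

  -- `x` moves each `s (suc m)` to `s m`, so without a clash membership passes down along the
  -- indices, and a downward closed set of indices containing 0 is an initial segment.
  closed⇒segment : (A : Vec Bool N) → ¬ Clash x A → ∃ λ k → k ℕ.≤ N × A ≡ segment k
  closed⇒segment A ¬cl = k , k≤ , V-ext (λ i →
      trans (cong (member A) (sym (s-ix (suc i)))) (trans (h (ix≤ (suc i))) (sym (lookup-segment k i))))
    where
    closed : ∀ i j → lookup A i ≡ true → lookup x (suc i) ≡ j → member A j ≡ true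
    closed i zero    e eq = refl
    closed i (suc j) e eq with bool-cases (lookup A j)
    ... | inj₁ t = t
    ... | inj₂ f = ⊥-elim (¬cl (mkClash e f eq))
    back : ∀ j k → member A j ≡ true → lookup x j ≡ k → j ≢ zero → member A k ≡ true
    back zero    k e eq nz = ⊥-elim (nz refl)
    back (suc i) k e eq nz = closed i k e eq
    down : ∀ {m} → suc m ℕ.≤ N → member A (s (suc m)) ≡ true → member A (s m) ≡ true
    down {m} m< e = back (s (suc m)) (s m) e (x-s m) (λ eq → ℕₚ.1+n≢0 (s-inj {suc m} {0} m< ℕ.z≤n eq))
    I : ∃ λ k → k ℕ.≤ N × (∀ {m} → m ℕ.≤ N → member A (s m) ≡ (m ℕ.≤ᵇ k))
    I = initial-segment N (λ m → member A (s m)) refl down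
    k : ℕ
    k = proj₁ I
    k≤ : k ℕ.≤ N
    k≤ = proj₁ (proj₂ I)
    h : ∀ {m} → m ℕ.≤ N → member A (s m) ≡ (m ℕ.≤ᵇ k)
    h = proj₂ (proj₂ I)

  private
    δ : Vec Bool N → ℕ → ℤ
    δ A k = ι (A ≟V segment k)

    δ-self : ∀ {k m} → k ℕ.≤ N → m ∈ upTo (suc N) → m ≢ k → δ (segment k) m ≡ 0ℤ
    δ-self {k} {m} k≤ m∈ m≢k = ι-no (segment k ≟V segment m) λ e →
      m≢k (trans (sym (size-segment m (ℕ.s≤s⁻¹ (∈ₚ.∈-upTo⁻ m∈)))) (trans (cong size (sym e)) (size-segment k k≤)))

    term : (A : Vec Bool N) (g : ℤ) → parity (size A) * F A x * g ≡ ∑ (upTo (suc N)) (λ k → δ A k * g)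
    term A g with dichotomy p A
    ... | inj₂ cl = trans (cong (_* g) (trans (cong (parity (size A) *_) (F-zero (clash-¬agrees cl))) (ℤₚ.*-zeroʳ (parity (size A)))))
        (trans (ℤₚ.*-zeroˡ g) (sym (∑-zero∈ (upTo (suc N)) (λ {k} k∈ →
          trans (cong (_* g) (ι-no (A ≟V segment k) (not-segment k k∈))) (ℤₚ.*-zeroˡ g)))))
      where
      not-segment : ∀ k → k ∈ upTo (suc N) → A ≢ segment k
      not-segment k k∈ e = clash-¬agrees cl (Inj-cyc k)
        (subst (Agrees (cyc k) x) (sym e) (cyc-agrees (ℕ.s≤s⁻¹ (∈ₚ.∈-upTo⁻ k∈))))
    ... | inj₁ (c , q , h) = go (closed⇒segment A (λ cl → clash-¬agrees cl q h))
      where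
      open ≡-Reasoning
      go : (∃ λ k → k ℕ.≤ N × A ≡ segment k) → parity (size A) * F A x * g ≡ ∑ (upTo (suc N)) (λ k → δ A k * g)
      go (k , k≤ , refl) = begin
        parity (size (segment k)) * F (segment k) x * g      ≡⟨ cong (_* g) (cong₂ _*_ (cong parity (size-segment k k≤)) (F-segment k≤)) ⟩
        parity k * parity k * g                              ≡⟨ cong (_* g) (parity²≡1 k) ⟩
        1ℤ * g                                               ≡⟨ cong (_* g) (ι-yes (segment k ≟V segment k) refl) ⟨
        δ (segment k) k * g
          ≡⟨ ∑-point (Uniqueₚ.upTo⁺ (suc N)) (∈ₚ.∈-upTo⁺ (ℕ.s≤s k≤)) (λ {m} m∈ m≢k →
               trans (cong (_* g) (δ-self k≤ m∈ m≢k)) (ℤₚ.*-zeroˡ g)) ⟨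
        ∑ (upTo (suc N)) (λ m → δ (segment k) m * g)         ∎

  -- For a segment the sign `parity k` of the cycle `cyc k` cancels the `parity` of the size. There
  -- is one segment of each size from 0 to N.
  cycle-sum : (g : Vec Bool N → ℤ) →
              ∑ (subsets N) (λ A → parity (size A) * F A x * g A) ≡ ∑ (upTo (suc N)) (λ k → g (segment k))
  cycle-sum g = begin
    ∑ (subsets N) (λ A → parity (size A) * F A x * g A)            ≡⟨ ∑-cong (subsets N) (λ A → term A (g A)) ⟩
    ∑ (subsets N) (λ A → ∑ (upTo (suc N)) (λ k → δ A k * g A))     ≡⟨ ∑-swap (subsets N) (upTo (suc N)) (λ A k → δ A k * g A) ⟩
    ∑ (upTo (suc N)) (λ k → ∑ (subsets N) (λ A → δ A k * g A))     ≡⟨ ∑-cong (upTo (suc N)) at ⟩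
    ∑ (upTo (suc N)) (λ k → g (segment k))                         ∎
    where
    open ≡-Reasoning
    at : ∀ k → ∑ (subsets N) (λ A → δ A k * g A) ≡ g (segment k)
    at k = trans
      (∑-point (subsets-unique N) (∈subsets (segment k)) (λ {A} _ A≢ →
        trans (cong (_* g A) (ι-no (A ≟V segment k) A≢)) (ℤₚ.*-zeroˡ (g A))))
      (trans (cong (_* g (segment k)) (ι-yes (segment k ≟V segment k) refl)) (ℤₚ.*-identityˡ (g (segment k))))

alt : Perm (suc N) → ℤ
alt {N} x = ∑ (subsets N) λ A → parity (size A) * F A x

alt-transitive : {x : Perm (suc N)} → Inj x → Transitive x → alt x ≡ ℤ.+ suc N
alt-transitive {N} {x} p tr = begin
  alt x                                                         ≡⟨ ∑-cong (subsets N) (λ A → ℤₚ.*-identityʳ (parity (size A) * F A x)) ⟨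
  ∑ (subsets N) (λ A → parity (size A) * F A x * 1ℤ)            ≡⟨ Cycle.cycle-sum p tr (λ _ → 1ℤ) ⟩
  ∑ (upTo (suc N)) (λ _ → 1ℤ)                                   ≡⟨ length-∑ (upTo (suc N)) ⟨
  ℤ.+ length (upTo (suc N))                                     ≡⟨ cong ℤ.+_ (Listₚ.length-upTo (suc N)) ⟩
  ℤ.+ suc N                                                     ∎
  where open ≡-Reasoning

∅ : Vec Bool N
∅ {N} = Vec.replicate N false

nonempty : (A : Vec Bool N) → A ≢ ∅ → ∃ λ a → lookup A a ≡ true
nonempty []          A≢ = ⊥-elim (A≢ refl)
nonempty (true ∷ A)  A≢ = zero , refl
nonempty (false ∷ A) A≢ with nonempty A (A≢ ∘ cong (false ∷_))
... | a , e = suc a , e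

size-∅ : ∀ N → size (∅ {N}) ≡ 0
size-∅ zero    = refl
size-∅ (suc N) = size-∅ N

F-∅ : (x : Perm (suc N)) → F ∅ x ≡ 1ℤ
F-∅ {N} x = trans (F-value {A = ∅} {c = idP} Inj-id (mk-agrees
  (λ {i} e → ⊥-elim (true≢false e (Vecₚ.lookup-replicate i false))) (λ {i} _ → lookup-id (suc i)))) sgn-id

-- The transposition of zero and `suc a` satisfies `Col` and has sign -1, so the sum equals its own
-- negative.
∑F-nonempty : (A : Vec Bool N) {a : Fin N} → lookup A a ≡ true → ∑ (S (suc N)) (F A) ≡ 0ℤ
∑F-nonempty {N} A {a} a∈ = neg-fixed⇒zero (∑ Sₙ (F A)) (begin
  ∑ Sₙ (F A)                            ≡⟨ ∑-translateˡ t-inj (F A) ⟨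
  ∑ Sₙ (λ x → F A (t ⊙ x))              ≡⟨ ∑-cong∈ Sₙ (λ {x} x∈ → trans (F-col A t-inj (∈S⇒Inj x∈) t-col)
                                             (cong (_* F A x) (sgn-swap (λ ())))) ⟩
  ∑ Sₙ (λ x → -1ℤ * F A x)              ≡⟨ ∑-*ˡ Sₙ -1ℤ (F A) ⟩
  -1ℤ * ∑ Sₙ (F A)                      ∎)
  where
  open ≡-Reasoning
  Sₙ = S (suc N)
  t : Perm (suc N)
  t = swap zero (suc a)
  t-inj : Inj t
  t-inj = Inj-swap zero (suc a)
  t-col : Col t A
  t-col i i∉ = swap-o zero (suc a) (λ ()) (λ e → true≢false a∈ (trans (cong (lookup A) (sym (Finₚ.suc-injective e))) i∉))

-- Only the empty set contributes. As `alt` is n on full cycles and 0 elsewhere, this total of n!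
-- counts the full cycles in `n·∣cycles∣`.
∑-alt : ∀ N → ∑ (S (suc N)) alt ≡ ℤ.+ length (S (suc N))
∑-alt N = begin
  ∑ Sₙ alt                                                          ≡⟨ ∑-swap Sₙ (subsets N) (λ x A → parity (size A) * F A x) ⟩
  ∑ (subsets N) (λ A → ∑ Sₙ (λ x → parity (size A) * F A x))        ≡⟨ ∑-cong (subsets N) (λ A → ∑-*ˡ Sₙ (parity (size A)) (F A)) ⟩
  ∑ (subsets N) (λ A → parity (size A) * ∑ Sₙ (F A))
    ≡⟨ ∑-point (subsets-unique N) (∈subsets ∅) (λ {A} _ A≢ →
         trans (cong (parity (size A) *_) (∑F-nonempty A (proj₂ (nonempty A A≢)))) (ℤₚ.*-zeroʳ (parity (size A)))) ⟩
  parity (size ∅′) * ∑ Sₙ (F ∅′)                                    ≡⟨ cong₂ (λ k s → parity k * s) (size-∅ N) (∑-cong Sₙ F-∅) ⟩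
  1ℤ * ∑ Sₙ (λ _ → 1ℤ)                                              ≡⟨ ℤₚ.*-identityˡ (∑ Sₙ (λ _ → 1ℤ)) ⟩
  ∑ Sₙ (λ _ → 1ℤ)                                                   ≡⟨ length-∑ Sₙ ⟨
  ℤ.+ length Sₙ                                                     ∎
  where
  open ≡-Reasoning
  Sₙ = S (suc N)
  ∅′ : Vec Bool N
  ∅′ = ∅

-- Cycle types

-- The local function of orbitLen has no name outside Defs. Abstracting suc m and 2 in the unfolding of
-- orbitLen makes all its arguments distinct variables, so unification finds it.
mutual
  orbitGo : Perm n → Fin n → ℕ → ℕ → ℕ
  orbitGo = _

  orbitGo-solution : ∀ m (σ : Perm (suc m)) (i : Fin (suc m)) → orbitLen σ i ≡ orbitLen σ i
  orbitGo-solution m σ i with suc m | 2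
  ... | n | k = refl {x = if iter σ 1 i ==F i then 1 else orbitGo {n} σ i m k}

record IsPeriod (σ : Perm n) (i : Fin n) (d : ℕ) : Set where
  constructor mkPeriod
  field
    nonzero  : 1 ℕ.≤ d
    closes   : iter σ d i ≡ i
    least    : ∀ {e} → 1 ℕ.≤ e → e ℕ.< d → iter σ e i ≢ i
open IsPeriod

IsPeriod-≤ : {σ : Perm n} {i : Fin n} {d e : ℕ} → IsPeriod σ i d → 1 ℕ.≤ e → iter σ e i ≡ i → d ℕ.≤ e
IsPeriod-≤ h 1≤e c = ℕₚ.≮⇒≥ λ e<d → least h 1≤e e<d c

-- `d` is some return time, known to be reached before the fuel `f` runs out. The last hypothesis is
-- the invariant of the search.
orbitGo-period : (σ : Perm n) (i : Fin n) (d : ℕ) → 1 ℕ.≤ d → iter σ d i ≡ i → ∀ f k → 1 ℕ.≤ k → d ℕ.< k ℕ.+ f →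
                 (∀ {e} → 1 ℕ.≤ e → e ℕ.< k → iter σ e i ≢ i) → IsPeriod σ i (orbitGo σ i f k)
orbitGo-period σ i d 1≤d c zero    k 1≤k d< none = ⊥-elim (none 1≤d (subst (d ℕ.<_) (ℕₚ.+-identityʳ k) d<) c)
orbitGo-period σ i d 1≤d c (suc f) k 1≤k d< none with iter σ k i ≟ i
... | yes e = mkPeriod 1≤k e none
... | no ¬e = orbitGo-period σ i d 1≤d c f (suc k) (ℕ.s≤s ℕ.z≤n) (subst (d ℕ.<_) (ℕₚ.+-suc k f) d<)
                (λ 1≤e e< → [ none 1≤e , (λ { refl → ¬e }) ]′ (ℕₚ.m≤n⇒m<n∨m≡n (ℕ.s≤s⁻¹ e<)))

orbitLen-period : {σ : Perm n} → Inj σ → ∀ i → IsPeriod σ i (orbitLen σ i)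
orbitLen-period {suc m} {σ} p i with period p i
... | d , d≤ , c = orbitGo-period σ i (suc d) (ℕ.s≤s ℕ.z≤n) c (suc m) 1 ℕₚ.≤-refl (ℕ.s≤s d≤)
                     (λ 1≤e e<1 _ → ℕₚ.<⇒≱ e<1 1≤e)

orbitLen-≤ : {σ : Perm n} → Inj σ → ∀ i → orbitLen σ i ℕ.≤ n
orbitLen-≤ p i with period p i
... | d , d≤ , c = ℕₚ.≤-trans (IsPeriod-≤ (orbitLen-period p i) (ℕ.s≤s ℕ.z≤n) c) d≤

-- Serves for conjugation, with `e` the conjugating permutation, and for the two inclusions into a
-- direct sum. Orbit lengths agree because returns to `i` and returns to `e i` happen at the same
-- times.
module Embedding {ρ : Perm n′} {σ : Perm n} (p : Inj ρ) (q : Inj σ) (e : Fin n′ → Fin n)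
                 (e-inj : ∀ {i j} → e i ≡ e j → i ≡ j) (e-step : ∀ i → lookup σ (e i) ≡ e (lookup ρ i)) where

  e-iter : ∀ k i → iter σ k (e i) ≡ e (iter ρ k i)
  e-iter zero    i = refl
  e-iter (suc k) i = trans (cong (lookup σ) (e-iter k i)) (e-step (iter ρ k i))

  e-orbitLen : ∀ i → orbitLen σ (e i) ≡ orbitLen ρ i
  e-orbitLen i = ℕₚ.≤-antisym
    (IsPeriod-≤ (orbitLen-period q (e i)) (nonzero P′) (trans (e-iter (orbitLen ρ i) i) (cong e (closes P′))))
    (IsPeriod-≤ P′ (nonzero Q′) (e-inj (trans (sym (e-iter (orbitLen σ (e i)) i)) (closes Q′))))
    where
    P′ : IsPeriod ρ i (orbitLen ρ i)
    P′ = orbitLen-period p i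
    Q′ : IsPeriod σ (e i) (orbitLen σ (e i))
    Q′ = orbitLen-period q (e i)

  e-orb : ∀ {i j} → Orb ρ i j → Orb σ (e i) (e j)
  e-orb {i} (orb k r) = orb k (trans (e-iter k i) (cong e r))

  e-orb⁻ : ∀ {i j} → Orb σ (e i) (e j) → Orb ρ i j
  e-orb⁻ {i} (orb k r) = orb k (e-inj (trans (sym (e-iter k i)) r))

record Least (σ : Perm n) (i : Fin n) : Set where
  constructor mkLeast
  field below : ∀ {j} → Orb σ i j → toℕ i ℕ.≤ toℕ j
open Least

-- The test inspects finitely many iterates, but by `orb-bounded` these already exhaust the orbit.
isCycleMin⇒Least : {σ : Perm n} → Inj σ → ∀ {i} → isCycleMin σ i ≡ true → Least σ i
isCycleMin⇒Least {n} {σ} p {i} t .below o with orb-bounded p o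
... | k , refl = ℕₚ.≤ᵇ⇒≤ (toℕ i) _ (All.lookup (Allₚ.all⁺ (λ k → toℕ i ℕ.≤ᵇ toℕ (iter σ k i)) (upTo (suc n)) (≡⇒T t))
                    (∈ₚ.∈-upTo⁺ (ℕₚ.m≤n⇒m≤1+n (Finₚ.toℕ<n k))))

Least⇒isCycleMin : {σ : Perm n} {i : Fin n} → Least σ i → isCycleMin σ i ≡ true
Least⇒isCycleMin {n} {σ} {i} l = T⇒≡ (Allₚ.all⁻ (λ k → toℕ i ℕ.≤ᵇ toℕ (iter σ k i)) {xs = upTo (suc n)}
  (All.universal (λ k → ℕₚ.≤⇒≤ᵇ (below l (orb k refl))) (upTo (suc n))))

opaque
  minι : Perm n → Fin n → ℤ
  minι σ i = if isCycleMin σ i then 1ℤ else 0ℤ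

  minι-def : (σ : Perm n) (i : Fin n) → minι σ i ≡ (if isCycleMin σ i then 1ℤ else 0ℤ)
  minι-def σ i = refl

  minι-yes : {σ : Perm n} {i : Fin n} → Least σ i → minι σ i ≡ 1ℤ
  minι-yes {σ = σ} {i} l with isCycleMin σ i | Least⇒isCycleMin l
  ... | true | _ = refl

  minι-no : {σ : Perm n} → Inj σ → {i : Fin n} → ¬ Least σ i → minι σ i ≡ 0ℤ
  minι-no {σ = σ} p {i} ¬l with isCycleMin σ i in e
  ... | false = refl
  ... | true  = ⊥-elim (¬l (isCycleMin⇒Least p e))

least? : {σ : Perm n} → Inj σ → ∀ i → Dec (Least σ i)
least? {σ = σ} p i with bool-cases (isCycleMin σ i)
... | inj₁ t = yes (isCycleMin⇒Least p t)
... | inj₂ f = no λ l → true≢false (Least⇒isCycleMin l) f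

minι-cong : {ρ : Perm n′} {σ : Perm n} → Inj ρ → Inj σ → {i : Fin n′} {j : Fin n} →
            (Least ρ i → Least σ j) → (Least σ j → Least ρ i) → minι ρ i ≡ minι σ j
minι-cong p q {i} {j} f g with least? p i
... | yes l = trans (minι-yes l) (sym (minι-yes (f l)))
... | no ¬l = trans (minι-no p ¬l) (sym (minι-no q (¬l ∘ g)))

opaque
  cycles : Perm n → ℕ → ℤ
  cycles {n} σ k = ∑ (allFin n) λ i → minι σ i * ι (k ℕ.≟ orbitLen σ i)

  cycles-∑ : (σ : Perm n) (k : ℕ) → cycles σ k ≡ ∑ (allFin n) λ i → minι σ i * ι (k ℕ.≟ orbitLen σ i)
  cycles-∑ σ k = refl

count-∑ : ∀ k (xs : List ℕ) → ℤ.+ count k xs ≡ ∑ xs (λ m → ι (k ℕ.≟ m))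
count-∑ k xs = trans (length-∑ (filterᵇ (k ℕ.≡ᵇ_) xs)) (∑-filterᵇ (k ℕ.≡ᵇ_) xs (λ _ → 1ℤ))

count-cycleType : (σ : Perm n) (k : ℕ) → ℤ.+ count k (cycleType σ) ≡ cycles σ k
count-cycleType {n} σ k = begin
  ℤ.+ count k (cycleType σ)
    ≡⟨ count-∑ k (cycleType σ) ⟩
  ∑ (cycleType σ) (λ m → ι (k ℕ.≟ m))
    ≡⟨ ∑-concatMap (λ i → if isCycleMin σ i then [ orbitLen σ i ] else []) (allFin n) (λ m → ι (k ℕ.≟ m)) ⟩
  ∑ (allFin n) (λ i → ∑ (if isCycleMin σ i then [ orbitLen σ i ] else []) (λ m → ι (k ℕ.≟ m)))
    ≡⟨ ∑-cong (allFin n) (λ i → trans (choose (isCycleMin σ i) (orbitLen σ i))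
                                      (cong (_* ι (k ℕ.≟ orbitLen σ i)) (sym (minι-def σ i)))) ⟩
  ∑ (allFin n) (λ i → minι σ i * ι (k ℕ.≟ orbitLen σ i))
    ≡⟨ cycles-∑ σ k ⟨
  cycles σ k
    ∎
  where
  open ≡-Reasoning
  choose : ∀ b d → ∑ (if b then [ d ] else []) (λ m → ι (k ℕ.≟ m)) ≡ (if b then 1ℤ else 0ℤ) * ι (k ℕ.≟ d)
  choose true  d = trans (ℤₚ.+-identityʳ (ι (k ℕ.≟ d))) (sym (ℤₚ.*-identityˡ (ι (k ℕ.≟ d))))
  choose false d = refl

least-Fin : {Q : Fin n → Set} → (∀ i → Dec (Q i)) → ∀ i → Q i → ∃ λ j → Q j × (∀ k → Q k → toℕ j ℕ.≤ toℕ k)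
least-Fin {suc n} Q? i q with Q? zero
... | yes q0 = zero , q0 , λ _ _ → ℕ.z≤n
least-Fin Q? zero    q | no ¬q0 = ⊥-elim (¬q0 q)
least-Fin Q? (suc i) q | no ¬q0 with least-Fin (Q? ∘ suc) i q
... | j , qj , le = suc j , qj , λ { zero q0 → ⊥-elim (¬q0 q0) ; (suc k) qk → ℕ.s≤s (le k qk) }

one-least : {σ : Perm n} (p : Inj σ) (i : Fin n) → ∑ (allFin n) (λ j → ι (orb? p i j) * minι σ j) ≡ 1ℤ
one-least {n} {σ} p i with least-Fin (orb? p i) i orb-refl
... | j , o , le = trans
  (∑-point (Uniqueₚ.allFin⁺ n) (∈allFin j) (λ {k} _ k≢j → other k k≢j))
  (cong₂ _*_ (ι-yes (orb? p i j) o) (minι-yes (mkLeast λ o′ → le _ (orb-trans o o′))))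
  where
  other : ∀ k → k ≢ j → ι (orb? p i k) * minι σ k ≡ 0ℤ
  other k k≢j with orb? p i k
  ... | no _   = ℤₚ.*-zeroˡ (minι σ k)
  ... | yes ok = trans (ℤₚ.*-identityˡ (minι σ k)) (minι-no p λ l → k≢j (Finₚ.toℕ-injective
                   (ℕₚ.≤-antisym (below l (orb-trans (orb-sym p ok) o)) (le k ok))))

-- Both sums count orbits, each through its own choice of one point per orbit.
selector-independent : {σ : Perm n} (p : Inj σ) (s₁ s₂ w : Fin n → ℤ) →
  (∀ i → ∑ (allFin n) (λ j → ι (orb? p i j) * s₁ j) ≡ 1ℤ) → (∀ i → ∑ (allFin n) (λ j → ι (orb? p i j) * s₂ j) ≡ 1ℤ) →
  (∀ {i j} → Orb σ i j → w i ≡ w j) → ∑ (allFin n) (λ i → s₁ i * w i) ≡ ∑ (allFin n) (λ i → s₂ i * w i)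
selector-independent {n} p s₁ s₂ w h₁ h₂ w-inv = begin
  ∑ Fs (λ i → s₁ i * w i)
    ≡⟨ ∑-cong Fs (λ i → trans (cong (s₁ i * w i *_) (h₂ i)) (ℤₚ.*-identityʳ (s₁ i * w i))) ⟨
  ∑ Fs (λ i → s₁ i * w i * ∑ Fs (λ j → o i j * s₂ j))
    ≡⟨ ∑-cong Fs (λ i → ∑-*ˡ Fs (s₁ i * w i) (λ j → o i j * s₂ j)) ⟨
  ∑ Fs (λ i → ∑ Fs (λ j → s₁ i * w i * (o i j * s₂ j)))
    ≡⟨ ∑-swap Fs Fs (λ i j → s₁ i * w i * (o i j * s₂ j)) ⟩
  ∑ Fs (λ j → ∑ Fs (λ i → s₁ i * w i * (o i j * s₂ j)))
    ≡⟨ ∑-cong Fs (λ j → trans (∑-cong Fs (λ i → exchange i j)) (∑-*ˡ Fs (s₂ j * w j) (λ i → o j i * s₁ i))) ⟩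
  ∑ Fs (λ j → s₂ j * w j * ∑ Fs (λ i → o j i * s₁ i))
    ≡⟨ ∑-cong Fs (λ j → trans (cong (s₂ j * w j *_) (h₁ j)) (ℤₚ.*-identityʳ (s₂ j * w j))) ⟩
  ∑ Fs (λ j → s₂ j * w j)
    ∎
  where
  open ≡-Reasoning
  Fs = allFin n
  o : Fin n → Fin n → ℤ
  o i j = ι (orb? p i j)
  move : ∀ a b c → a * b * (1ℤ * c) ≡ c * b * (1ℤ * a)
  move = solve-∀
  zeros : ∀ a b c d → a * b * (0ℤ * c) ≡ c * d * (0ℤ * a)
  zeros = solve-∀
  exchange : ∀ i j → s₁ i * w i * (o i j * s₂ j) ≡ s₂ j * w j * (o j i * s₁ i)
  exchange i j = go (orb? p i j)
    where
    go : Dec (Orb _ i j) → s₁ i * w i * (o i j * s₂ j) ≡ s₂ j * w j * (o j i * s₁ i)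
    go (yes r) = trans (cong (λ t → s₁ i * w i * (t * s₂ j)) (ι-yes (orb? p i j) r))
      (trans (move (s₁ i) (w i) (s₂ j)) (trans (cong (λ t → s₂ j * t * (1ℤ * s₁ i)) (w-inv r))
        (cong (λ t → s₂ j * w j * (t * s₁ i)) (sym (ι-yes (orb? p j i) (orb-sym p r))))))
    go (no ¬r) = trans (cong (λ t → s₁ i * w i * (t * s₂ j)) (ι-no (orb? p i j) ¬r))
      (trans (zeros (s₁ i) (w i) (s₂ j) (w j))
        (cong (λ t → s₂ j * w j * (t * s₁ i)) (sym (ι-no (orb? p j i) (¬r ∘ orb-sym p)))))

orbitLen-orb : {σ : Perm n} → Inj σ → ∀ {i j} → Orb σ i j → orbitLen σ i ≡ orbitLen σ j
orbitLen-orb {σ = σ} p {i} {j} (orb k refl) = ℕₚ.≤-antisym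
  (IsPeriod-≤ (orbitLen-period p i) (nonzero Q′) (iter-inj p k (trans (sym (commute (orbitLen σ j))) (closes Q′))))
  (IsPeriod-≤ Q′ (nonzero P′) (trans (commute (orbitLen σ i)) (cong (iter σ k) (closes P′))))
  where
  P′ : IsPeriod σ i (orbitLen σ i)
  P′ = orbitLen-period p i
  Q′ : IsPeriod σ j (orbitLen σ j)
  Q′ = orbitLen-period p j
  commute : ∀ d → iter σ d (iter σ k i) ≡ iter σ k (iter σ d i)
  commute d = trans (sym (iter-+ σ d k i)) (trans (cong (λ t → iter σ t i) (ℕₚ.+-comm d k)) (iter-+ σ k d i))

-- Conjugation by `y` disturbs the order of the points, so least points need not go to least points.
-- Pulling the least points back along `y` still selects one point in each orbit, and by
-- `selector-independent` the count is the same.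
cycles-conj : {y σ : Perm n} → Inj y → Inj σ → ∀ k → cycles (conj y σ) k ≡ cycles σ k
cycles-conj {n} {y} {σ} p q k = begin
  cycles σ′ k
    ≡⟨ cycles-∑ σ′ k ⟩
  ∑ Fs (λ i → minι σ′ i * ι (k ℕ.≟ orbitLen σ′ i))
    ≡⟨ ∑-permute p (λ i → minι σ′ i * ι (k ℕ.≟ orbitLen σ′ i)) ⟨
  ∑ Fs (λ i → minι σ′ (lookup y i) * ι (k ℕ.≟ orbitLen σ′ (lookup y i)))
    ≡⟨ ∑-cong Fs (λ i → cong (λ d → minι σ′ (lookup y i) * ι (k ℕ.≟ d)) (E.e-orbitLen i)) ⟩
  ∑ Fs (λ i → minι σ′ (lookup y i) * ι (k ℕ.≟ orbitLen σ i))
    ≡⟨ selector-independent q (λ i → minι σ′ (lookup y i)) (minι σ) (λ i → ι (k ℕ.≟ orbitLen σ i)) pulled (one-least q)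
         (λ o → cong (λ d → ι (k ℕ.≟ d)) (orbitLen-orb q o)) ⟩
  ∑ Fs (λ i → minι σ i * ι (k ℕ.≟ orbitLen σ i))
    ≡⟨ cycles-∑ σ k ⟨
  cycles σ k
    ∎
  where
  open ≡-Reasoning
  Fs = allFin n
  σ′ : Perm n
  σ′ = conj y σ
  q′ : Inj σ′
  q′ = Inj-conj p q
  module E = Embedding {ρ = σ} {σ = σ′} q q′ (lookup y) (inj p) (lookup-conj p)
  pulled : ∀ i → ∑ Fs (λ j → ι (orb? q i j) * minι σ′ (lookup y j)) ≡ 1ℤ
  pulled i = begin
    ∑ Fs (λ j → ι (orb? q i j) * minι σ′ (lookup y j))
      ≡⟨ ∑-cong Fs (λ j → cong (_* minι σ′ (lookup y j)) (ι-cong (orb? q i j) (orb? q′ (lookup y i) (lookup y j)) E.e-orb E.e-orb⁻)) ⟩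
    ∑ Fs (λ j → ι (orb? q′ (lookup y i) (lookup y j)) * minι σ′ (lookup y j))
      ≡⟨ ∑-permute p (λ j → ι (orb? q′ (lookup y i) j) * minι σ′ j) ⟩
    ∑ Fs (λ j → ι (orb? q′ (lookup y i) j) * minι σ′ j)
      ≡⟨ one-least q′ (lookup y i) ⟩
    1ℤ
      ∎

-- A fixed point is the least point of its orbit, and that orbit has length 1.
fixpts-≤ : {σ : Perm n} → Inj σ → fixpts σ ℤ.≤ cycles σ 1
fixpts-≤ {n} {σ} p = subst (fixpts σ ℤ.≤_) (sym (cycles-∑ σ 1)) (∑-mono∈ (allFin n) λ {i} _ → go i (lookup σ i ≟ i))
  where
  go : ∀ i → Dec (lookup σ i ≡ i) → isFixed σ i ℤ.≤ minι σ i * ι (1 ℕ.≟ orbitLen σ i)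
  go i (yes e) = ℤₚ.≤-reflexive (trans (isFixed-yes σ i e) (sym (cong₂ _*_ (minι-yes least-i) (ι-yes (1 ℕ.≟ orbitLen σ i) len))))
    where
    stays-put : ∀ k → iter σ k i ≡ i
    stays-put zero    = refl
    stays-put (suc k) = trans (cong (lookup σ) (stays-put k)) e
    least-i : Least σ i
    least-i = mkLeast λ { (orb k r) → ℕₚ.≤-reflexive (cong toℕ (trans (sym (stays-put k)) r)) }
    len : 1 ≡ orbitLen σ i
    len = ℕₚ.≤-antisym (nonzero (orbitLen-period p i)) (IsPeriod-≤ (orbitLen-period p i) ℕₚ.≤-refl e)
  go i (no ¬e) = subst (ℤ._≤ minι σ i * ι (1 ℕ.≟ orbitLen σ i)) (sym (isFixed-no σ i ¬e))
    (nonneg-* (minι σ i) (ι (1 ℕ.≟ orbitLen σ i)) minι≥0 (ι-nonneg (1 ℕ.≟ orbitLen σ i)))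
    where
    minι≥0 : 0ℤ ℤ.≤ minι σ i
    minι≥0 with least? p i
    ... | yes l = subst (0ℤ ℤ.≤_) (sym (minι-yes l)) (ℤ.+≤+ ℕ.z≤n)
    ... | no ¬l = ℤₚ.≤-reflexive (sym (minι-no p ¬l))

sameMultiset⇒ : ∀ {n xs ys} → T (sameMultiset n xs ys) → ∀ {k} → k ℕ.≤ n → count k xs ≡ count k ys
sameMultiset⇒ {n} {xs} {ys} t {k} k≤ = ℕₚ.≡ᵇ⇒≡ (count k xs) (count k ys)
  (All.lookup (Allₚ.all⁺ (λ k → count k xs ℕ.≡ᵇ count k ys) (upTo (suc n)) t) (∈ₚ.∈-upTo⁺ (ℕ.s≤s k≤)))

⇒sameMultiset : ∀ {n xs ys} → (∀ {k} → k ℕ.≤ n → count k xs ≡ count k ys) → T (sameMultiset n xs ys)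
⇒sameMultiset {n} {xs} {ys} h = Allₚ.all⁻ (λ k → count k xs ℕ.≡ᵇ count k ys) {xs = upTo (suc n)}
  (All.tabulate λ {k} k∈ → ℕₚ.≡⇒≡ᵇ (count k xs) (count k ys) (h (ℕ.s≤s⁻¹ (∈ₚ.∈-upTo⁻ k∈))))

∈C⇒ : (l : List ℕ) {σ : Perm n} → σ ∈ C n l → Inj σ × (∀ {k} → k ℕ.≤ n → cycles σ k ≡ ℤ.+ count k l)
∈C⇒ {n} l {σ} σ∈ with ∈ₚ.∈-filter⁻ _ {xs = S n} σ∈
... | σ∈S , t = ∈S⇒Inj σ∈S , λ {k} k≤ → trans (sym (count-cycleType σ k)) (cong ℤ.+_ (sameMultiset⇒ {n} {cycleType σ} {l} t k≤))

⇒∈C : (l : List ℕ) {σ : Perm n} → Inj σ → (∀ {k} → k ℕ.≤ n → cycles σ k ≡ ℤ.+ count k l) → σ ∈ C n l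
⇒∈C {n} l {σ} p h = ∈ₚ.∈-filter⁺ _ (Inj⇒∈S p) (⇒sameMultiset {n} {cycleType σ} {l} λ {k} k≤ →
  ℤₚ.+-injective (trans (count-cycleType σ k) (h k≤)))

C-conj : (l : List ℕ) {y σ : Perm n} → Inj y → σ ∈ C n l → conj y σ ∈ C n l
C-conj l p σ∈ with ∈C⇒ l σ∈
... | q , h = ⇒∈C l (Inj-conj p q) λ {k} k≤ → trans (cycles-conj p q k) (h k≤)

-- If zero returns to itself after some number of steps, reducing step counts modulo that number
-- embeds all n points into the residues.
transitive-orbitLen : {x : Perm (suc N)} → Inj x → Transitive x → orbitLen x zero ≡ suc N
transitive-orbitLen {N} {x} p tr = ℕₚ.≤-antisym (orbitLen-≤ p zero) (bound (orbitLen x zero) (orbitLen-period p zero))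
  where
  bound : ∀ d → IsPeriod x zero d → suc N ℕ.≤ d
  bound (suc d) h = Finₚ.injective⇒≤ {f = f} f-inj
    where
    f : Fin (suc N) → Fin (suc d)
    f j = Fin.fromℕ< (ℕD.m%n<n (steps (covers tr j)) (suc d))
    f-spec : ∀ j → iter x (toℕ (f j)) zero ≡ j
    f-spec j = trans (cong (λ k → iter x k zero) (Finₚ.toℕ-fromℕ< (ℕD.m%n<n (steps (covers tr j)) (suc d))))
                     (trans (sym (iter-% x d (closes h) (steps (covers tr j)))) (reach (covers tr j)))
    f-inj : ∀ {i j} → f i ≡ f j → i ≡ j
    f-inj {i} {j} e = trans (sym (f-spec i)) (trans (cong (λ k → iter x (toℕ k) zero) e) (f-spec j))

transitive-cycles : {x : Perm (suc N)} → Inj x → Transitive x → ∀ k → cycles x k ≡ ℤ.+ count k [ suc N ]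
transitive-cycles {N} {x} p tr k = begin
  cycles x k                                                             ≡⟨ cycles-∑ x k ⟩
  ∑ (allFin (suc N)) (λ i → minι x i * ι (k ℕ.≟ orbitLen x i))           ≡⟨ ∑-point (Uniqueₚ.allFin⁺ (suc N)) (∈allFin zero) other ⟩
  minι x zero * ι (k ℕ.≟ orbitLen x zero)                                ≡⟨ cong₂ (λ a d → a * ι (k ℕ.≟ d)) (minι-yes zero-least) (transitive-orbitLen p tr) ⟩
  1ℤ * ι (k ℕ.≟ suc N)                                                   ≡⟨ ℤₚ.*-identityˡ (ι (k ℕ.≟ suc N)) ⟩
  ι (k ℕ.≟ suc N)                                                        ≡⟨ ℤₚ.+-identityʳ (ι (k ℕ.≟ suc N)) ⟨
  ι (k ℕ.≟ suc N) + 0ℤ                                                   ≡⟨ count-∑ k [ suc N ] ⟨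
  ℤ.+ count k [ suc N ]                                                  ∎
  where
  open ≡-Reasoning
  zero-least : Least x zero
  zero-least = mkLeast λ _ → ℕ.z≤n
  other : ∀ {i} → i ∈ allFin (suc N) → i ≢ zero → minι x i * ι (k ℕ.≟ orbitLen x i) ≡ 0ℤ
  other {i} _ i≢0 = trans (cong (_* ι (k ℕ.≟ orbitLen x i)) (minι-no p λ l →
    i≢0 (Finₚ.toℕ-injective (ℕₚ.n≤0⇒n≡0 (below l (orb-sym p (covers tr i))))))) (ℤₚ.*-zeroˡ (ι (k ℕ.≟ orbitLen x i)))

transitive⇒∈C : {x : Perm (suc N)} → Inj x → Transitive x → x ∈ C (suc N) [ suc N ]
transitive⇒∈C {N} p tr = ⇒∈C [ suc N ] p λ {k} _ → transitive-cycles p tr k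

∑-nonzero : {A : Set} {f : A → ℤ} (xs : List A) → ∑ xs f ≢ 0ℤ → ∃ λ x → f x ≢ 0ℤ
∑-nonzero []       h = ⊥-elim (h refl)
∑-nonzero {f = f} (x ∷ xs) h with f x ℤ.≟ 0ℤ
... | no fx≢0  = x , fx≢0
... | yes fx≡0 = ∑-nonzero xs λ e → h (trans (cong (_+ ∑ xs f) fx≡0) (trans (ℤₚ.+-identityˡ (∑ xs f)) e))

full-period : {x : Perm (suc N)} → Inj x → {i : Fin (suc N)} → IsPeriod x i (suc N) → ∀ j → Orb x i j
full-period {N} {x} p {i} h j = orb (toℕ (proj₁ onto)) (proj₂ onto)
  where
  no-return : ∀ {a b} → a ℕ.< b → b ℕ.< suc N → iter x a i ≢ iter x b i
  no-return {a} {b} a<b b< e = least h (ℕₚ.m<n⇒0<n∸m a<b) (ℕₚ.≤-<-trans (ℕₚ.m∸n≤m b a) b<)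
    (iter-inj p a (trans (sym (iter-+ x a (b ℕ.∸ a) i)) (trans (cong (λ k → iter x k i) (ℕₚ.m+[n∸m]≡n (ℕₚ.<⇒≤ a<b))) (sym e))))
  f-inj : ∀ {a b : Fin (suc N)} → iter x (toℕ a) i ≡ iter x (toℕ b) i → a ≡ b
  f-inj {a} {b} e with Finₚ.<-cmp a b
  ... | tri< a<b _ _ = ⊥-elim (no-return a<b (Finₚ.toℕ<n b) e)
  ... | tri≈ _ a≡b _ = a≡b
  ... | tri> _ _ b<a = ⊥-elim (no-return b<a (Finₚ.toℕ<n a) (sym e))
  onto : ∃ λ (a : Fin (suc N)) → iter x (toℕ a) i ≡ j
  onto = injective⇒surjective (λ a → iter x (toℕ a) i) f-inj j

-- There is one cycle of length n, so some point `i` has an orbit of length n, which is everything.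
-- Zero is then connected to any point through `i`.
∈C⇒transitive : {x : Perm (suc N)} → x ∈ C (suc N) [ suc N ] → Transitive x
∈C⇒transitive {N} {x} x∈ = mkTransitive λ j →
  orb-trans (orb-sym p (full-period p h zero)) (full-period p h j)
  where
  spec : Inj x × (∀ {k} → k ℕ.≤ suc N → cycles x k ≡ ℤ.+ count k [ suc N ])
  spec = ∈C⇒ [ suc N ] x∈
  p : Inj x
  p = proj₁ spec
  f : Fin (suc N) → ℤ
  f i = minι x i * ι (suc N ℕ.≟ orbitLen x i)
  one : ∑ (allFin (suc N)) f ≡ 1ℤ
  one = begin
    ∑ (allFin (suc N)) f                 ≡⟨ cycles-∑ x (suc N) ⟨
    cycles x (suc N)                     ≡⟨ proj₂ spec ℕₚ.≤-refl ⟩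
    ℤ.+ count (suc N) [ suc N ]          ≡⟨ count-∑ (suc N) [ suc N ] ⟩
    ι (suc N ℕ.≟ suc N) + 0ℤ             ≡⟨ ℤₚ.+-identityʳ (ι (suc N ℕ.≟ suc N)) ⟩
    ι (suc N ℕ.≟ suc N)                  ≡⟨ ι-yes (suc N ℕ.≟ suc N) refl ⟩
    1ℤ                                   ∎
    where open ≡-Reasoning
  1≢0 : 1ℤ ≢ 0ℤ
  1≢0 ()
  W : ∃ λ i → f i ≢ 0ℤ
  W = ∑-nonzero {f = f} (allFin (suc N)) (λ e → 1≢0 (trans (sym one) e))
  i : Fin (suc N)
  i = proj₁ W
  recover : (d : Dec (suc N ≡ orbitLen x i)) → minι x i * ι d ≢ 0ℤ → suc N ≡ orbitLen x i
  recover (yes e) _  = e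
  recover (no ¬e) ne = ⊥-elim (ne (ℤₚ.*-zeroʳ (minι x i)))
  len : suc N ≡ orbitLen x i
  len = recover (suc N ℕ.≟ orbitLen x i) (proj₂ W)
  h : IsPeriod x i (suc N)
  h = subst (IsPeriod x i) (sym len) (orbitLen-period p i)

-- `alt` is n times the indicator of the full cycles. Through this exchange the class of n-cycles
-- enters the calculus of the `F A`.
∑-full-cycles : ∀ N (f : Perm (suc N) → ℤ) →
                ∑ (C (suc N) [ suc N ]) (λ x → ℤ.+ suc N * f x) ≡ ∑ (S (suc N)) (λ x → alt x * f x)
∑-full-cycles N f = trans (∑-filterᵇ test Sₙ (λ x → nn * f x)) (∑-cong∈ Sₙ (λ {x} x∈ → go x x∈))
  where
  Sₙ = S (suc N)
  nn : ℤ
  nn = ℤ.+ suc N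
  test : Perm (suc N) → Bool
  test σ = sameMultiset (suc N) (cycleType σ) [ suc N ]
  go : ∀ x → x ∈ Sₙ → (if test x then nn * f x else 0ℤ) ≡ alt x * f x
  go x x∈ with bool-cases (test x)
  ... | inj₁ t = trans (cong (λ b → if b then nn * f x else 0ℤ) t)
                   (cong (_* f x) (sym (alt-transitive (∈S⇒Inj x∈) (∈C⇒transitive (∈ₚ.∈-filter⁺ _ x∈ (≡⇒T t))))))
  ... | inj₂ e = trans (cong (λ b → if b then nn * f x else 0ℤ) e)
                   (sym (trans (cong (_* f x) (alt-intransitive (∈S⇒Inj x∈) intr)) (ℤₚ.*-zeroˡ (f x))))
    where
    intr : ∃ λ j → ¬ Orb x zero j
    intr with transitive? (∈S⇒Inj x∈)
    ... | inj₂ r  = r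
    ... | inj₁ tr = ⊥-elim (true≢false (T⇒≡ (proj₂ (∈ₚ.∈-filter⁻ _ {xs = Sₙ} (transitive⇒∈C (∈S⇒Inj x∈) tr)))) e)

n·∣cycles∣ : ∀ N → ℤ.+ suc N * ℤ.+ length (C (suc N) [ suc N ]) ≡ ℤ.+ length (S (suc N))
n·∣cycles∣ N = begin
  nn * ℤ.+ length (C (suc N) [ suc N ])              ≡⟨ ℤₚ.*-comm nn (ℤ.+ length (C (suc N) [ suc N ])) ⟩
  ℤ.+ length (C (suc N) [ suc N ]) * nn              ≡⟨ ∑-const (C (suc N) [ suc N ]) nn ⟨
  ∑ (C (suc N) [ suc N ]) (λ _ → nn)                 ≡⟨ ∑-cong (C (suc N) [ suc N ]) (λ _ → ℤₚ.*-identityʳ nn) ⟨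
  ∑ (C (suc N) [ suc N ]) (λ _ → nn * 1ℤ)            ≡⟨ ∑-full-cycles N (λ _ → 1ℤ) ⟩
  ∑ (S (suc N)) (λ x → alt x * 1ℤ)                   ≡⟨ ∑-cong (S (suc N)) (λ x → ℤₚ.*-identityʳ (alt x)) ⟩
  ∑ (S (suc N)) alt                                  ≡⟨ ∑-alt N ⟩
  ℤ.+ length (S (suc N))                             ∎
  where
  open ≡-Reasoning
  nn : ℤ
  nn = ℤ.+ suc N

-- Existence by counting: an empty class would force n! to be 0.
full-cycle : ∀ N → ∃ λ (x : Perm (suc N)) → x ∈ C (suc N) [ suc N ]
full-cycle N = nonempty-list (C (suc N) [ suc N ]) refl
  where
  nonempty-list : (xs : List (Perm (suc N))) → xs ≡ C (suc N) [ suc N ] → ∃ λ x → x ∈ xs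
  nonempty-list (x ∷ xs) _ = x , here refl
  nonempty-list []       e = ⊥-elim (absurd (S (suc N)) (Inj⇒∈S Inj-id)
    (ℤₚ.+-injective (trans (sym (n·∣cycles∣ N)) (trans (cong (λ l → ℤ.+ suc N * ℤ.+ length l) (sym e)) (ℤₚ.*-zeroʳ (ℤ.+ suc N))))))
    where
    absurd : (ys : List (Perm (suc N))) → idP ∈ ys → length ys ≢ 0
    absurd (y ∷ ys) _ ()

-- Direct sums and the existence of every cycle type

module _ (ρ : Perm n′) (τ : Perm n) where

  private
    side : Fin n′ ⊎ Fin n → Fin (n′ ℕ.+ n)
    side (inj₁ i) = lookup ρ i Fin.↑ˡ n
    side (inj₂ j) = n′ Fin.↑ʳ lookup τ j

  _⊕_ : Perm (n′ ℕ.+ n)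
  _⊕_ = tabulate (side ∘ Fin.splitAt n′)

  lookup-⊕ˡ : ∀ i → lookup _⊕_ (i Fin.↑ˡ n) ≡ lookup ρ i Fin.↑ˡ n
  lookup-⊕ˡ i = trans (Vecₚ.lookup∘tabulate (side ∘ Fin.splitAt n′) (i Fin.↑ˡ n)) (cong side (Finₚ.splitAt-↑ˡ n′ i n))

  lookup-⊕ʳ : ∀ j → lookup _⊕_ (n′ Fin.↑ʳ j) ≡ n′ Fin.↑ʳ lookup τ j
  lookup-⊕ʳ j = trans (Vecₚ.lookup∘tabulate (side ∘ Fin.splitAt n′) (n′ Fin.↑ʳ j)) (cong side (Finₚ.splitAt-↑ʳ n′ n j))

  ⊕-view : (k : Fin (n′ ℕ.+ n)) → (∃ λ i → k ≡ i Fin.↑ˡ n) ⊎ (∃ λ j → k ≡ n′ Fin.↑ʳ j)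
  ⊕-view k with Fin.splitAt n′ k in e
  ... | inj₁ i = inj₁ (i , sym (Finₚ.splitAt⁻¹-↑ˡ e))
  ... | inj₂ j = inj₂ (j , sym (Finₚ.splitAt⁻¹-↑ʳ e))

  ⊕-apart : ∀ {i j} → i Fin.↑ˡ n ≢ n′ Fin.↑ʳ j
  ⊕-apart {i} {j} e with trans (sym (Finₚ.splitAt-↑ˡ n′ i n)) (trans (cong (Fin.splitAt n′) e) (Finₚ.splitAt-↑ʳ n′ n j))
  ... | ()

  Inj-⊕ : Inj ρ → Inj τ → Inj _⊕_
  Inj-⊕ p q .inj {a} {b} e with ⊕-view a | ⊕-view b
  ... | inj₁ (i , refl) | inj₁ (j , refl) =
    cong (Fin._↑ˡ n) (inj p (Finₚ.↑ˡ-injective n _ _ (trans (sym (lookup-⊕ˡ i)) (trans e (lookup-⊕ˡ j)))))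
  ... | inj₂ (i , refl) | inj₂ (j , refl) =
    cong (n′ Fin.↑ʳ_) (inj q (Finₚ.↑ʳ-injective n′ _ _ (trans (sym (lookup-⊕ʳ i)) (trans e (lookup-⊕ʳ j)))))
  ... | inj₁ (i , refl) | inj₂ (j , refl) = ⊥-elim (⊕-apart (trans (sym (lookup-⊕ˡ i)) (trans e (lookup-⊕ʳ j))))
  ... | inj₂ (j , refl) | inj₁ (i , refl) = ⊥-elim (⊕-apart (trans (sym (lookup-⊕ˡ i)) (trans (sym e) (lookup-⊕ʳ j))))

∑-Fin-+ : ∀ m {n} (f : Fin (m ℕ.+ n) → ℤ) →
          ∑ (allFin (m ℕ.+ n)) f ≡ ∑ (allFin m) (λ i → f (i Fin.↑ˡ n)) + ∑ (allFin n) (λ j → f (m Fin.↑ʳ j))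
∑-Fin-+ zero    {n} f = sym (ℤₚ.+-identityˡ (∑ (allFin n) f))
∑-Fin-+ (suc m) {n} f = begin
  ∑ (allFin (suc m ℕ.+ n)) f
    ≡⟨ ∑-Fin-suc f ⟩
  f zero + ∑ (allFin (m ℕ.+ n)) (f ∘ suc)
    ≡⟨ cong (λ t → f zero + t) (∑-Fin-+ m (f ∘ suc)) ⟩
  f zero + (a + b)
    ≡⟨ ℤₚ.+-assoc (f zero) a b ⟨
  f zero + a + b
    ≡⟨ cong (_+ b) (∑-Fin-suc (λ i → f (i Fin.↑ˡ n))) ⟨
  ∑ (allFin (suc m)) (λ i → f (i Fin.↑ˡ n)) + b
    ∎
  where
  open ≡-Reasoning
  a b : ℤ
  a = ∑ (allFin m) (λ i → f (suc (i Fin.↑ˡ n)))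
  b = ∑ (allFin n) (λ j → f (suc m Fin.↑ʳ j))

-- Both inclusions preserve the order of the points, so least points correspond to least points and
-- the sums match term by term.
cycles-⊕ : {ρ : Perm n′} {τ : Perm n} → Inj ρ → Inj τ → ∀ k → cycles (ρ ⊕ τ) k ≡ cycles ρ k + cycles τ k
cycles-⊕ {m} {n} {ρ} {τ} p q k = begin
  cycles σ k
    ≡⟨ cycles-∑ σ k ⟩
  ∑ (allFin (m ℕ.+ n)) f
    ≡⟨ ∑-Fin-+ m f ⟩
  ∑ (allFin m) (λ i → f (i Fin.↑ˡ n)) + ∑ (allFin n) (λ j → f (m Fin.↑ʳ j))
    ≡⟨ cong₂ _+_
         (∑-cong (allFin m) (λ i → cong₂ (λ a d → a * ι (k ℕ.≟ d)) (minˡ i) (L.e-orbitLen i)))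
         (∑-cong (allFin n) (λ j → cong₂ (λ a d → a * ι (k ℕ.≟ d)) (minʳ j) (R′.e-orbitLen j))) ⟩
  ∑ (allFin m) (λ i → minι ρ i * ι (k ℕ.≟ orbitLen ρ i)) + ∑ (allFin n) (λ j → minι τ j * ι (k ℕ.≟ orbitLen τ j))
    ≡⟨ cong₂ _+_ (cycles-∑ ρ k) (cycles-∑ τ k) ⟨
  cycles ρ k + cycles τ k
    ∎
  where
  open ≡-Reasoning
  σ : Perm (m ℕ.+ n)
  σ = ρ ⊕ τ
  r : Inj σ
  r = Inj-⊕ ρ τ p q
  f : Fin (m ℕ.+ n) → ℤ
  f i = minι σ i * ι (k ℕ.≟ orbitLen σ i)
  module L = Embedding {ρ = ρ} {σ = σ} p r (Fin._↑ˡ n) (Finₚ.↑ˡ-injective n _ _) (lookup-⊕ˡ ρ τ)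
  module R′ = Embedding {ρ = τ} {σ = σ} q r (m Fin.↑ʳ_) (Finₚ.↑ʳ-injective m _ _) (lookup-⊕ʳ ρ τ)
  minˡ : ∀ i → minι σ (i Fin.↑ˡ n) ≡ minι ρ i
  minˡ i = minι-cong r p
    (λ l → mkLeast λ {j} o → subst₂ ℕ._≤_ (Finₚ.toℕ-↑ˡ i n) (Finₚ.toℕ-↑ˡ j n) (below l (L.e-orb o)))
    (λ l → mkLeast λ { (orb s refl) → subst₂ ℕ._≤_ (sym (Finₚ.toℕ-↑ˡ i n))
        (trans (sym (Finₚ.toℕ-↑ˡ (iter ρ s i) n)) (cong toℕ (sym (L.e-iter s i)))) (below l (orb s refl)) })
  minʳ : ∀ j → minι σ (m Fin.↑ʳ j) ≡ minι τ j
  minʳ j = minι-cong r q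
    (λ l → mkLeast λ {i} o → ℕₚ.+-cancelˡ-≤ m (toℕ j) (toℕ i)
        (subst₂ ℕ._≤_ (Finₚ.toℕ-↑ʳ m j) (Finₚ.toℕ-↑ʳ m i) (below l (R′.e-orb o))))
    (λ l → mkLeast λ { (orb s refl) → subst₂ ℕ._≤_ (sym (Finₚ.toℕ-↑ʳ m j))
        (trans (sym (Finₚ.toℕ-↑ʳ m (iter τ s j))) (cong toℕ (sym (R′.e-iter s j))))
        (ℕₚ.+-monoʳ-≤ m (below l (orb s refl))) })

-- One full cycle for each part, glued by direct sums.
realise : (l : List ℕ) → All (λ k → 1 ℕ.≤ k) l →
          ∃ λ (σ : Perm (sum l)) → Inj σ × (∀ k → cycles σ k ≡ ℤ.+ count k l)
realise []          All.[] = [] , mkInj (λ { {()} }) , λ k → trans (cycles-∑ [] k) (sym (count-∑ k []))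
realise (suc a ∷ l) (_ All.∷ pos) with realise l pos | full-cycle a
... | τ , q , h | ρ , ρ∈ = ρ ⊕ τ , Inj-⊕ ρ τ p q , λ k → begin
    cycles (ρ ⊕ τ) k                                             ≡⟨ cycles-⊕ p q k ⟩
    cycles ρ k + cycles τ k                                      ≡⟨ cong₂ _+_ (transitive-cycles p (∈C⇒transitive ρ∈) k) (h k) ⟩
    ℤ.+ count k [ suc a ] + ℤ.+ count k l                        ≡⟨ cong₂ _+_ (trans (count-∑ k [ suc a ]) (ℤₚ.+-identityʳ (ι (k ℕ.≟ suc a)))) (count-∑ k l) ⟩
    ι (k ℕ.≟ suc a) + ∑ l (λ d → ι (k ℕ.≟ d))                    ≡⟨ count-∑ k (suc a ∷ l) ⟨
    ℤ.+ count k (suc a ∷ l)                                      ∎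
  where
  open ≡-Reasoning
  p : Inj ρ
  p = proj₁ (∈C⇒ [ suc a ] ρ∈)

-- Ensures that the denominator of `P` is positive.
C-nonempty : ∀ {n l} → IsPartition n l → ∃ λ σ → σ ∈ C n l
C-nonempty {n} {l} part with IsPartition.total part
... | refl with realise l (IsPartition.positive part)
...   | σ , p , h = σ , ⇒∈C l p (λ {k} _ → h k)

-- The second moment

C-unique : ∀ n l → Unique (C n l)
C-unique n l = Uniqueₚ.filter⁺ _ (S-unique n)

∈C⇒Inj : (l : List ℕ) {σ : Perm n} → σ ∈ C n l → Inj σ
∈C⇒Inj l σ∈ = proj₁ (∈C⇒ l σ∈)

conj-cancel : {y z σ : Perm n} → Inj y → Inj z → (∀ i → lookup y (lookup z i) ≡ i) → Inj σ → conj y (conj z σ) ≡ σ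
conj-cancel {y = y} {z} {σ} p q yz r = ext λ i → go i (injective⇒surjective (lookup y ∘ lookup z) (inj q ∘ inj p) i)
  where
  open ≡-Reasoning
  go : ∀ i → (∃ λ k → lookup y (lookup z k) ≡ i) → lookup (conj y (conj z σ)) i ≡ lookup σ i
  go i (k , e) = begin
    lookup (conj y (conj z σ)) i                          ≡⟨ cong (lookup (conj y (conj z σ))) e ⟨
    lookup (conj y (conj z σ)) (lookup y (lookup z k))    ≡⟨ lookup-conj p (lookup z k) ⟩
    lookup y (lookup (conj z σ) (lookup z k))             ≡⟨ cong (lookup y) (lookup-conj q k) ⟩
    lookup y (lookup z (lookup σ k))                      ≡⟨ yz (lookup σ k) ⟩
    lookup σ k                                            ≡⟨ cong (lookup σ) (trans (sym (yz k)) e) ⟩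
    lookup σ i                                            ∎

∑-class : (l : List ℕ) {y : Perm n} → Inj y → (f : Perm n → ℤ) → ∑ (C n l) (λ σ → f (conj y σ)) ≡ ∑ (C n l) f
∑-class {n} l {y} p = ∑-bij _≟P_ _≟P_ (C-unique n l) (C-unique n l) (conj y) (conj (inv y))
  (C-conj l p) (C-conj l (Inj-inv p))
  (λ σ∈ → conj-cancel (Inj-inv p) p (lookup-invˡ p) (∈C⇒Inj l σ∈))
  (λ σ∈ → conj-cancel p (Inj-inv p) (lookup-invʳ p) (∈C⇒Inj l σ∈))

module Product (N : ℕ) (l : List ℕ) where

  n! : ℤ
  n! = ℤ.+ length (S (suc N))

  K L Sₙ : List (Perm (suc N))
  K = C (suc N) [ suc N ]
  L = C (suc N) l
  Sₙ = S (suc N)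

  R̄ R̄⁻ : Vec Bool N → ℤ
  R̄ A = ∑ L (R A)
  R̄⁻ A = ∑ L (λ σ → R A (inv σ))

  -- A class is stable under conjugation, so each conjugator `y` gives the same sum. Summing over
  -- all of them produces the inner sum of `schur`.
  average : (f : Perm (suc N) → ℤ) → n! * ∑ L f ≡ ∑ L (λ σ → ∑ Sₙ (λ y → f (conj y σ)))
  average f = begin
    n! * ∑ L f                                    ≡⟨ ∑-const Sₙ (∑ L f) ⟨
    ∑ Sₙ (λ _ → ∑ L f)                            ≡⟨ ∑-cong∈ Sₙ (λ y∈ → sym (∑-class l (∈S⇒Inj y∈) f)) ⟩
    ∑ Sₙ (λ y → ∑ L (λ σ → f (conj y σ)))         ≡⟨ ∑-swap Sₙ L (λ y σ → f (conj y σ)) ⟩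
    ∑ L (λ σ → ∑ Sₙ (λ y → f (conj y σ)))         ∎
    where open ≡-Reasoning

  average-F : (A : Vec Bool N) {u : Perm (suc N)} → Inj u → n! * ∑ L (λ σ → F A (u ⊙ σ)) ≡ F A u * R̄ A
  average-F A {u} p = begin
    n! * ∑ L (λ σ → F A (u ⊙ σ))                        ≡⟨ average (λ σ → F A (u ⊙ σ)) ⟩
    ∑ L (λ σ → ∑ Sₙ (λ y → F A (u ⊙ conj y σ)))         ≡⟨ ∑-cong∈ L (λ σ∈ → schur A p (∈C⇒Inj l σ∈)) ⟩
    ∑ L (λ σ → F A u * R A σ)                           ≡⟨ ∑-*ˡ L (F A u) (R A) ⟩
    F A u * R̄ A                                         ∎
    where open ≡-Reasoning

  average-F⁻ : (A : Vec Bool N) {u : Perm (suc N)} → Inj u → n! * ∑ L (λ σ → F A (u ⊙ inv σ)) ≡ F A u * R̄⁻ A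
  average-F⁻ A {u} p = begin
    n! * ∑ L (λ σ → F A (u ⊙ inv σ))                    ≡⟨ average (λ σ → F A (u ⊙ inv σ)) ⟩
    ∑ L (λ σ → ∑ Sₙ (λ y → F A (u ⊙ inv (conj y σ))))
      ≡⟨ ∑-cong∈ L (λ σ∈ → trans
           (∑-cong∈ Sₙ (λ y∈ → cong (λ t → F A (u ⊙ t)) (inv-conj (∈S⇒Inj y∈) (∈C⇒Inj l σ∈))))
           (schur A p (Inj-inv (∈C⇒Inj l σ∈)))) ⟩
    ∑ L (λ σ → F A u * R A (inv σ))                     ≡⟨ ∑-*ˡ L (F A u) (λ σ → R A (inv σ)) ⟩
    F A u * R̄⁻ A                                        ∎
    where open ≡-Reasoning

  -- `schur` is used once for `σ` and once for `τ`. To bring `σ` to the right end, `inv τ` is moved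
  -- to its left, which replaces `σ` by `conj τ σ`; the sum over the class does not notice.
  average-F₂ : (A : Vec Bool N) {π : Perm (suc N)} → Inj π →
               n! * n! * ∑ L (λ τ → ∑ L (λ σ → F A ((π ⊙ σ) ⊙ inv τ))) ≡ F A π * (R̄ A * R̄⁻ A)
  average-F₂ A {π} p = begin
    n! * n! * ∑ L (λ τ → ∑ L (λ σ → F A ((π ⊙ σ) ⊙ inv τ)))
      ≡⟨ ℤₚ.*-assoc n! n! (∑ L (λ τ → ∑ L (λ σ → F A ((π ⊙ σ) ⊙ inv τ)))) ⟩
    n! * (n! * ∑ L (λ τ → ∑ L (λ σ → F A ((π ⊙ σ) ⊙ inv τ))))
      ≡⟨ cong (n! *_) (∑-*ˡ L n! (λ τ → ∑ L (λ σ → F A ((π ⊙ σ) ⊙ inv τ)))) ⟨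
    n! * ∑ L (λ τ → n! * ∑ L (λ σ → F A ((π ⊙ σ) ⊙ inv τ)))
      ≡⟨ cong (n! *_) (∑-cong∈ L (λ {τ} τ∈ → inner τ (∈C⇒Inj l τ∈))) ⟩
    n! * ∑ L (λ τ → F A (π ⊙ inv τ) * R̄ A)
      ≡⟨ cong (n! *_) (∑-*ʳ L (R̄ A) (λ τ → F A (π ⊙ inv τ))) ⟩
    n! * (∑ L (λ τ → F A (π ⊙ inv τ)) * R̄ A)
      ≡⟨ ℤₚ.*-assoc n! (∑ L (λ τ → F A (π ⊙ inv τ))) (R̄ A) ⟨
    n! * ∑ L (λ τ → F A (π ⊙ inv τ)) * R̄ A
      ≡⟨ cong (_* R̄ A) (average-F⁻ A p) ⟩
    F A π * R̄⁻ A * R̄ A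
      ≡⟨ trans (ℤₚ.*-assoc (F A π) (R̄⁻ A) (R̄ A)) (cong (F A π *_) (ℤₚ.*-comm (R̄⁻ A) (R̄ A))) ⟩
    F A π * (R̄ A * R̄⁻ A)
      ∎
    where
    open ≡-Reasoning
    inner : ∀ τ → Inj τ → n! * ∑ L (λ σ → F A ((π ⊙ σ) ⊙ inv τ)) ≡ F A (π ⊙ inv τ) * R̄ A
    inner τ q = begin
      n! * ∑ L (λ σ → F A ((π ⊙ σ) ⊙ inv τ))              ≡⟨ cong (n! *_) (∑-cong L (λ σ → cong (F A) (shift σ))) ⟩
      n! * ∑ L (λ σ → F A ((π ⊙ inv τ) ⊙ conj τ σ))       ≡⟨ cong (n! *_) (∑-class l q (λ σ → F A ((π ⊙ inv τ) ⊙ σ))) ⟩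
      n! * ∑ L (λ σ → F A ((π ⊙ inv τ) ⊙ σ))              ≡⟨ average-F A (Inj-⊙ p (Inj-inv q)) ⟩
      F A (π ⊙ inv τ) * R̄ A                               ∎
      where
      shift : ∀ σ → (π ⊙ σ) ⊙ inv τ ≡ (π ⊙ inv τ) ⊙ conj τ σ
      shift σ = begin
        (π ⊙ σ) ⊙ inv τ                         ≡⟨ ⊙-assoc π σ (inv τ) ⟩
        π ⊙ (σ ⊙ inv τ)                         ≡⟨ cong (π ⊙_) (inv-cancelˡ q (σ ⊙ inv τ)) ⟨
        π ⊙ (inv τ ⊙ (τ ⊙ (σ ⊙ inv τ)))         ≡⟨ cong (λ t → π ⊙ (inv τ ⊙ t)) (conj-def τ σ) ⟨
        π ⊙ (inv τ ⊙ conj τ σ)                  ≡⟨ ⊙-assoc π (inv τ) (conj τ σ) ⟨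
        (π ⊙ inv τ) ⊙ conj τ σ                  ∎

  ways : Perm (suc N) → ℤ
  ways x = ∑ K (λ π → ∑ L (λ σ → ι ((π ⊙ σ) ≟P x)))

  -- For given `y` and `σ` the only possible `π` is `y ⊙ inv σ`. The factor n stands on the left
  -- because the indicator of the full cycles is `alt` divided by n.
  n-ways : {y : Perm (suc N)} → Inj y → ℤ.+ suc N * ways y ≡ ∑ L (λ τ → alt (y ⊙ inv τ))
  n-ways {y} p = begin
    nn * ways y                                                      ≡⟨ ∑-*ˡ K nn (λ π → ∑ L (λ σ → ι ((π ⊙ σ) ≟P y))) ⟨
    ∑ K (λ π → nn * ∑ L (λ σ → ι ((π ⊙ σ) ≟P y)))                    ≡⟨ ∑-full-cycles N (λ π → ∑ L (λ σ → ι ((π ⊙ σ) ≟P y))) ⟩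
    ∑ Sₙ (λ π → alt π * ∑ L (λ σ → ι ((π ⊙ σ) ≟P y)))                ≡⟨ ∑-cong Sₙ (λ π → ∑-*ˡ L (alt π) (λ σ → ι ((π ⊙ σ) ≟P y))) ⟨
    ∑ Sₙ (λ π → ∑ L (λ σ → alt π * ι ((π ⊙ σ) ≟P y)))                ≡⟨ ∑-swap Sₙ L (λ π σ → alt π * ι ((π ⊙ σ) ≟P y)) ⟩
    ∑ L (λ σ → ∑ Sₙ (λ π → alt π * ι ((π ⊙ σ) ≟P y)))                ≡⟨ ∑-cong∈ L (λ {σ} σ∈ → single σ (∈C⇒Inj l σ∈)) ⟩
    ∑ L (λ σ → alt (y ⊙ inv σ))                                      ∎
    where
    open ≡-Reasoning
    nn : ℤ
    nn = ℤ.+ suc N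
    single : ∀ σ → Inj σ → ∑ Sₙ (λ π → alt π * ι ((π ⊙ σ) ≟P y)) ≡ alt (y ⊙ inv σ)
    single σ q = trans
      (∑-point (S-unique (suc N)) (Inj⇒∈S (Inj-⊙ p (Inj-inv q))) (λ {π} _ π≢ → trans
        (cong (alt π *_) (ι-no ((π ⊙ σ) ≟P y) (λ e → π≢ (trans (sym (inv-cancelʳ q π)) (cong (_⊙ inv σ) e)))))
        (ℤₚ.*-zeroʳ (alt π))))
      (trans (cong (alt (y ⊙ inv σ) *_) (ι-yes (((y ⊙ inv σ) ⊙ σ) ≟P y) (inv-cancelʳ′ q y))) (ℤₚ.*-identityʳ (alt (y ⊙ inv σ))))

  ∑-ways : (f : Perm (suc N) → ℤ) → ∑ Sₙ (λ x → ways x * f x) ≡ ∑ K (λ π → ∑ L (λ σ → f (π ⊙ σ)))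
  ∑-ways f = begin
    ∑ Sₙ (λ x → ways x * f x)
      ≡⟨ ∑-cong Sₙ (λ x → sym (trans
           (∑-cong K (λ π → ∑-*ʳ L (f x) (λ σ → ι ((π ⊙ σ) ≟P x))))
           (∑-*ʳ K (f x) (λ π → ∑ L (λ σ → ι ((π ⊙ σ) ≟P x)))))) ⟩
    ∑ Sₙ (λ x → ∑ K (λ π → ∑ L (λ σ → ι ((π ⊙ σ) ≟P x) * f x)))
      ≡⟨ ∑-swap Sₙ K (λ x π → ∑ L (λ σ → ι ((π ⊙ σ) ≟P x) * f x)) ⟩
    ∑ K (λ π → ∑ Sₙ (λ x → ∑ L (λ σ → ι ((π ⊙ σ) ≟P x) * f x)))
      ≡⟨ ∑-cong K (λ π → ∑-swap Sₙ L (λ x σ → ι ((π ⊙ σ) ≟P x) * f x)) ⟩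
    ∑ K (λ π → ∑ L (λ σ → ∑ Sₙ (λ x → ι ((π ⊙ σ) ≟P x) * f x)))
      ≡⟨ ∑-cong∈ K (λ {π} π∈ → ∑-cong∈ L (λ {σ} σ∈ → single π σ (Inj-⊙ (∈C⇒Inj [ suc N ] π∈) (∈C⇒Inj l σ∈)))) ⟩
    ∑ K (λ π → ∑ L (λ σ → f (π ⊙ σ)))
      ∎
    where
    open ≡-Reasoning
    single : ∀ π σ → Inj (π ⊙ σ) → ∑ Sₙ (λ x → ι ((π ⊙ σ) ≟P x) * f x) ≡ f (π ⊙ σ)
    single π σ q = trans
      (∑-point (S-unique (suc N)) (Inj⇒∈S q) (λ {x} _ x≢ →
        trans (cong (_* f x) (ι-no ((π ⊙ σ) ≟P x) (x≢ ∘ sym))) (ℤₚ.*-zeroˡ (f x))))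
      (trans (cong (_* f (π ⊙ σ)) (ι-yes ((π ⊙ σ) ≟P (π ⊙ σ)) refl)) (ℤₚ.*-identityˡ (f (π ⊙ σ))))

  -- One factor `ways x` is resolved into pairs `π`, `σ` with product `x`, the other into
  -- alternating sums by `n-ways`. The arguments of `F A` are then `(π ⊙ σ) ⊙ inv τ`, as in
  -- `average-F₂`.
  second-moment : n! * n! * (ℤ.+ suc N * ∑ Sₙ (λ x → ways x * ways x)) ≡
                  ∑ K (λ π → ∑ (subsets N) (λ A → parity (size A) * F A π * (R̄ A * R̄⁻ A)))
  second-moment = begin
    ff * (nn * ∑ Sₙ (λ x → ways x * ways x))
      ≡⟨ cong (λ t → ff * (nn * t)) (∑-ways ways) ⟩
    ff * (nn * ∑ K (λ π → ∑ L (λ σ → ways (π ⊙ σ))))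
      ≡⟨ cong (ff *_) (∑-*ˡ K nn (λ π → ∑ L (λ σ → ways (π ⊙ σ)))) ⟨
    ff * ∑ K (λ π → nn * ∑ L (λ σ → ways (π ⊙ σ)))
      ≡⟨ ∑-*ˡ K ff (λ π → nn * ∑ L (λ σ → ways (π ⊙ σ))) ⟨
    ∑ K (λ π → ff * (nn * ∑ L (λ σ → ways (π ⊙ σ))))
      ≡⟨ ∑-cong∈ K (λ {π} π∈ → per-cycle π (∈C⇒Inj [ suc N ] π∈)) ⟩
    ∑ K (λ π → ∑ (subsets N) (λ A → parity (size A) * F A π * (R̄ A * R̄⁻ A)))
      ∎
    where
    open ≡-Reasoning
    ff nn : ℤ
    ff = n! * n!
    nn = ℤ.+ suc N
    Us : List (Vec Bool N)
    Us = subsets N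
    move : ∀ a b c → a * (b * c) ≡ b * (a * c)
    move = solve-∀
    per-cycle : ∀ π → Inj π → ff * (nn * ∑ L (λ σ → ways (π ⊙ σ))) ≡ ∑ Us (λ A → parity (size A) * F A π * (R̄ A * R̄⁻ A))
    per-cycle π p = begin
      ff * (nn * ∑ L (λ σ → ways (π ⊙ σ)))
        ≡⟨ cong (ff *_) (∑-*ˡ L nn (λ σ → ways (π ⊙ σ))) ⟨
      ff * ∑ L (λ σ → nn * ways (π ⊙ σ))
        ≡⟨ cong (ff *_) (∑-cong∈ L (λ {σ} σ∈ → n-ways (Inj-⊙ p (∈C⇒Inj l σ∈)))) ⟩
      ff * ∑ L (λ σ → ∑ L (λ τ → alt ((π ⊙ σ) ⊙ inv τ)))
        ≡⟨ cong (ff *_) (∑-swap L L (λ σ τ → alt ((π ⊙ σ) ⊙ inv τ))) ⟩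
      ff * ∑ L (λ τ → ∑ L (λ σ → ∑ Us (λ A → parity (size A) * F A ((π ⊙ σ) ⊙ inv τ))))
        ≡⟨ cong (ff *_) (∑-cong L (λ τ → ∑-swap L Us (λ σ A → parity (size A) * F A ((π ⊙ σ) ⊙ inv τ)))) ⟩
      ff * ∑ L (λ τ → ∑ Us (λ A → ∑ L (λ σ → parity (size A) * F A ((π ⊙ σ) ⊙ inv τ))))
        ≡⟨ cong (ff *_) (∑-swap L Us (λ τ A → ∑ L (λ σ → parity (size A) * F A ((π ⊙ σ) ⊙ inv τ)))) ⟩
      ff * ∑ Us (λ A → ∑ L (λ τ → ∑ L (λ σ → parity (size A) * F A ((π ⊙ σ) ⊙ inv τ))))
        ≡⟨ ∑-*ˡ Us ff (λ A → ∑ L (λ τ → ∑ L (λ σ → parity (size A) * F A ((π ⊙ σ) ⊙ inv τ)))) ⟨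
      ∑ Us (λ A → ff * ∑ L (λ τ → ∑ L (λ σ → parity (size A) * F A ((π ⊙ σ) ⊙ inv τ))))
        ≡⟨ ∑-cong Us per-subset ⟩
      ∑ Us (λ A → parity (size A) * F A π * (R̄ A * R̄⁻ A))
        ∎
      where
      per-subset : ∀ A → ff * ∑ L (λ τ → ∑ L (λ σ → parity (size A) * F A ((π ⊙ σ) ⊙ inv τ))) ≡
                         parity (size A) * F A π * (R̄ A * R̄⁻ A)
      per-subset A = begin
        ff * ∑ L (λ τ → ∑ L (λ σ → s * F A ((π ⊙ σ) ⊙ inv τ)))
          ≡⟨ cong (ff *_) (∑-cong L (λ τ → ∑-*ˡ L s (λ σ → F A ((π ⊙ σ) ⊙ inv τ)))) ⟩
        ff * ∑ L (λ τ → s * ∑ L (λ σ → F A ((π ⊙ σ) ⊙ inv τ)))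
          ≡⟨ cong (ff *_) (∑-*ˡ L s (λ τ → ∑ L (λ σ → F A ((π ⊙ σ) ⊙ inv τ)))) ⟩
        ff * (s * ∑ L (λ τ → ∑ L (λ σ → F A ((π ⊙ σ) ⊙ inv τ))))
          ≡⟨ move ff s (∑ L (λ τ → ∑ L (λ σ → F A ((π ⊙ σ) ⊙ inv τ)))) ⟩
        s * (ff * ∑ L (λ τ → ∑ L (λ σ → F A ((π ⊙ σ) ⊙ inv τ))))
          ≡⟨ cong (s *_) (average-F₂ A p) ⟩
        s * (F A π * (R̄ A * R̄⁻ A))
          ≡⟨ ℤₚ.*-assoc s (F A π) (R̄ A * R̄⁻ A) ⟨
        s * F A π * (R̄ A * R̄⁻ A)
          ∎
        where
        s : ℤ
        s = parity (size A)

-- The telescoping estimate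

Σ< : (ℕ → ℕ) → ℕ → ℕ
Σ< t zero    = 0
Σ< t (suc n) = Σ< t n ℕ.+ t n

Σ<-first : ∀ t n → Σ< t (suc n) ≡ t 0 ℕ.+ Σ< (t ∘ suc) n
Σ<-first t zero    = ℕₚ.+-comm 0 (t 0)
Σ<-first t (suc n) = trans (cong (ℕ._+ t (suc n)) (Σ<-first t n)) (ℕₚ.+-assoc (t 0) (Σ< (t ∘ suc) n) (t (suc n)))

Σ<-+ : ∀ t a b → Σ< t (a ℕ.+ b) ≡ Σ< t a ℕ.+ Σ< (λ k → t (a ℕ.+ k)) b
Σ<-+ t a zero    = trans (cong (Σ< t) (ℕₚ.+-identityʳ a)) (sym (ℕₚ.+-identityʳ (Σ< t a)))
Σ<-+ t a (suc b) = trans (cong (Σ< t) (ℕₚ.+-suc a b))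
  (trans (cong (ℕ._+ t (a ℕ.+ b)) (Σ<-+ t a b)) (ℕₚ.+-assoc (Σ< t a) (Σ< (λ k → t (a ℕ.+ k)) b) (t (a ℕ.+ b))))

Σ<-reverse : ∀ t n → Σ< t n ≡ Σ< (λ k → t (n ℕ.∸ suc k)) n
Σ<-reverse t zero    = refl
Σ<-reverse t (suc n) = trans (ℕₚ.+-comm (Σ< t n) (t n))
  (trans (cong (t n ℕ.+_) (Σ<-reverse t n)) (sym (Σ<-first (λ k → t (n ℕ.∸ k)) n)))

-- The telescoping bound Σ_{k=1}^{M} 1/((N-k+1)(N-k)) = 1/(N-M) - 1/N with N = M + r, cleared of denominators.
telescope : ∀ M r (t : ℕ → ℕ) E → (∀ {k s} → k ℕ.+ s ≡ M ℕ.+ r → 1 ℕ.≤ k → k ℕ.≤ M → suc s ℕ.* s ℕ.* t k ℕ.≤ E) →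
            (M ℕ.+ r) ℕ.* r ℕ.* Σ< (t ∘ suc) M ℕ.≤ M ℕ.* E
telescope zero    r t E h = ℕₚ.≤-reflexive (ℕₚ.*-zeroʳ (r ℕ.* r))
telescope (suc M) r t E h = ℕₚ.*-cancelˡ-≤ (suc r) (begin
  suc r ℕ.* ((suc M ℕ.+ r) ℕ.* r ℕ.* (X ℕ.+ u))
    ≡⟨ split M r X u ⟩
  r ℕ.* ((M ℕ.+ suc r) ℕ.* suc r ℕ.* X) ℕ.+ (suc M ℕ.+ r) ℕ.* (suc r ℕ.* r ℕ.* u)
    ≤⟨ ℕₚ.+-mono-≤ (ℕₚ.*-monoʳ-≤ r IH) (ℕₚ.*-monoʳ-≤ (suc M ℕ.+ r) (h refl (ℕ.s≤s ℕ.z≤n) ℕₚ.≤-refl)) ⟩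
  r ℕ.* (M ℕ.* E) ℕ.+ (suc M ℕ.+ r) ℕ.* E
    ≡⟨ join M r E ⟩
  suc r ℕ.* (suc M ℕ.* E)
    ∎)
  where
  open ℕₚ.≤-Reasoning
  X u : ℕ
  X = Σ< (t ∘ suc) M
  u = t (suc M)
  IH : (M ℕ.+ suc r) ℕ.* suc r ℕ.* X ℕ.≤ M ℕ.* E
  IH = telescope M (suc r) t E λ e 1≤k k≤M → h (trans e (ℕₚ.+-suc M r)) 1≤k (ℕₚ.m≤n⇒m≤1+n k≤M)
  split : ∀ M r X u → suc r ℕ.* ((suc M ℕ.+ r) ℕ.* r ℕ.* (X ℕ.+ u)) ≡
          r ℕ.* ((M ℕ.+ suc r) ℕ.* suc r ℕ.* X) ℕ.+ (suc M ℕ.+ r) ℕ.* (suc r ℕ.* r ℕ.* u)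
  split = ℕR.solve-∀
  join : ∀ M r E → r ℕ.* (M ℕ.* E) ℕ.+ (suc M ℕ.+ r) ℕ.* E ≡ suc r ℕ.* (suc M ℕ.* E)
  join = ℕR.solve-∀

-- Telescoping up to M gives M / ((M + r + 1)(r + 1)), which is at most 1 / (M + r + 1) once M ≤ r +
-- 1, that is, over about half of the range.
half-sum : ∀ M r (t : ℕ → ℕ) E → M ℕ.≤ suc r →
           (∀ {k s} → k ℕ.+ s ≡ M ℕ.+ suc r → 1 ℕ.≤ k → k ℕ.≤ M → suc s ℕ.* s ℕ.* t k ℕ.≤ E) →
           (M ℕ.+ suc r) ℕ.* Σ< (t ∘ suc) M ℕ.≤ E
half-sum M r t E M≤ h = ℕₚ.*-cancelˡ-≤ (suc r) (begin
  suc r ℕ.* ((M ℕ.+ suc r) ℕ.* Σ< (t ∘ suc) M)     ≡⟨ move (suc r) (M ℕ.+ suc r) (Σ< (t ∘ suc) M) ⟩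
  (M ℕ.+ suc r) ℕ.* suc r ℕ.* Σ< (t ∘ suc) M       ≤⟨ telescope M (suc r) t E h ⟩
  M ℕ.* E                                          ≤⟨ ℕₚ.*-monoˡ-≤ E M≤ ⟩
  suc r ℕ.* E                                      ∎)
  where
  open ℕₚ.≤-Reasoning
  move : ∀ a b c → a ℕ.* (b ℕ.* c) ≡ b ℕ.* a ℕ.* c
  move = ℕR.solve-∀

-- The N sizes strictly between the extremes are split into `M` small and `M′` large ones, evenly
-- enough for `half-sum` to apply to both.
halves : ∀ N → ∃₂ λ M M′ → suc N ≡ M ℕ.+ suc M′ × M ℕ.≤ suc M′ × M′ ℕ.≤ suc M
halves zero = 0 , 0 , refl , ℕ.z≤n , ℕ.z≤n
halves (suc N) with halves N
... | M , M′ , e , a , b with ℕₚ.≤-total M M′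
...   | inj₁ le = suc M , M′ , cong suc e , ℕ.s≤s le , ℕₚ.m≤n⇒m≤1+n b
...   | inj₂ ge = M , suc M′ , trans (cong suc e) (sym (ℕₚ.+-suc M (suc M′))) , ℕₚ.m≤n⇒m≤1+n a , ℕ.s≤s ge

-- The two extreme sizes are estimated by `Z`. Sizes up to `M` use the factor that comes from the
-- complement; the larger sizes, read backwards, use the one that comes from the size itself. Each
-- half costs `E`.
sum-bound : ∀ N₀ (t : ℕ → ℕ) E Z → t 0 ℕ.≤ Z → t (suc N₀) ℕ.≤ Z →
            (∀ {k s} → k ℕ.+ s ≡ suc N₀ → 1 ℕ.≤ k → 1 ℕ.≤ s → suc s ℕ.* s ℕ.* t k ℕ.≤ E × suc k ℕ.* k ℕ.* t k ℕ.≤ E) →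
            suc N₀ ℕ.* Σ< t (suc (suc N₀)) ℕ.≤ suc N₀ ℕ.* (Z ℕ.+ Z) ℕ.+ (E ℕ.+ E)
sum-bound N₀ t E Z t0 tN h with halves N₀
... | M , M′ , e , M≤ , M′≤ = begin
  D ℕ.* Σ< t (suc D)
    ≡⟨ cong (D ℕ.*_) total ⟩
  D ℕ.* (t 0 ℕ.+ A ℕ.+ B ℕ.+ t D)
    ≡⟨ rearrange D (t 0) A B (t D) ⟩
  D ℕ.* (t 0 ℕ.+ t D) ℕ.+ (D ℕ.* A ℕ.+ D ℕ.* B)
    ≤⟨ ℕₚ.+-mono-≤ (ℕₚ.*-monoʳ-≤ D (ℕₚ.+-mono-≤ t0 tN)) (ℕₚ.+-mono-≤ leftBound rightBound) ⟩
  D ℕ.* (Z ℕ.+ Z) ℕ.+ (E ℕ.+ E)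
    ∎
  where
  open ℕₚ.≤-Reasoning
  D : ℕ
  D = suc N₀
  t′ : ℕ → ℕ
  -- For `j` up to `M′` this is the value of `t` at D - j, so the second half also starts at index
  -- 1.
  t′ j = t (suc M ℕ.+ (M′ ℕ.∸ j))
  A B : ℕ
  A = Σ< (t ∘ suc) M
  B = Σ< (t′ ∘ suc) M′
  e′ : D ≡ suc M ℕ.+ M′
  e′ = trans e (ℕₚ.+-suc M M′)
  e″ : D ≡ M′ ℕ.+ suc M
  e″ = trans e′ (ℕₚ.+-comm (suc M) M′)
  total : Σ< t (suc D) ≡ t 0 ℕ.+ A ℕ.+ B ℕ.+ t D
  total = cong (ℕ._+ t D) (trans (cong (Σ< t) e′) (trans (Σ<-+ t (suc M) M′)
            (cong₂ ℕ._+_ (Σ<-first t M) (Σ<-reverse (λ k → t (suc M ℕ.+ k)) M′))))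
  rearrange : ∀ D a x y b → D ℕ.* (a ℕ.+ x ℕ.+ y ℕ.+ b) ≡ D ℕ.* (a ℕ.+ b) ℕ.+ (D ℕ.* x ℕ.+ D ℕ.* y)
  rearrange = ℕR.solve-∀
  leftBound : D ℕ.* A ℕ.≤ E
  leftBound = subst (λ m → m ℕ.* A ℕ.≤ E) (sym e) (half-sum M M′ t E M≤ λ {k} {s} k+s 1≤k k≤M →
    proj₁ (h (trans k+s (sym e)) 1≤k (ℕₚ.+-cancelˡ-≤ k 1 s (ℕₚ.≤-trans (ℕₚ.+-monoˡ-≤ 1 k≤M)
      (subst (M ℕ.+ 1 ℕ.≤_) (sym k+s) (ℕₚ.+-monoʳ-≤ M (ℕ.s≤s ℕ.z≤n)))))))
  rightBound : D ℕ.* B ℕ.≤ E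
  rightBound = subst (λ m → m ℕ.* B ℕ.≤ E) (sym e″) (half-sum M′ M t′ E M′≤ λ {k} {s} k+s 1≤k k≤M′ → right k s k+s 1≤k k≤M′)
    where
    right : ∀ k s → k ℕ.+ s ≡ M′ ℕ.+ suc M → 1 ℕ.≤ k → k ℕ.≤ M′ → suc s ℕ.* s ℕ.* t′ k ℕ.≤ E
    right k s k+s 1≤k k≤M′ = subst (λ j → suc s ℕ.* s ℕ.* t j ℕ.≤ E) pos
      (proj₂ (h {s} {k} (trans (ℕₚ.+-comm s k) (trans k+s (sym e″))) (subst (1 ℕ.≤_) (sym pos) (ℕ.s≤s ℕ.z≤n)) 1≤k))
      where
      pos : s ≡ suc M ℕ.+ (M′ ℕ.∸ k)
      pos = ℕₚ.+-cancelˡ-≡ k s _ (trans k+s (trans (ℕₚ.+-comm M′ (suc M)) (trans (cong (suc M ℕ.+_) (sym (ℕₚ.m∸n+n≡m k≤M′)))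
              (swap₃ (suc M) (M′ ℕ.∸ k) k))))
        where
        swap₃ : ∀ a b c → a ℕ.+ (b ℕ.+ c) ≡ c ℕ.+ (a ℕ.+ b)
        swap₃ = ℕR.solve-∀

∣∑upTo∣ : ∀ n (h : ℕ → ℤ) → ∣ ∑ (upTo n) h ∣ ℕ.≤ Σ< (∣_∣ ∘ h) n
∣∑upTo∣ zero    h = ℕ.z≤n
∣∑upTo∣ (suc n) h = subst (ℕ._≤ Σ< (∣_∣ ∘ h) (suc n)) (cong ∣_∣ (sym snoc))
  (ℕₚ.≤-trans (ℤₚ.∣i+j∣≤∣i∣+∣j∣ (∑ (upTo n) h) (h n)) (ℕₚ.+-monoˡ-≤ ∣ h n ∣ (∣∑upTo∣ n h)))
  where
  snoc : ∑ (upTo (suc n)) h ≡ ∑ (upTo n) h + h n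
  snoc = trans (cong (λ xs → ∑ xs h) (sym (Listₚ.upTo-∷ʳ n))) (trans (∑-++ (upTo n) [ n ] h)
           (cong (λ t → ∑ (upTo n) h + t) (ℤₚ.+-identityʳ (h n))))

∣∑∣-scaled : {A : Set} {f : A → ℤ} {b : ℕ} (c : ℕ) (xs : List A) → (∀ {x} → x ∈ xs → c ℕ.* ∣ f x ∣ ℕ.≤ b) →
             c ℕ.* ∣ ∑ xs f ∣ ℕ.≤ length xs ℕ.* b
∣∑∣-scaled {f = f} {b} c xs h = subst (ℕ._≤ length xs ℕ.* b)
  (trans (cong ∣_∣ (∑-*ˡ xs (ℤ.+ c) f)) (ℤₚ.abs-* (ℤ.+ c) (∑ xs f)))
  (∣∑∣≤ xs λ {x} x∈ → subst (ℕ._≤ b) (sym (ℤₚ.abs-* (ℤ.+ c) (f x))) (h x∈))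

size-complement : (A : Vec Bool N) → size A ℕ.+ size (complement A) ≡ N
size-complement []          = refl
size-complement (true ∷ A)  = cong suc (size-complement A)
size-complement (false ∷ A) = trans (ℕₚ.+-suc (size A) (size (complement A))) (cong suc (size-complement A))

size-positive : (A : Vec Bool N) → 1 ℕ.≤ size A → ∃ λ a → lookup A a ≡ true
size-positive {N} A 1≤ = nonempty A λ e → ℕₚ.<⇒≢ 1≤ (sym (trans (cong size e) (size-∅ N)))

module Bounds (N : ℕ) (l : List ℕ) (m : ℕ) (1≤m : 1 ℕ.≤ m)
              (few-fixpts : ∀ {σ} → σ ∈ C (suc N) l → fixpts σ ℤ.≤ ℤ.+ m) where
  open Product N l

  f ℓ κ : ℕ
  f = length Sₙ
  ℓ = length L
  κ = length K

  private
    few-fixpts⁻ : ∀ {σ} → σ ∈ L → fixpts (inv σ) ℤ.≤ ℤ.+ m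
    few-fixpts⁻ σ∈ = subst (ℤ._≤ ℤ.+ m) (sym (fixpts-inv (∈C⇒Inj l σ∈))) (few-fixpts σ∈)

    g : Vec Bool N → ℤ
    g A = R̄ A * R̄⁻ A

    scaled-product : ∀ c (x y : ℤ) b → c ℕ.* ∣ x ∣ ℕ.≤ b → c ℕ.* ∣ y ∣ ℕ.≤ b → c ℕ.* c ℕ.* ∣ x * y ∣ ℕ.≤ b ℕ.* b
    scaled-product c x y b hx hy = subst (ℕ._≤ b ℕ.* b)
      (trans (interchange c ∣ x ∣ ∣ y ∣) (cong (c ℕ.* c ℕ.*_) (sym (ℤₚ.abs-* x y)))) (ℕₚ.*-mono-≤ hx hy)
      where
      interchange : ∀ c x y → c ℕ.* x ℕ.* (c ℕ.* y) ≡ c ℕ.* c ℕ.* (x ℕ.* y)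
      interchange = ℕR.solve-∀

    g-bound₀ : ∀ A → ∣ g A ∣ ℕ.≤ ℓ ℕ.* f ℕ.* (ℓ ℕ.* f)
    g-bound₀ A = subst (ℕ._≤ ℓ ℕ.* f ℕ.* (ℓ ℕ.* f)) (sym (ℤₚ.abs-* (R̄ A) (R̄⁻ A)))
      (ℕₚ.*-mono-≤ (∣∑∣≤ L λ σ∈ → ∣R∣≤ A (∈C⇒Inj l σ∈)) (∣∑∣≤ L λ σ∈ → ∣R∣≤ A (Inj-inv (∈C⇒Inj l σ∈))))

    E : ℕ
    E = ℓ ℕ.* (f ℕ.* m) ℕ.* (ℓ ℕ.* (f ℕ.* m))

    g-boundˡ : ∀ A → 1 ℕ.≤ size A → suc (size (complement A)) ℕ.* suc (size (complement A)) ℕ.* ∣ g A ∣ ℕ.≤ E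
    g-boundˡ A 1≤ with size-positive A 1≤
    ... | a , a∈ = scaled-product (suc (size (complement A))) (R̄ A) (R̄⁻ A) (ℓ ℕ.* (f ℕ.* m))
      (∣∑∣-scaled (suc (size (complement A))) L λ σ∈ → ∣R∣-boundˡ A a∈ (∈C⇒Inj l σ∈) 1≤m (few-fixpts σ∈))
      (∣∑∣-scaled (suc (size (complement A))) L λ σ∈ → ∣R∣-boundˡ A a∈ (Inj-inv (∈C⇒Inj l σ∈)) 1≤m (few-fixpts⁻ σ∈))

    g-boundʳ : ∀ A → 1 ℕ.≤ size (complement A) → suc (size A) ℕ.* suc (size A) ℕ.* ∣ g A ∣ ℕ.≤ E
    g-boundʳ A 1≤ with size-positive (complement A) 1≤
    ... | a , a∈ = scaled-product (suc (size A)) (R̄ A) (R̄⁻ A) (ℓ ℕ.* (f ℕ.* m))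
      (∣∑∣-scaled (suc (size A)) L λ σ∈ → ∣R∣-boundʳ A a∉ (∈C⇒Inj l σ∈) 1≤m (few-fixpts σ∈))
      (∣∑∣-scaled (suc (size A)) L λ σ∈ → ∣R∣-boundʳ A a∉ (Inj-inv (∈C⇒Inj l σ∈)) 1≤m (few-fixpts⁻ σ∈))
      where
      a∉ : lookup A a ≡ false
      a∉ = trans (sym (Boolₚ.not-involutive (lookup A a)))
                 (cong not (trans (sym (Vecₚ.lookup-map a not A)) a∈))

  Q : ℕ
  Q = ∣ ∑ Sₙ (λ x → ways x * ways x) ∣

  B : ℕ
  B = N ℕ.* (ℓ ℕ.* f ℕ.* (ℓ ℕ.* f) ℕ.+ ℓ ℕ.* f ℕ.* (ℓ ℕ.* f)) ℕ.+ (E ℕ.+ E)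

  per-cycle-bound : 1 ℕ.≤ N → {π : Perm (suc N)} → π ∈ K →
                    N ℕ.* ∣ ∑ (subsets N) (λ A → parity (size A) * F A π * (R̄ A * R̄⁻ A)) ∣ ℕ.≤ B
  per-cycle-bound 1≤N {π} π∈ = subst (λ t → N ℕ.* ∣ t ∣ ℕ.≤ B) (sym (Y.cycle-sum g))
    (ℕₚ.≤-trans (ℕₚ.*-monoʳ-≤ N (∣∑upTo∣ (suc N) (g ∘ Y.segment))) (go N refl 1≤N))
    where
    module Y = Cycle (∈C⇒Inj [ suc N ] π∈) (∈C⇒transitive π∈)
    t : ℕ → ℕ
    t k = ∣ g (Y.segment k) ∣
    compl : ∀ {k s} → k ℕ.+ s ≡ N → size (complement (Y.segment k)) ≡ s
    compl {k} {s} e = ℕₚ.+-cancelˡ-≡ k _ s (trans (cong (ℕ._+ size (complement (Y.segment k))) (sym (Y.size-segment k k≤)))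
                        (trans (size-complement (Y.segment k)) (sym e)))
      where
      k≤ : k ℕ.≤ N
      k≤ = subst (k ℕ.≤_) e (ℕₚ.m≤m+n k s)
    bounds : ∀ {k s} → k ℕ.+ s ≡ N → 1 ℕ.≤ k → 1 ℕ.≤ s → suc s ℕ.* s ℕ.* t k ℕ.≤ E × suc k ℕ.* k ℕ.* t k ℕ.≤ E
    -- The squared character bounds carry (s + 1)² and (k + 1)²; lowering one of the two equal
    -- factors by 1 gives the form that telescopes.
    bounds {k} {s} e 1≤k 1≤s =
      (ℕₚ.≤-trans (ℕₚ.*-monoˡ-≤ (t k) (ℕₚ.*-monoʳ-≤ (suc s) (ℕₚ.n≤1+n s)))
        (subst (λ c → suc c ℕ.* suc c ℕ.* t k ℕ.≤ E) (compl e) (g-boundˡ (Y.segment k) (subst (1 ℕ.≤_) (sym size-k) 1≤k)))) ,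
      (ℕₚ.≤-trans (ℕₚ.*-monoˡ-≤ (t k) (ℕₚ.*-monoʳ-≤ (suc k) (ℕₚ.n≤1+n k)))
        (subst (λ c → suc c ℕ.* suc c ℕ.* t k ℕ.≤ E) size-k (g-boundʳ (Y.segment k) (subst (1 ℕ.≤_) (sym (compl e)) 1≤s))))
      where
      size-k : size (Y.segment k) ≡ k
      size-k = Y.size-segment k (subst (k ℕ.≤_) e (ℕₚ.m≤m+n k s))
    go : ∀ N′ → N ≡ N′ → 1 ℕ.≤ N′ → N ℕ.* Σ< t (suc N) ℕ.≤ B
    go (suc N₀) e _ = subst (λ M → M ℕ.* Σ< t (suc M) ℕ.≤
        M ℕ.* (ℓ ℕ.* f ℕ.* (ℓ ℕ.* f) ℕ.+ ℓ ℕ.* f ℕ.* (ℓ ℕ.* f)) ℕ.+ (E ℕ.+ E)) (sym e)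
      (sum-bound N₀ t E (ℓ ℕ.* f ℕ.* (ℓ ℕ.* f)) (g-bound₀ (Y.segment 0)) (g-bound₀ (Y.segment (suc N₀)))
        (λ k+s → bounds (trans k+s (sym e))))

  f≡nκ : suc N ℕ.* κ ≡ f
  f≡nκ = ℤₚ.+-injective (trans (ℤₚ.pos-* (suc N) κ) (n·∣cycles∣ N))

  f≥1 : 1 ℕ.≤ f
  f≥1 = positive (Inj⇒∈S Inj-id)
    where
    positive : ∀ {xs : List (Perm (suc N))} → idP ∈ xs → 1 ℕ.≤ length xs
    positive {x ∷ xs} _ = ℕ.s≤s ℕ.z≤n

  -- Divided by (κ ℓ)², the second moment of P is at most (2 / n!)(1 + m² / N): the 1 comes from the
  -- sizes 0 and N, the rest from the sizes between. One of the factors `f` is spent as n κ, to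
  -- match the n of `second-moment` and the κ cycles `π`.
  moment-bound : 1 ℕ.≤ N → N ℕ.* f ℕ.* Q ℕ.≤ κ ℕ.* ℓ ℕ.* (κ ℕ.* ℓ) ℕ.* (N ℕ.+ N ℕ.+ (m ℕ.* m ℕ.+ m ℕ.* m))
  moment-bound 1≤N = cancel f f≥1 (begin
    f ℕ.* f ℕ.* (N ℕ.* f ℕ.* Q)
      ≡⟨ cong (λ t → f ℕ.* f ℕ.* (N ℕ.* t ℕ.* Q)) f≡nκ ⟨
    f ℕ.* f ℕ.* (N ℕ.* (suc N ℕ.* κ) ℕ.* Q)
      ≡⟨ arrange₁ (f ℕ.* f) N (suc N) κ Q ⟩
    κ ℕ.* (N ℕ.* (f ℕ.* f ℕ.* (suc N ℕ.* Q)))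
      ≡⟨ cong (λ t → κ ℕ.* (N ℕ.* t)) abs-moment ⟩
    κ ℕ.* (N ℕ.* ∣ ∑ K h ∣)
      ≤⟨ ℕₚ.*-monoʳ-≤ κ (∣∑∣-scaled N K (per-cycle-bound 1≤N)) ⟩
    κ ℕ.* (κ ℕ.* B)
      ≡⟨ arrange₂ f κ ℓ N m ⟩
    f ℕ.* f ℕ.* (κ ℕ.* ℓ ℕ.* (κ ℕ.* ℓ) ℕ.* (N ℕ.+ N ℕ.+ (m ℕ.* m ℕ.+ m ℕ.* m)))
      ∎)
    where
    open ℕₚ.≤-Reasoning
    h : Perm (suc N) → ℤ
    h π = ∑ (subsets N) (λ A → parity (size A) * F A π * (R̄ A * R̄⁻ A))
    cancel : ∀ f {a b} → 1 ℕ.≤ f → f ℕ.* f ℕ.* a ℕ.≤ f ℕ.* f ℕ.* b → a ℕ.≤ b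
    cancel (suc f) _ le = ℕₚ.*-cancelˡ-≤ (suc f ℕ.* suc f) le
    sq : ℤ
    sq = ∑ Sₙ (λ x → ways x * ways x)
    abs-moment : f ℕ.* f ℕ.* (suc N ℕ.* Q) ≡ ∣ ∑ K h ∣
    abs-moment = trans (sym (trans (ℤₚ.abs-* (n! * n!) (ℤ.+ suc N * sq))
      (cong₂ ℕ._*_ (ℤₚ.abs-* n! n!) (ℤₚ.abs-* (ℤ.+ suc N) sq)))) (cong ∣_∣ second-moment)
    arrange₁ : ∀ ff N n κ Q → ff ℕ.* (N ℕ.* (n ℕ.* κ) ℕ.* Q) ≡ κ ℕ.* (N ℕ.* (ff ℕ.* (n ℕ.* Q)))
    arrange₁ = ℕR.solve-∀
    arrange₂ : ∀ f κ ℓ N m → κ ℕ.* (κ ℕ.* (N ℕ.* (ℓ ℕ.* f ℕ.* (ℓ ℕ.* f) ℕ.+ ℓ ℕ.* f ℕ.* (ℓ ℕ.* f)) ℕ.+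
        (ℓ ℕ.* (f ℕ.* m) ℕ.* (ℓ ℕ.* (f ℕ.* m)) ℕ.+ ℓ ℕ.* (f ℕ.* m) ℕ.* (ℓ ℕ.* (f ℕ.* m))))) ≡
      f ℕ.* f ℕ.* (κ ℕ.* ℓ ℕ.* (κ ℕ.* ℓ) ℕ.* (N ℕ.+ N ℕ.+ (m ℕ.* m ℕ.+ m ℕ.* m)))
    arrange₂ = ℕR.solve-∀

-- The total variation distance

-- Induction on the list; the mixed terms are split by 2 a b ≤ a² + b².
cauchy-schwarz : {A : Set} (xs : List A) (f : A → ℤ) →
                 ∑ xs f * ∑ xs f ℤ.≤ ℤ.+ length xs * ∑ xs (λ x → f x * f x)
cauchy-schwarz []       f = ℤ.+≤+ ℕ.z≤n
cauchy-schwarz {A} (x ∷ xs) f = subst₂ ℤ._≤_ (sym (expandˡ a s)) (sym (expandʳ a k q))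
    (ℤₚ.+-monoʳ-≤ (a * a) (ℤₚ.+-mono-≤ mixed (cauchy-schwarz xs f)))
  where
  a s q k : ℤ
  a = f x
  s = ∑ xs f
  q = ∑ xs (λ y → f y * f y)
  k = ℤ.+ length xs
  expandˡ : ∀ a s → (a + s) * (a + s) ≡ a * a + ((a * s + a * s) + s * s)
  expandˡ = solve-∀
  expandʳ : ∀ a k q → (1ℤ + k) * (a * a + q) ≡ a * a + ((k * (a * a) + q) + k * q)
  expandʳ = solve-∀
  square : ∀ b → 0ℤ ℤ.≤ b * b
  square (ℤ.+ b)      = subst (0ℤ ℤ.≤_) (ℤₚ.pos-* b b) (ℤ.+≤+ ℕ.z≤n)
  square (ℤ.-[1+ b ]) = ℤ.+≤+ ℕ.z≤n
  pt : ∀ a b → (a - b) * (a - b) + (a * b + a * b) ≡ a * a + b * b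
  pt = solve-∀
  two : A → ℤ
  two y = a * f y + a * f y
  pointwise : ∀ {y} → y ∈ xs → two y ℤ.≤ a * a + f y * f y
  pointwise {y} _ = subst₂ ℤ._≤_ (ℤₚ.+-identityˡ (two y)) (pt a (f y)) (ℤₚ.+-monoˡ-≤ (two y) (square (a - f y)))
  mixed : a * s + a * s ℤ.≤ k * (a * a) + q
  mixed = subst₂ ℤ._≤_
    (trans (∑-+ xs (λ y → a * f y) (λ y → a * f y)) (cong₂ _+_ (∑-*ˡ xs a f) (∑-*ˡ xs a f)))
    (trans (∑-+ xs (λ _ → a * a) (λ y → f y * f y)) (cong (_+ q) (∑-const xs (a * a))))
    (∑-mono∈ xs pointwise)

nonneg-*-≤ : ∀ {a b} c → 0ℤ ℤ.≤ c → a ℤ.≤ b → c * a ℤ.≤ c * b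
nonneg-*-≤ (ℤ.+ c) _ = ℤₚ.*-monoˡ-≤-nonNeg (ℤ.+ c)

abs-square : ∀ a → ℤ.+ ∣ a ∣ * ℤ.+ ∣ a ∣ ≡ a * a
abs-square (ℤ.+ a)      = refl
abs-square (ℤ.-[1+ a ]) = refl

-- If w / Z is a distribution on `xs`, then `W` is a Z times twice its distance from the uniform
-- one. The bound measures by how much `q` exceeds Z² / a, the least second moment possible.
deviation : {A : Set} (xs : List A) (w : A → ℤ) (Z q : ℤ) → ∑ xs w ≡ Z → ∑ xs (λ x → w x * w x) ≡ q →
            let a = ℤ.+ length xs ; W = ∑ xs (λ x → ℤ.+ ∣ a * w x - Z ∣) in
            W * W ℤ.≤ a * a * (a * q - Z * Z)
deviation xs w Z q refl refl = ℤₚ.≤-trans (cauchy-schwarz xs (λ x → ℤ.+ ∣ a * w x - Z ∣)) (ℤₚ.≤-reflexive (begin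
  a * ∑ xs (λ x → ℤ.+ ∣ a * w x - Z ∣ * ℤ.+ ∣ a * w x - Z ∣)
    ≡⟨ cong (a *_) (∑-cong xs (λ x → trans (abs-square (a * w x - Z)) (expand a (w x) Z))) ⟩
  a * ∑ xs (λ x → (a * a * (w x * w x) - (a * Z + a * Z) * w x) + Z * Z)
    ≡⟨ cong (a *_) (trans (∑-+ xs (λ x → a * a * (w x * w x) - (a * Z + a * Z) * w x) (λ _ → Z * Z))
         (cong₂ _+_ (trans (∑-- xs (λ x → a * a * (w x * w x)) (λ x → (a * Z + a * Z) * w x))
                           (cong₂ _-_ (∑-*ˡ xs (a * a) (λ x → w x * w x)) (∑-*ˡ xs (a * Z + a * Z) w)))
                    (∑-const xs (Z * Z)))) ⟩
  a * ((a * a * q - (a * Z + a * Z) * Z) + a * (Z * Z))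
    ≡⟨ collect a q Z ⟩
  a * a * (a * q - Z * Z)
    ∎))
  where
  open ≡-Reasoning
  a : ℤ
  a = ℤ.+ length xs
  expand : ∀ a w Z → (a * w - Z) * (a * w - Z) ≡ (a * a * (w * w) - (a * Z + a * Z) * w) + Z * Z
  expand = solve-∀
  collect : ∀ a q Z → a * ((a * a * q - (a * Z + a * Z) * Z) + a * (Z * Z)) ≡ a * a * (a * q - Z * Z)
  collect = solve-∀

-- Clearing denominators

toℚᵘ-frac : ∀ c b → toℚᵘ (frac c (suc b)) ≃ᵘ mkℚᵘ (ℤ.+ c) b
toℚᵘ-frac c b = ℚₚ.toℚᵘ-fromℚᵘ (mkℚᵘ (ℤ.+ c) b)

toℚᵘ-∣-∣ : ∀ {p q u v} → toℚᵘ p ≃ᵘ u → toℚᵘ q ≃ᵘ v → toℚᵘ ℚ.∣ p ℚ.- q ∣ ≃ᵘ ℚᵘ.∣ u ℚᵘ.+ (ℚᵘ.- v) ∣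
toℚᵘ-∣-∣ {p} {q} {u} {v} hp hq = ℚᵘₚ.≃-trans (ℚₚ.toℚᵘ-homo-∣-∣ (p ℚ.- q)) (ℚᵘₚ.∣-∣-cong
  (ℚᵘₚ.≃-trans (ℚₚ.toℚᵘ-homo-+ p (ℚ.- q)) (ℚᵘₚ.+-cong hp
    (ℚᵘₚ.≃-trans (ℚₚ.toℚᵘ-homo‿- q) (ℚᵘₚ.-‿cong hq)))))

-- `mkℚᵘ` stores the denominator minus one, so `a ℕ.+ z ℕ.* suc a` stands for (z + 1)(a + 1).
frac-distance : ∀ c z a → toℚᵘ ℚ.∣ frac c (suc z) ℚ.- frac 1 (suc a) ∣ ≃ᵘ
                mkℚᵘ (ℤ.+ ∣ ℤ.+ suc a * ℤ.+ c - ℤ.+ suc z ∣) (a ℕ.+ z ℕ.* suc a)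
frac-distance c z a = ℚᵘₚ.≃-trans (toℚᵘ-∣-∣ {frac c (suc z)} {frac 1 (suc a)} (toℚᵘ-frac c z) (toℚᵘ-frac 1 a))
  (ℚᵘₚ.≃-reflexive (cong (λ t → mkℚᵘ (ℤ.+ ∣ t ∣) (a ℕ.+ z ℕ.* suc a)) (arrange (ℤ.+ c) (ℤ.+ suc a) (ℤ.+ suc z))))
  where
  arrange : ∀ c a z → c * a + -1ℤ * z ≡ a * c - z
  arrange = solve-∀

frac-zero : ∀ z d → toℚᵘ ℚ.∣ frac 0 (suc z) ℚ.- 0ℚ ∣ ≃ᵘ mkℚᵘ 0ℤ d
frac-zero z d = ℚᵘₚ.≃-trans (toℚᵘ-∣-∣ {frac 0 (suc z)} {0ℚ} (toℚᵘ-frac 0 z) ℚᵘₚ.≃-refl) (*≡* refl)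

-- Unnormalised fractions keep a common denominator, so the numerators can be added as integers.
toℚᵘ-sum : {A : Set} (xs : List A) (g : A → ℚ) (h : A → ℤ) (d : ℕ) → (∀ {x} → x ∈ xs → toℚᵘ (g x) ≃ᵘ mkℚᵘ (h x) d) →
           toℚᵘ (sumℚ (List.map g xs)) ≃ᵘ mkℚᵘ (∑ xs h) d
toℚᵘ-sum []       g h d e = *≡* refl
toℚᵘ-sum (x ∷ xs) g h d e = ℚᵘₚ.≃-trans (ℚₚ.toℚᵘ-homo-+ (g x) (sumℚ (List.map g xs)))
  (ℚᵘₚ.≃-trans (ℚᵘₚ.+-cong (e (here refl)) (toℚᵘ-sum xs g h d (e ∘ there)))
    (*≡* (common-denominator (h x) (∑ xs h) (ℤ.+ suc d))))
  where
  common-denominator : ∀ p q d → (p * d + q * d) * d ≡ (p + q) * (d * d)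
  common-denominator = solve-∀

-- The factor 2 in `BoundedBy` undoes the one half in `TV`; the rest is multiplied by the square of
-- the denominator `suc d`.
bounded : ∀ s W d m N → toℚᵘ s ≃ᵘ mkℚᵘ W d →
          W * W * ℤ.+ N ℤ.≤ ℤ.+ (m ℕ.* m) * (ℤ.+ suc d * ℤ.+ suc d) → BoundedBy (frac 1 2 ℚ.* s) m (suc N)
bounded s W d m N hs le = ℚₚ.toℚᵘ-cancel-≤ (ℚᵘₚ.≤-respˡ-≃ (ℚᵘₚ.≃-sym lhs) (ℚᵘₚ.≤-respʳ-≃ (ℚᵘₚ.≃-sym (toℚᵘ-frac (m ℕ.* m) 0))
    (*≤* (subst (ℤ._≤ ℤ.+ (m ℕ.* m) * (ℤ.+ suc d * ℤ.+ suc d * 1ℤ)) (sym (ℤₚ.*-identityʳ (W * W * ℤ.+ N)))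
      (subst (λ t → W * W * ℤ.+ N ℤ.≤ ℤ.+ (m ℕ.* m) * t) (sym (ℤₚ.*-identityʳ (ℤ.+ suc d * ℤ.+ suc d))) le)))))
  where
  twice : toℚᵘ (frac 2 1 ℚ.* (frac 1 2 ℚ.* s)) ≃ᵘ mkℚᵘ W d
  twice = ℚᵘₚ.≃-trans (ℚₚ.toℚᵘ-homo-* (frac 2 1) (frac 1 2 ℚ.* s))
    (ℚᵘₚ.≃-trans (ℚᵘₚ.*-cong (toℚᵘ-frac 2 0) (ℚᵘₚ.≃-trans (ℚₚ.toℚᵘ-homo-* (frac 1 2) s) (ℚᵘₚ.*-cong (toℚᵘ-frac 1 1) hs)))
      (*≡* (cancel W (ℤ.+ suc d))))
    where
    cancel : ∀ W d → (ℤ.+ 2 * (1ℤ * W)) * d ≡ W * (1ℤ * (ℤ.+ 2 * d))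
    cancel = solve-∀
  x₂ : ℚ
  x₂ = frac 2 1 ℚ.* (frac 1 2 ℚ.* s)
  lhs : toℚᵘ ((x₂ ℚ.* x₂) ℚ.* frac N 1) ≃ᵘ (mkℚᵘ W d ℚᵘ.* mkℚᵘ W d) ℚᵘ.* mkℚᵘ (ℤ.+ N) 0
  lhs = ℚᵘₚ.≃-trans (ℚₚ.toℚᵘ-homo-* (x₂ ℚ.* x₂) (frac N 1))
    (ℚᵘₚ.*-cong (ℚᵘₚ.≃-trans (ℚₚ.toℚᵘ-homo-* x₂ x₂) (ℚᵘₚ.*-cong twice twice)) (toℚᵘ-frac N 0))

∑-sgn : ∀ N → ∑ (S (suc (suc N))) sgn ≡ 0ℤ
∑-sgn N = neg-fixed⇒zero (∑ Sₙ sgn) (begin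
  ∑ Sₙ sgn                      ≡⟨ ∑-translateˡ t-inj sgn ⟨
  ∑ Sₙ (λ σ → sgn (t ⊙ σ))      ≡⟨ ∑-cong∈ Sₙ (λ {σ} σ∈ → trans (sgn-⊙ t-inj (∈S⇒Inj σ∈)) (cong (_* sgn σ) (sgn-swap (λ ())))) ⟩
  ∑ Sₙ (λ σ → -1ℤ * sgn σ)      ≡⟨ ∑-*ˡ Sₙ -1ℤ sgn ⟩
  -1ℤ * ∑ Sₙ sgn                ∎)
  where
  open ≡-Reasoning
  Sₙ = S (suc (suc N))
  t : Perm (suc (suc N))
  t = swap zero (suc zero)
  t-inj : Inj t
  t-inj = Inj-swap zero (suc zero)

indicator : Bool → ℤ
indicator b = if b then 1ℤ else 0ℤ

length-filterᵇ : {A : Set} (e : A → Bool) (xs : List A) → ℤ.+ length (filterᵇ e xs) ≡ ∑ xs (indicator ∘ e)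
length-filterᵇ e xs = trans (length-∑ (filterᵇ e xs)) (∑-filterᵇ e xs (λ _ → 1ℤ))

-- For `s` the sign and `c` equal to 1 or -1, the last hypothesis says that `e` tests for sign `c`.
-- The signs cancel in total, so half of the entries pass.
half-filter : {A : Set} (xs : List A) (e : A → Bool) (s : A → ℤ) (c : ℤ) → ∑ xs s ≡ 0ℤ →
              (∀ x → indicator (e x) + indicator (e x) ≡ 1ℤ + c * s x) →
              length (filterᵇ e xs) ℕ.+ length (filterᵇ e xs) ≡ length xs
half-filter xs e s c z h = ℤₚ.+-injective (begin
  ℤ.+ length (filterᵇ e xs) + ℤ.+ length (filterᵇ e xs)              ≡⟨ cong₂ _+_ (length-filterᵇ e xs) (length-filterᵇ e xs) ⟩
  ∑ xs (indicator ∘ e) + ∑ xs (indicator ∘ e)                        ≡⟨ ∑-+ xs (indicator ∘ e) (indicator ∘ e) ⟨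
  ∑ xs (λ x → indicator (e x) + indicator (e x))                     ≡⟨ ∑-cong xs h ⟩
  ∑ xs (λ x → 1ℤ + c * s x)                                          ≡⟨ ∑-+ xs (λ _ → 1ℤ) (λ x → c * s x) ⟩
  ∑ xs (λ _ → 1ℤ) + ∑ xs (λ x → c * s x)                             ≡⟨ cong₂ _+_ (sym (length-∑ xs)) (trans (∑-*ˡ xs c s) (trans (cong (c *_) z) (ℤₚ.*-zeroʳ c))) ⟩
  ℤ.+ length xs + 0ℤ                                                 ≡⟨ ℤₚ.+-identityʳ (ℤ.+ length xs) ⟩
  ℤ.+ length xs                                                      ∎)
  where open ≡-Reasoning

isOdd : Perm n → Bool
isOdd σ = if isEven σ then false else true

∣An∣ : ∀ N → length (An (suc (suc N))) ℕ.+ length (An (suc (suc N))) ≡ length (S (suc (suc N)))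
∣An∣ N = half-filter (S (suc (suc N))) isEven sgn 1ℤ (∑-sgn N) λ σ → go (isEven σ) (sgn-isEven σ)
  where
  go : ∀ b {s} → s ≡ (if b then 1ℤ else -1ℤ) → indicator b + indicator b ≡ 1ℤ + 1ℤ * s
  go true  refl = refl
  go false refl = refl

∣Anc∣ : ∀ N → length (Anc (suc (suc N))) ℕ.+ length (Anc (suc (suc N))) ≡ length (S (suc (suc N)))
∣Anc∣ N = half-filter (S (suc (suc N))) isOdd sgn -1ℤ (∑-sgn N) λ σ → go (isEven σ) (sgn-isEven σ)
  where
  go : ∀ b {s} → s ≡ (if b then 1ℤ else -1ℤ) →
       indicator (if b then false else true) + indicator (if b then false else true) ≡ 1ℤ + -1ℤ * s
  go true  refl = refl
  go false refl = refl

isEven-· : {π σ : Perm n} → Inj π → Inj σ → isEven (π · σ) ≡ (if isEven π then isEven σ else isOdd σ)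
isEven-· {π = π} {σ} p q = go (isEven (π · σ)) (isEven π) (isEven σ)
  (trans (sym (sgn-isEven (π · σ))) (trans (cong sgn (sym (⊙-def π σ)))
    (trans (sgn-⊙ p q) (cong₂ _*_ (sgn-isEven π) (sgn-isEven σ)))))
  where
  go : ∀ a b c → (if a then 1ℤ else -1ℤ) ≡ (if b then 1ℤ else -1ℤ) * (if c then 1ℤ else -1ℤ) →
       a ≡ (if b then c else (if c then false else true))
  go true  true  true  _ = refl
  go true  false false _ = refl
  go false true  false _ = refl
  go false false true  _ = refl
  go true  true  false ()
  go true  false true  ()
  go false true  true  ()
  go false false false ()

-- Treats both parities at once: `e` is the test for the half of the group in question, it holds on
-- all products, and it selects half of the permutations.
module Distance (N : ℕ) (l : List ℕ) (part : IsPartition (suc N) l) (1≤N : 1 ℕ.≤ N)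
                (e : Perm (suc N) → Bool)
                (supported : ∀ {π σ} → π ∈ C (suc N) [ suc N ] → σ ∈ C (suc N) l → e (π · σ) ≡ true)
                (half : length (filterᵇ e (S (suc N))) ℕ.+ length (filterᵇ e (S (suc N))) ≡ length (S (suc N))) where

  private
    m : ℕ
    m = 1 ℕ.⊔ ones l

    1≤m : 1 ℕ.≤ m
    1≤m = ℕₚ.m≤m⊔n 1 (ones l)

    few-fixpts : ∀ {σ} → σ ∈ C (suc N) l → fixpts σ ℤ.≤ ℤ.+ m
    few-fixpts {σ} σ∈ = ℤₚ.≤-trans (fixpts-≤ (∈C⇒Inj l σ∈))
      (ℤₚ.≤-trans (ℤₚ.≤-reflexive (proj₂ (∈C⇒ l σ∈) (ℕ.s≤s ℕ.z≤n))) (ℤ.+≤+ (ℕₚ.m≤n⊔m 1 (ones l))))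

    open Product N l
    open Bounds N l m 1≤m few-fixpts

    X : List (Perm (suc N))
    X = filterᵇ e Sₙ

    a Z : ℕ
    a = length X
    Z = κ ℕ.* ℓ

    q : ℤ
    q = ∑ Sₙ (λ x → ways x * ways x)

    cnt : Perm (suc N) → ℕ
    cnt x = length (concatMap (λ π → filterᵇ (λ σ → (π · σ) ==P x) L) K)

    cnt-ways : ∀ x → ℤ.+ cnt x ≡ ways x
    cnt-ways x = begin
      ℤ.+ cnt x
        ≡⟨ length-∑ (concatMap (λ π → filterᵇ (λ σ → (π · σ) ==P x) L) K) ⟩
      ∑ (concatMap (λ π → filterᵇ (λ σ → (π · σ) ==P x) L) K) (λ _ → 1ℤ)
        ≡⟨ ∑-concatMap (λ π → filterᵇ (λ σ → (π · σ) ==P x) L) K (λ _ → 1ℤ) ⟩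
      ∑ K (λ π → ∑ (filterᵇ (λ σ → (π · σ) ==P x) L) (λ _ → 1ℤ))
        ≡⟨ ∑-cong K (λ π → trans (∑-filterᵇ (λ σ → (π · σ) ==P x) L (λ _ → 1ℤ))
             (∑-cong L (λ σ → trans (cong (λ y → indicator (y ==P x)) (sym (⊙-def π σ))) (isYes-ι ((π ⊙ σ) ≟P x))))) ⟩
      ways x
        ∎
      where
      open ≡-Reasoning
      isYes-ι : {A : Set} (d : Dec A) → indicator ⌊ d ⌋ ≡ ι d
      isYes-ι (yes _) = refl
      isYes-ι (no _)  = refl

    ways-off : ∀ {x} → e x ≡ false → ways x ≡ 0ℤ
    ways-off {x} off = ∑-zero∈ K λ {π} π∈ → ∑-zero∈ L λ {σ} σ∈ → ι-no ((π ⊙ σ) ≟P x) λ eq →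
      true≢false (supported π∈ σ∈) (trans (cong e (trans (sym (⊙-def π σ)) eq)) off)

    restrict : (h : Perm (suc N) → ℤ) → (∀ {x} → e x ≡ false → h x ≡ 0ℤ) → ∑ X h ≡ ∑ Sₙ h
    restrict h off = trans (∑-filterᵇ e Sₙ h) (∑-cong Sₙ go)
      where
      go : ∀ x → (if e x then h x else 0ℤ) ≡ h x
      go x with bool-cases (e x)
      ... | inj₁ t = cong (λ b → if b then h x else 0ℤ) t
      ... | inj₂ u = trans (cong (λ b → if b then h x else 0ℤ) u) (sym (off u))

    total-ways : ∑ X ways ≡ ℤ.+ Z
    total-ways = begin
      ∑ X ways                             ≡⟨ restrict ways ways-off ⟩
      ∑ Sₙ ways                            ≡⟨ ∑-cong Sₙ (λ x → ℤₚ.*-identityʳ (ways x)) ⟨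
      ∑ Sₙ (λ x → ways x * 1ℤ)             ≡⟨ ∑-ways (λ _ → 1ℤ) ⟩
      ∑ K (λ _ → ∑ L (λ _ → 1ℤ))           ≡⟨ ∑-const K (∑ L (λ _ → 1ℤ)) ⟩
      ℤ.+ κ * ∑ L (λ _ → 1ℤ)               ≡⟨ cong (ℤ.+ κ *_) (length-∑ L) ⟨
      ℤ.+ κ * ℤ.+ ℓ                        ≡⟨ ℤₚ.pos-* κ ℓ ⟨
      ℤ.+ Z                                ∎
      where open ≡-Reasoning

    square-ways : ∑ X (λ x → ways x * ways x) ≡ q
    square-ways = restrict (λ x → ways x * ways x) λ {x} off →
      trans (cong (_* ways x) (ways-off off)) (ℤₚ.*-zeroˡ (ways x))

    W : ℤ
    W = ∑ X (λ x → ℤ.+ ∣ ℤ.+ a * ways x - ℤ.+ Z ∣)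

    q≡Q : ℤ.+ Q ≡ q
    q≡Q = ℤₚ.0≤i⇒+∣i∣≡i (∑-nonneg Sₙ λ x → subst (0ℤ ℤ.≤_) (abs-square (ways x))
            (subst (0ℤ ℤ.≤_) (ℤₚ.pos-* ∣ ways x ∣ ∣ ways x ∣) (ℤ.+≤+ ℕ.z≤n)))

    -- Since n! is twice `a`, the factor 2 due to the two one-dimensional representations in
    -- `moment-bound` drops out.
    moment : N ℕ.* (a ℕ.* Q) ℕ.≤ Z ℕ.* Z ℕ.* (N ℕ.+ m ℕ.* m)
    moment = ℕₚ.*-cancelˡ-≤ 2 (subst₂ ℕ._≤_
        (trans (cong (λ t → N ℕ.* t ℕ.* Q) (sym half)) (double₁ N a Q)) (double₂ (Z ℕ.* Z) N (m ℕ.* m)) (moment-bound 1≤N))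
      where
      double₁ : ∀ N a Q → N ℕ.* (a ℕ.+ a) ℕ.* Q ≡ 2 ℕ.* (N ℕ.* (a ℕ.* Q))
      double₁ = ℕR.solve-∀
      double₂ : ∀ z N s → z ℕ.* (N ℕ.+ N ℕ.+ (s ℕ.+ s)) ≡ 2 ℕ.* (z ℕ.* (N ℕ.+ s))
      double₂ = ℕR.solve-∀

    W-bound : W * W * ℤ.+ N ℤ.≤ ℤ.+ (m ℕ.* m) * (ℤ.+ (Z ℕ.* a) * ℤ.+ (Z ℕ.* a))
    W-bound = begin
      W * W * ℤ.+ N
        ≡⟨ ℤₚ.*-comm (W * W) (ℤ.+ N) ⟩
      ℤ.+ N * (W * W)
        ≤⟨ nonneg-*-≤ (ℤ.+ N) (ℤ.+≤+ ℕ.z≤n) (deviation X ways (ℤ.+ Z) q total-ways square-ways) ⟩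
      ℤ.+ N * (A * A * (A * q - z * z))
        ≡⟨ rearrange (ℤ.+ N) A q z ⟩
      A * A * (ℤ.+ N * (A * q) - ℤ.+ N * (z * z))
        ≤⟨ nonneg-*-≤ (A * A) (subst (0ℤ ℤ.≤_) (ℤₚ.pos-* a a) (ℤ.+≤+ ℕ.z≤n)) (ℤₚ.+-monoˡ-≤ (- (ℤ.+ N * (z * z))) momentℤ) ⟩
      -- The part N z² of the bound is what the uniform distribution on `X` accounts for. It
      -- cancels, and only m² z² remains.
      A * A * (z * z * (ℤ.+ N + M) - ℤ.+ N * (z * z))
        ≡⟨ finish A z (ℤ.+ N) M ⟩
      M * (z * A * (z * A))
        ≡⟨ cong (λ t → M * (t * t)) (ℤₚ.pos-* Z a) ⟨
      M * (ℤ.+ (Z ℕ.* a) * ℤ.+ (Z ℕ.* a))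
        ∎
      where
      open ℤₚ.≤-Reasoning
      A z M : ℤ
      A = ℤ.+ a
      z = ℤ.+ Z
      M = ℤ.+ (m ℕ.* m)
      rearrange : ∀ N A q z → N * (A * A * (A * q - z * z)) ≡ A * A * (N * (A * q) - N * (z * z))
      rearrange = solve-∀
      finish : ∀ A z N M → A * A * (z * z * (N + M) - N * (z * z)) ≡ M * (z * A * (z * A))
      finish = solve-∀
      momentℤ : ℤ.+ N * (A * q) ℤ.≤ z * z * (ℤ.+ N + M)
      momentℤ = subst₂ ℤ._≤_
        (trans (ℤₚ.pos-* N (a ℕ.* Q)) (cong (ℤ.+ N *_) (trans (ℤₚ.pos-* a Q) (cong (A *_) q≡Q))))
        (trans (ℤₚ.pos-* (Z ℕ.* Z) (N ℕ.+ m ℕ.* m)) (cong (_* (ℤ.+ N + M)) (ℤₚ.pos-* Z Z)))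
        (ℤ.+≤+ moment)

    memberP-e : ∀ {x} → x ∈ Sₙ → memberP x X ≡ e x
    memberP-e {x} x∈ with bool-cases (e x)
    ... | inj₁ t = trans (T⇒≡ (Anyₚ.any⁺ (x ==P_) (found (∈ₚ.∈-filter⁺ _ x∈ (≡⇒T t))))) (sym t)
      where
      found : ∀ {ys} → x ∈ ys → Any (λ y → T (x ==P y)) ys
      found (there p)   = Any.there (found p)
      found (here refl) = Any.here (go (x ≟P x))
        where
        go : (d : Dec (x ≡ x)) → T ⌊ d ⌋
        go (yes _) = _
        go (no ¬p) = ¬p refl
    ... | inj₂ u with bool-cases (memberP x X)
    ...   | inj₂ f = trans f (sym u)
    ...   | inj₁ t = ⊥-elim (true≢false (T⇒≡ (proj₂ (∈ₚ.∈-filter⁻ _ {xs = Sₙ} (lost (Anyₚ.any⁻ (x ==P_) X (≡⇒T t)))))) u)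
      where
      equal : ∀ {y} (d : Dec (x ≡ y)) → T ⌊ d ⌋ → x ≡ y
      equal (yes p) _ = p
      lost : ∀ {ys} → Any (λ y → T (x ==P y)) ys → x ∈ ys
      lost {y ∷ ys} (Any.here t)  = here (equal (x ≟P y) t)
      lost          (Any.there p) = there (lost p)

    -- Positivity of `κ`, `ℓ` and `a` keeps `frac` away from its default value at denominator 0.
    κ≥1 : 1 ℕ.≤ κ
    κ≥1 = positive (proj₂ (full-cycle N))
      where
      positive : ∀ {x} {xs : List (Perm (suc N))} → x ∈ xs → 1 ℕ.≤ length xs
      positive {xs = x ∷ xs} _ = ℕ.s≤s ℕ.z≤n

    ℓ≥1 : 1 ℕ.≤ ℓ
    ℓ≥1 = positive (proj₂ (C-nonempty part))
      where
      positive : ∀ {x} {xs : List (Perm (suc N))} → x ∈ xs → 1 ℕ.≤ length xs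
      positive {xs = x ∷ xs} _ = ℕ.s≤s ℕ.z≤n

    a≥1 : 1 ℕ.≤ a
    a≥1 = go a half
      where
      go : ∀ b → b ℕ.+ b ≡ f → 1 ℕ.≤ b
      go zero    eq = ⊥-elim (ℕₚ.<⇒≢ f≥1 eq)
      go (suc b) _  = ℕ.s≤s ℕ.z≤n

    d : Perm (suc N) → ℤ
    d x = if e x then ℤ.+ ∣ ℤ.+ a * ways x - ℤ.+ Z ∣ else 0ℤ

    at : ∀ z a′ → Z ≡ suc z → a ≡ suc a′ → ∀ {x} → x ∈ Sₙ →
         toℚᵘ ℚ.∣ frac (cnt x) Z ℚ.- (if memberP x X then frac 1 a else 0ℚ) ∣ ≃ᵘ mkℚᵘ (d x) (a′ ℕ.+ z ℕ.* suc a′)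
    at z a′ Z≡ a≡ {x} x∈ = subst
        (λ b → toℚᵘ ℚ.∣ frac (cnt x) Z ℚ.- (if b then frac 1 a else 0ℚ) ∣ ≃ᵘ mkℚᵘ (d x) (a′ ℕ.+ z ℕ.* suc a′))
        (sym (memberP-e x∈)) (go (e x) refl)
      where
      go : ∀ b → e x ≡ b → toℚᵘ ℚ.∣ frac (cnt x) Z ℚ.- (if b then frac 1 a else 0ℚ) ∣ ≃ᵘ mkℚᵘ (d x) (a′ ℕ.+ z ℕ.* suc a′)
      go true ex = subst₂ (λ Z′ a″ → toℚᵘ ℚ.∣ frac (cnt x) Z′ ℚ.- frac 1 a″ ∣ ≃ᵘ mkℚᵘ (d x) (a′ ℕ.+ z ℕ.* suc a′))
          (sym Z≡) (sym a≡) (subst (λ t → toℚᵘ ℚ.∣ frac (cnt x) (suc z) ℚ.- frac 1 (suc a′) ∣ ≃ᵘ mkℚᵘ t (a′ ℕ.+ z ℕ.* suc a′))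
            dx (frac-distance (cnt x) z a′))
        where
        dx : ℤ.+ ∣ ℤ.+ suc a′ * ℤ.+ cnt x - ℤ.+ suc z ∣ ≡ d x
        dx = trans (cong (λ t → ℤ.+ ∣ t ∣) (trans (cong (λ t → ℤ.+ suc a′ * t - ℤ.+ suc z) (cnt-ways x))
               (cong₂ (λ A B → ℤ.+ A * ways x - ℤ.+ B) (sym a≡) (sym Z≡))))
               (cong (λ b → if b then ℤ.+ ∣ ℤ.+ a * ways x - ℤ.+ Z ∣ else 0ℤ) (sym ex))
      -- Outside `X` both distributions vanish, so the term is 0 over the common denominator.
      go false ex = subst (λ t → toℚᵘ ℚ.∣ frac (cnt x) Z ℚ.- 0ℚ ∣ ≃ᵘ mkℚᵘ t (a′ ℕ.+ z ℕ.* suc a′))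
          (cong (λ b → if b then ℤ.+ ∣ ℤ.+ a * ways x - ℤ.+ Z ∣ else 0ℤ) (sym ex))
          (subst₂ (λ c Z′ → toℚᵘ ℚ.∣ frac c Z′ ℚ.- 0ℚ ∣ ≃ᵘ mkℚᵘ 0ℤ (a′ ℕ.+ z ℕ.* suc a′))
            (sym cnt≡0) (sym Z≡) (frac-zero z (a′ ℕ.+ z ℕ.* suc a′)))
        where
        cnt≡0 : cnt x ≡ 0
        cnt≡0 = ℤₚ.+-injective (trans (cnt-ways x) (ways-off ex))

  bound : BoundedBy (TV (suc N) (P (suc N) [ suc N ] l) (U (suc N) X)) m (suc N)
  bound = go Z a refl refl (ℕₚ.*-mono-≤ κ≥1 ℓ≥1) a≥1
    where
    go : ∀ Z′ a″ → Z ≡ Z′ → a ≡ a″ → 1 ℕ.≤ Z′ → 1 ℕ.≤ a″ →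
         BoundedBy (TV (suc N) (P (suc N) [ suc N ] l) (U (suc N) X)) m (suc N)
    go (suc z) (suc a′) Z≡ a≡ _ _ = bounded
      (sumℚ (List.map g Sₙ)) W (a′ ℕ.+ z ℕ.* suc a′) m N
      (subst (λ t → toℚᵘ (sumℚ (List.map g Sₙ)) ≃ᵘ mkℚᵘ t (a′ ℕ.+ z ℕ.* suc a′)) (sym (∑-filterᵇ e Sₙ (λ x → ℤ.+ ∣ ℤ.+ a * ways x - ℤ.+ Z ∣)))
        (toℚᵘ-sum Sₙ g d (a′ ℕ.+ z ℕ.* suc a′) (at z a′ Z≡ a≡)))
      (subst (λ t → W * W * ℤ.+ N ℤ.≤ ℤ.+ (m ℕ.* m) * (ℤ.+ t * ℤ.+ t)) (cong₂ ℕ._*_ Z≡ a≡) W-bound)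
      where
      g : Perm (suc N) → ℚ
      g x = ℚ.∣ P (suc N) [ suc N ] l x ℚ.- U (suc N) X x ∣

theorem1 : (n : ℕ) → 2 ≤ n → (λ′ : List ℕ) → IsPartition n λ′ →
    (((EvenPartition n [ n ] × EvenPartition n λ′) ⊎ (OddPartition n [ n ] × OddPartition n λ′)) →
    BoundedBy (TV n (P n [ n ] λ′) (U n (An n))) (1 ⊔ ones λ′) n)
    ×
    (((EvenPartition n [ n ] × OddPartition n λ′) ⊎ (OddPartition n [ n ] × EvenPartition n λ′)) →
    BoundedBy (TV n (P n [ n ] λ′) (U n (Anc n))) (1 ⊔ ones λ′) n)
theorem1 (suc zero)    (ℕ.s≤s ())
theorem1 (suc (suc N)) _ λ′ part =
  (λ same → Distance.bound (suc N) λ′ part (ℕ.s≤s ℕ.z≤n) isEven (λ π∈ σ∈ → products-even same π∈ σ∈) (∣An∣ N)) ,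
  (λ opposite → Distance.bound (suc N) λ′ part (ℕ.s≤s ℕ.z≤n) isOdd (λ π∈ σ∈ → products-odd opposite π∈ σ∈) (∣Anc∣ N))
  where
  top : ℕ
  top = suc (suc N)
  parity-of : ∀ {π σ b c} → π ∈ C top [ top ] → σ ∈ C top λ′ → isEven π ≡ b → isEven σ ≡ c →
              isEven (π · σ) ≡ (if b then c else (if c then false else true))
  parity-of π∈ σ∈ refl refl = isEven-· (∈C⇒Inj [ top ] π∈) (∈C⇒Inj λ′ σ∈)
  products-even : (EvenPartition top [ top ] × EvenPartition top λ′) ⊎ (OddPartition top [ top ] × OddPartition top λ′) →
                  ∀ {π σ} → π ∈ C top [ top ] → σ ∈ C top λ′ → isEven (π · σ) ≡ true
  products-even (inj₁ (h , k)) π∈ σ∈ = parity-of π∈ σ∈ (All.lookup h π∈) (All.lookup k σ∈)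
  products-even (inj₂ (h , k)) π∈ σ∈ = parity-of π∈ σ∈ (All.lookup h π∈) (All.lookup k σ∈)
  products-odd : (EvenPartition top [ top ] × OddPartition top λ′) ⊎ (OddPartition top [ top ] × EvenPartition top λ′) →
                 ∀ {π σ} → π ∈ C top [ top ] → σ ∈ C top λ′ → isOdd (π · σ) ≡ true
  products-odd (inj₁ (h , k)) π∈ σ∈ =
    cong (λ b → if b then false else true) (parity-of π∈ σ∈ (All.lookup h π∈) (All.lookup k σ∈))
  products-odd (inj₂ (h , k)) π∈ σ∈ =
    cong (λ b → if b then false else true) (parity-of π∈ σ∈ (All.lookup h π∈) (All.lookup k σ∈))
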